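{- There is a Turing machine $M_{\mathrm{subst}}$ that, given two binary numbers $k,m$ and a term $s$, halts in time $O(k\cdot p(\min(m,\mathrm{Space}(s))))$ for some polynomial $p$ and in space $O(\min(m,\mathrm{Space}(s))+\log m+\log k)$, and whose result is one of the following. Either it outputs a term $t$; then $s$ has normal form $t$, $m\ge\mathrm{Space}(s)$ and $k\ge 3\cdot\mathrm{Time}(s)+1$. Or it halts in a final state named "space bound reached", which implies $m\le 2\cdot\mathrm{Space}(s)$. Or it halts in a final state named "space bound not reached", which implies $k<3\cdot\mathrm{Time}(s)+1$.
   Context: $\mathsf{L}$-terms in de Bruijn notation: $s::=n\mid st\mid\lambda s$, size $|n|=1+n$, $|\lambda s|=1+|s|$, $|st|=1+|s|+|t|$. Substitution $k^k_u=u$, $n^k_u=n$ ($n\ne k$), $(st)^k_u=(s^k_u)(t^k_u)$, $(\lambda s)^k_u=\lambda(s^{k+1}_u)$. Reduction: $(\lambda s)(\lambda t)\succ s^0_{\lambda t}$; $s\succ s'\Rightarrow st\succ s't$; $t\succ t'\Rightarrow(\lambda s)t\succ(\lambda s)t'$ (deterministic). If $s=s_0\succ\cdots\succ s_j$ with $s_j$ an abstraction (the normal form of $s$), then $\mathrm{Time}(s)=j$ and $\mathrm{Space}(s)=\max_i|s_i|$; if $s$ does not reduce to an abstraction, $\mathrm{Time}(s)=\mathrm{Space}(s)=\infty$. Terms are stored on tapes as the program $\gamma s$ (lists over the commands $\mathsf{ret},\mathsf{var}\,n,\mathsf{lam},\mathsf{app}$ with $\gamma n=[\mathsf{var}\,n]$,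 $\gamma(st)=\gamma s++\gamma t++[\mathsf{app}]$, $\gamma(\lambda s)=\mathsf{lam}::\gamma s++[\mathsf{ret}]$), de Bruijn indices written in unary. -}

module Defs where

open import Data.Bool.Base using (Bool; true; false)
open import Data.Fin.Base using (Fin)
open import Data.List.Base using (List; []; _∷_; _++_; [_]; map; concatMap; replicate; reverse; foldr; length)
open import Data.Maybe.Base using (Maybe; just; nothing)
open import Data.Nat.Base using (ℕ; zero; suc; _+_; _*_; _≤_; _<_; _⊔_; _⊓_)
open import Data.Nat.Properties using (_≟_)
open import Data.Product.Base using (_×_; _,_; ∃; ∃₂)
open import Data.Vec.Base as Vec using (Vec; []; _∷_)
open import Relation.Binary.PropositionalEquality.Core using (_≡_)
open import Relation.Nullary.Decidable.Core using (yes; no)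
open import Relation.Nullary.Negation.Core using (¬_)
import Relation.Binary.Construct.Add.Supremum.NonStrict as NonStrict
import Relation.Binary.Construct.Add.Supremum.Strict as Strict
import Relation.Nullary.Construct.Add.Supremum as Sup

open Sup public using (_⁺; ⊤⁺)

ℕ∞ : Set
ℕ∞ = ℕ ⁺

pattern fin n = Sup.[ n ]
pattern ∞     = Sup.⊤⁺

open NonStrict _≤_ public using () renaming (_≤⁺_ to _≤∞_)
open Strict    _<_ public using () renaming (_<⁺_ to _<∞_)

-- The minimum with a finite number is always finite.
min∞ : ℕ → ℕ∞ → ℕ
min∞ m (fin n) = m ⊓ n
min∞ m ∞       = m

infixl 7 _*∞_
infixl 6 _+∞_

-- Only used with a nonzero left factor, hence a * ∞ = ∞.
_*∞_ : (a : ℕ) → ℕ∞ → ℕ∞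
a *∞ fin n = fin (a * n)
a *∞ ∞     = ∞

_+∞_ : ℕ∞ → ℕ → ℕ∞
fin n +∞ b = fin (n + b)
∞     +∞ b = ∞

infixl 9 _·_

data Term : Set where
  #_  : ℕ → Term
  _·_ : Term → Term → Term
  ƛ_  : Term → Term

size : Term → ℕ
size (# n)   = 1 + n
size (s · t) = 1 + size s + size t
size (ƛ s)   = 1 + size s

subst : Term → ℕ → Term → Term
subst (# n)   k u with n ≟ k
... | yes _ = u
... | no  _ = # n
subst (s · t) k u = subst s k u · subst t k u
subst (ƛ s)   k u = ƛ (subst s (suc k) u)

infix 4 _≻_

data _≻_ : Term → Term → Set where
  β   : ∀ {s t}             → (ƛ s) · (ƛ t) ≻ subst s 0 (ƛ t)
  ξₗ  : ∀ {s s′ t} → s ≻ s′ → s · t ≻ s′ · t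
  ξᵣ  : ∀ {s t t′} → t ≻ t′ → (ƛ s) · t ≻ (ƛ s) · t′

-- s ⇓⟨ j , n ⟩ t : there is a reduction s = s₀ ≻ ⋯ ≻ sⱼ = t to an
-- abstraction t, and n is the maximum of the sizes of s₀, …, sⱼ.

infix 4 _⇓⟨_,_⟩_

data _⇓⟨_,_⟩_ : Term → ℕ → ℕ → Term → Set where
  done : ∀ {s} → ƛ s ⇓⟨ 0 , size (ƛ s) ⟩ ƛ s
  _◅_  : ∀ {s s′ t j n} → s ≻ s′ → s′ ⇓⟨ j , n ⟩ t →
         s ⇓⟨ suc j , size s ⊔ n ⟩ t

HasNormalForm : Term → Term → Set
HasNormalForm s t = ∃₂ λ j n → s ⇓⟨ j , n ⟩ t

-- Whether a term normalises is undecidable, so Time and Space are given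
-- by their graphs: IsTime s τ means Time(s) = τ.

IsTime : Term → ℕ∞ → Set
IsTime s (fin j) = ∃₂ λ n t → s ⇓⟨ j , n ⟩ t
IsTime s ∞       = ¬ ∃ (HasNormalForm s)

IsSpace : Term → ℕ∞ → Set
IsSpace s (fin n) = ∃₂ λ j t → s ⇓⟨ j , n ⟩ t
IsSpace s ∞       = ¬ ∃ (HasNormalForm s)

data Com : Set where
  ret lam app : Com
  var         : ℕ → Com

γ : Term → List Com
γ (# n)   = [ var n ]
γ (s · t) = γ s ++ γ t ++ [ app ]
γ (ƛ s)   = lam ∷ γ s ++ [ ret ]

-- A machine may use `a` additional symbols of its own. The symbol ▷
-- initially marks the leftmost cell of each tape.

data Symbol (a : ℕ) : Set where
  ␣ ▷                : Symbol a
  bit                : Bool → Symbol a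
  RET LAM APP VAR ∣  : Symbol a
  aux                : Fin a → Symbol a

encodeCom : ∀ {a} → Com → List (Symbol a)
encodeCom ret     = [ RET ]
encodeCom lam     = [ LAM ]
encodeCom app     = [ APP ]
encodeCom (var n) = VAR ∷ replicate n ∣

encodeTerm : ∀ {a} → Term → List (Symbol a)
encodeTerm s = concatMap encodeCom (γ s)

increment : List Bool → List Bool
increment []           = [ true ]
increment (false ∷ bs) = true ∷ bs
increment (true  ∷ bs) = false ∷ increment bs

-- Least significant bit first, without superfluous zeros.
binary : ℕ → List Bool
binary zero    = []
binary (suc n) = increment (binary n)

encodeℕ : ∀ {a} → ℕ → List (Symbol a)
encodeℕ n = map bit (binary n)

-- Tapes are infinite to the right only: `left` lists all cells to the
-- left of the head, nearest first, so that the head is on the cell with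
-- index `length left`. Cells beyond the end of `right` are blank.

record Tape (a : ℕ) : Set where
  constructor tape
  field
    left  : List (Symbol a)
    head  : Symbol a
    right : List (Symbol a)

data Move : Set where
  L N R : Move

write : ∀ {a} → Symbol a → Tape a → Tape a
write x (tape ls _ rs) = tape ls x rs

-- Moving left on the leftmost cell has no effect.
move : ∀ {a} → Move → Tape a → Tape a
move N t                    = t
move L (tape []       x rs) = tape [] x rs
move L (tape (l ∷ ls) x rs) = tape ls l (x ∷ rs)
move R (tape ls x [])       = tape (x ∷ ls) ␣ []
move R (tape ls x (r ∷ rs)) = tape (x ∷ ls) r rs

inputTape : ∀ {a} → List (Symbol a) → Tape a
inputTape w = tape [] ▷ w

Holds : ∀ {a} → Tape a → List (Symbol a) → Set
Holds (tape ls x rs) w =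
  ∃ λ b → reverse ls ++ x ∷ rs ≡ ▷ ∷ w ++ replicate b ␣

-- A state q is final, with the name r, iff final q ≡ just r.

record TM (Name : Set) (n : ℕ) : Set where
  field
    auxiliary : ℕ
    states    : ℕ
    start     : Fin states
    final     : Fin states → Maybe Name
    δ         : Fin states → Vec (Symbol auxiliary) n →
                Fin states × Vec (Symbol auxiliary × Move) n

module Run {Name : Set} {n : ℕ} (M : TM Name n) where
  open TM M

  Tapes : Set
  Tapes = Vec (Tape auxiliary) n

  Config : Set
  Config = Fin states × Tapes

  step : Config → Config
  step (q , ts) =
    let q′ , as = δ q (Vec.map Tape.head ts)
    in  q′ , Vec.zipWith (λ (x , d) t → move d (write x t)) as ts

  -- Heads start on the leftmost cell and move by at most one cell per
  -- step, so the number of cells a head visits during a run is the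
  -- maximum of this number over the run.
  headPositions : Tapes → Vec ℕ n
  headPositions = Vec.map (λ t → suc (length (Tape.left t)))

  -- HaltsFrom c time visited r ts : started in c, the machine reaches its
  -- first final state, named r, after `time` steps with tapes ts; `visited`
  -- is the tapewise maximum of headPositions.
  data HaltsFrom : Config → ℕ → Vec ℕ n → Name → Tapes → Set where
    halt : ∀ {q ts r} → final q ≡ just r →
           HaltsFrom (q , ts) 0 (headPositions ts) r ts
    next : ∀ {q ts time visited r ts′} → final q ≡ nothing →
           HaltsFrom (step (q , ts)) time visited r ts′ →
           HaltsFrom (q , ts) (suc time)
             (Vec.zipWith _⊔_ (headPositions ts) visited) r ts′

  -- The total number of cells visited on all tapes. Input cells that are
  -- never visited do not count, which permits space below the input size.
  Halts : Tapes → ℕ → ℕ → Name → Tapes → Set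
  Halts ts time space r ts′ =
    ∃ λ visited → HaltsFrom (start , ts) time visited r ts′ × Vec.sum visited ≡ space

open Run public using (Tapes; Halts)

data Verdict : Set where
  term                 : Verdict
  spaceBoundReached    : Verdict
  spaceBoundNotReached : Verdict

-- Tapes for k, m, s and the output, followed by w work tapes. On a shared
-- input tape, moving past m would already take time depending on m.
inputs : ∀ {w} (M : TM Verdict (4 + w)) → ℕ → ℕ → Term → Tapes M
inputs {w} M k m s =
  inputTape (encodeℕ k) ∷ inputTape (encodeℕ m) ∷ inputTape (encodeTerm s) ∷
  inputTape [] ∷ Vec.replicate w (inputTape [])

Outputs : ∀ {w} (M : TM Verdict (4 + w)) → Tapes M → Term → Set
Outputs M (_ ∷ _ ∷ _ ∷ out ∷ _) t = Holds out (encodeTerm t)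

-- Coefficients in ℕ, the constant one first.
Polynomial : Set
Polynomial = List ℕ

⟦_⟧ : Polynomial → ℕ → ℕ
⟦ p ⟧ x = foldr (λ a r → a + x * r) 0 p

-- f ∈ O(g) is read as: there is c with f x ≤[ c ] g x for all x. The
-- additive constant matters only where g vanishes: no machine can halt
-- in 0 steps on some inputs without doing so on all.
infix 4 _≤[_]_

_≤[_]_ : ℕ → ℕ → ℕ → Set
x ≤[ c ] y = x ≤ c * y + c

{-# OPTIONS --safe #-}

-- The machine evaluates the code of s like a postfix expression. Finished
-- abstractions move from a stack of commands to a stack of values, and app
-- contracts the two topmost values by naive substitution; at any time the
-- two stacks hold the current term. Each contraction takes three units from
-- k, and counting down in binary has constant amortised cost. The size of
-- the term is counted in binary as well, and one more digit of m is read only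
-- when that counter grows by a digit. So reading m costs no more than the
-- logarithm of the space in use, and running out of digits means that a term
-- has size at least 2 ^ ⌊log₂ m ⌋ > m / 2.
--
-- The Turing machine is compiled from a structured language of stack
-- programs. Its semantics Halt is a big-step semantics with explicit
-- continuations that bounds time and tape usage, and compilation preserves
-- these bounds.

module Submission where

open import Data.Bool using (Bool; true; false; if_then_else_)
open import Data.Fin using (Fin; zero; suc; join; splitAt; combine; remQuot) renaming (#_ to tape#_)
open import Data.Fin.Properties using (splitAt-join; remQuot-combine) renaming (_≟_ to _≟ᶠ_)
open import Data.List using (List; []; _∷_; _++_; map; length; head; drop; reverse; concatMap; replicate; _ʳ++_)
open import Data.List.Properties using (length-++; length-map; length-ʳ++; ʳ++-ʳ++; ++-assoc; ++-identityʳ; concatMap-++; map-∘; reverse-++; reverse-map)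
open import Data.Maybe as Maybe using (Maybe; just; nothing; is-just; fromMaybe; maybe)
open import Data.Nat
open import Data.Nat.Logarithm using (⌊log₂_⌋; ⌊log₂⌋-mono-≤; ⌊log₂[2^n]⌋≡n)
open import Data.Nat.Properties
open import Data.Nat.Tactic.RingSolver using (solve-∀)
open import Data.Product using (Σ; ∃; ∃₂; _×_; _,_; proj₁; proj₂; map₁)
open import Data.Sum as Sum using (_⊎_; inj₁; inj₂)
open import Data.Unit using (⊤; tt)
open import Data.Vec as Vec using (Vec; []; _∷_; lookup; _[_]≔_)
open import Data.Vec.Properties using (lookup-map; lookup-zipWith; lookup∘updateAt; lookup∘updateAt′; lookup∘update; []≔-idempotent; []≔-lookup)
open import Function using (_∘_; _$_; const)
open import Relation.Binary.PropositionalEquality renaming (subst to ≡-subst)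
open import Relation.Nullary using (¬_; yes; no; contradiction)
import Relation.Binary.Construct.Add.Supremum.NonStrict _≤_ as NonStrict
import Relation.Binary.Construct.Add.Supremum.Strict _<_ as Strict
open import Defs


-- Whether `s` normalises is undecidable and `Space` may be infinite, so the run cannot be measured
-- against `Space` directly. It is described by a `Course`, a finite trace computed from `s`, `k`
-- and the threshold B = 2 ^ ⌊log₂ m⌋. All resources are bounded in terms of `top`, the minimum of B
-- and the largest size on the trace. Only at the end is `top` compared with m, by B ≤ m, and with
-- each finite value that `IsSpace` allows, because the traced terms are reducts of `s`.
--
-- Two things keep the machine within `top`. The redex is subtracted from the size counter before
-- the contractum is written, so that the counter approaches the next size from below and never
-- exceeds it. And the code on a tape is at most a fixed multiple of some value the counter has had,
-- which lies below B. Already the input is counted while it is read, as it may be far larger than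
-- m.
--
-- The summand 1 in 3 · Time + 1 is taken from k before m and `s` are looked at, since for k = 0
-- only constant time is allowed.

-- Numbering finite types

record Finite (A : Set) : Set where
  field
    card      : ℕ
    index     : A → Fin card
    element   : Fin card → A
    retract   : ∀ x → element (index x) ≡ x

open Finite

finite-⊤ : Finite ⊤
finite-⊤ = record { card = 1; index = λ _ → zero; element = λ _ → tt; retract = λ _ → refl }

finite-⊎ : ∀ {A B} → Finite A → Finite B → Finite (A ⊎ B)
finite-⊎ fa fb = record
  { card    = card fa + card fb
  ; index   = join _ _ ∘ Sum.map (index fa) (index fb)
  ; element = Sum.map (element fa) (element fb) ∘ splitAt (card fa)
  ; retract = λ
      { (inj₁ x) → trans (cong (Sum.map _ _) (splitAt-join (card fa) (card fb) (inj₁ (index fa x)))) (cong inj₁ (retract fa x))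
      ; (inj₂ y) → trans (cong (Sum.map _ _) (splitAt-join (card fa) (card fb) (inj₂ (index fb y)))) (cong inj₂ (retract fb y)) }
  }

finite-× : ∀ {A B} → Finite A → Finite B → Finite (A × B)
finite-× fa fb = record
  { card    = card fa * card fb
  ; index   = λ (x , y) → combine (index fa x) (index fb y)
  ; element = λ i → let (j , k) = remQuot (card fb) i in element fa j , element fb k
  ; retract = λ (x , y) → trans
      (cong (λ (j , k) → element fa j , element fb k) (remQuot-combine (index fa x) (index fb y)))
      (cong₂ _,_ (retract fa x) (retract fb y))
  }

finite-Maybe : ∀ {A} → Finite A → Finite (Maybe A)
finite-Maybe fa = record
  { card    = suc (card fa)
  ; index   = maybe (suc ∘ index fa) zero
  ; element = λ { zero → nothing ; (suc i) → just (element fa i) }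
  ; retract = λ { (just x) → cong just (retract fa x) ; nothing → refl }
  }

-- Letters, registers and stores

data Letter : Set where
  Bit               : Bool → Letter
  Ret Lam App Var I : Letter

Reg : Set
Reg = Maybe Letter

symbol : Letter → Symbol 0
symbol (Bit b) = bit b
symbol Ret     = RET
symbol Lam     = LAM
symbol App     = APP
symbol Var     = VAR
symbol I       = ∣

letter : Symbol 0 → Reg
letter ␣       = nothing
letter ▷       = nothing
letter (bit b) = just (Bit b)
letter RET     = just Ret
letter LAM     = just Lam
letter APP     = just App
letter VAR     = just Var
letter ∣       = just I

letter-symbol : ∀ x → letter (symbol x) ≡ just x
letter-symbol (Bit b) = refl
letter-symbol Ret     = refl
letter-symbol Lam     = refl
letter-symbol App     = refl
letter-symbol Var     = refl
letter-symbol I       = refl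

finite-Letter : Finite Letter
finite-Letter = record
  { card    = 7
  ; index   = λ { (Bit false) → zero ; (Bit true) → suc zero ; Ret → suc (suc zero) ; Lam → suc (suc (suc zero))
                ; App → suc (suc (suc (suc zero))) ; Var → suc (suc (suc (suc (suc zero))))
                ; I → suc (suc (suc (suc (suc (suc zero))))) }
  ; element = lookup (Bit false ∷ Bit true ∷ Ret ∷ Lam ∷ App ∷ Var ∷ I ∷ [])
  ; retract = λ { (Bit false) → refl ; (Bit true) → refl ; Ret → refl ; Lam → refl ; App → refl ; Var → refl ; I → refl }
  }

-- Nested pairs rather than vectors: by η, updates at different literal
-- positions commute definitionally.
Tuple : Set → ℕ → Set
Tuple A zero    = ⊤
Tuple A (suc n) = A × Tuple A n

module _ {A : Set} where

  copies : ∀ n → A → Tuple A n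
  copies zero    x = tt
  copies (suc n) x = x , copies n x

  get : ∀ {n} → Fin n → Tuple A n → A
  get zero    t = proj₁ t
  get (suc i) t = get i (proj₂ t)

  set : ∀ {n} → Fin n → A → Tuple A n → Tuple A n
  set zero    x t = x , proj₂ t
  set (suc i) x t = proj₁ t , set i x (proj₂ t)

  get-set : ∀ {n} (i : Fin n) x t → get i (set i x t) ≡ x
  get-set zero    x t = refl
  get-set (suc i) x t = get-set i x (proj₂ t)

  get-set′ : ∀ {n} (i j : Fin n) x t → i ≢ j → get i (set j x t) ≡ get i t
  get-set′ zero    zero    x t i≢j = contradiction refl i≢j
  get-set′ zero    (suc j) x t i≢j = refl
  get-set′ (suc i) zero    x t i≢j = refl
  get-set′ (suc i) (suc j) x t i≢j = get-set′ i j x (proj₂ t) (i≢j ∘ cong suc)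

-- A stack is a tape whose head is right of its contents; what lies under
-- the head and beyond is irrelevant, so popping need not erase.
data Store : Set where
  stream : ℕ → List Letter → Store
  stack  : List Letter → Store
  output : List Letter → Store

extent : Store → ℕ
extent (stream p _) = suc p
extent (stack xs)   = 2 + length xs
extent (output xs)  = 2 + length xs

-- Stack programs and their compilation to Turing machines

module Language (n : ℕ) where

  infixr 6 _⨾_

  data Prog : Set where
    push     : Fin n → (Reg → Letter) → Prog
    pop read : Fin n → Prog
    skip     : Prog
    _⨾_      : Prog → Prog → Prog
    cond     : (Reg → Bool) → Prog → Prog → Prog
    while    : (Reg → Bool) → Prog → Prog
    exit     : Verdict → Prog

  St : Set
  St = Tuple Store n

  -- Halt Φ lim K r st b: run with the programs K left to execute, the
  -- machine exits within b steps, with Φ holding at the exit, and tape i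
  -- never extends beyond lim i.
  data Halt (Φ : Verdict → St → Set) (lim : Vec ℕ n) : List Prog → Reg → St → ℕ → Set where
    push′  : ∀ {i f xs K r st b} → get i st ≡ stack xs → extent (stack (f r ∷ xs)) ≤ lookup lim i →
             Halt Φ lim K r (set i (stack (f r ∷ xs)) st) b → Halt Φ lim (push i f ∷ K) r st (1 + b)
    emit′  : ∀ {i f xs K r st b} → get i st ≡ output xs → extent (output (f r ∷ xs)) ≤ lookup lim i →
             Halt Φ lim K r (set i (output (f r ∷ xs)) st) b → Halt Φ lim (push i f ∷ K) r st (1 + b)
    pop′   : ∀ {i x xs K r st b} → get i st ≡ stack (x ∷ xs) →
             Halt Φ lim K (just x) (set i (stack xs) st) b → Halt Φ lim (pop i ∷ K) r st (2 + b)
    empty′ : ∀ {i K r st b} → get i st ≡ stack [] →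
             Halt Φ lim K nothing st b → Halt Φ lim (pop i ∷ K) r st (2 + b)
    read′  : ∀ {i p x xs K r st b} → get i st ≡ stream p (x ∷ xs) → 2 + p ≤ lookup lim i →
             Halt Φ lim K (just x) (set i (stream (suc p) xs) st) b → Halt Φ lim (read i ∷ K) r st (2 + b)
    end′   : ∀ {i p K r st b} → get i st ≡ stream p [] → 2 + p ≤ lookup lim i →
             Halt Φ lim K nothing (set i (stream (suc p) []) st) b → Halt Φ lim (read i ∷ K) r st (2 + b)
    skip′  : ∀ {K r st b} → Halt Φ lim K r st b → Halt Φ lim (skip ∷ K) r st (1 + b)
    seq′   : ∀ {P Q K r st b} → Halt Φ lim (P ∷ Q ∷ K) r st b → Halt Φ lim (P ⨾ Q ∷ K) r st b
    cond′  : ∀ {c P Q K r st b} → Halt Φ lim ((if c r then P else Q) ∷ K) r st b →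
             Halt Φ lim (cond c P Q ∷ K) r st (1 + b)
    while′ : ∀ {c P K r st b} → Halt Φ lim (if c r then P ∷ while c P ∷ K else K) r st b →
             Halt Φ lim (while c P ∷ K) r st (1 + b)
    exit′  : ∀ {v K r st b} → Φ v st → Halt Φ lim (exit v ∷ K) r st b

  slack : ∀ {Φ lim K r st b c} → b ≤ c → Halt Φ lim K r st b → Halt Φ lim K r st c
  slack (s≤s le)       (push′ e l h) = push′ e l (slack le h)
  slack (s≤s le)       (emit′ e l h) = emit′ e l (slack le h)
  slack (s≤s (s≤s le)) (pop′ e h)    = pop′ e (slack le h)
  slack (s≤s (s≤s le)) (empty′ e h)  = empty′ e (slack le h)
  slack (s≤s (s≤s le)) (read′ e l h) = read′ e l (slack le h)
  slack (s≤s (s≤s le)) (end′ e l h)  = end′ e l (slack le h)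
  slack (s≤s le)       (skip′ h)     = skip′ (slack le h)
  slack le             (seq′ h)      = seq′ (slack le h)
  slack (s≤s le)       (cond′ h)     = cond′ (slack le h)
  slack (s≤s le)       (while′ h)    = while′ (slack le h)
  slack le             (exit′ φ)     = exit′ φ

  Pos : Prog → Set
  Pos (push _ _)   = ⊤
  Pos (pop _)      = Maybe ⊤
  Pos (read _)     = Maybe ⊤
  Pos skip         = ⊤
  Pos (P ⨾ Q)      = Pos P ⊎ Pos Q
  Pos (cond _ P Q) = Maybe (Pos P ⊎ Pos Q)
  Pos (while _ P)  = Maybe (Pos P)
  Pos (exit _)     = ⊤

  finite-Pos : ∀ P → Finite (Pos P)
  finite-Pos (push _ _)   = finite-⊤
  finite-Pos (pop _)      = finite-Maybe finite-⊤
  finite-Pos (read _)     = finite-Maybe finite-⊤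
  finite-Pos skip         = finite-⊤
  finite-Pos (P ⨾ Q)      = finite-⊎ (finite-Pos P) (finite-Pos Q)
  finite-Pos (cond _ P Q) = finite-Maybe (finite-⊎ (finite-Pos P) (finite-Pos Q))
  finite-Pos (while _ P)  = finite-Maybe (finite-Pos P)
  finite-Pos (exit _)     = finite-⊤

  entry : ∀ P → Pos P
  entry (push _ _)   = tt
  entry (pop _)      = nothing
  entry (read _)     = nothing
  entry skip         = tt
  entry (P ⨾ Q)      = inj₁ (entry P)
  entry (cond _ P Q) = nothing
  entry (while _ P)  = nothing
  entry (exit _)     = tt

  Heads Actions : Set
  Heads   = Vec (Symbol 0) n
  Actions = Vec (Symbol 0 × Move) n

  stay : Heads → Actions
  stay = Vec.map (_, N)

  -- A pop from the empty stack lands on the marker and has to go back. On any other symbol the head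
  -- stays: that cell is then no longer left of the head, which is what removes it from the stack.
  rebound : Symbol 0 → Symbol 0 × Move
  rebound ▷ = ▷ , R
  rebound x = x , N

  -- The position nothing is the exit of the program.
  advance : ∀ P → Pos P → Reg → Heads → Maybe (Pos P) × Reg × Actions
  advance (push i f)   _               r hs = nothing , r , stay hs [ i ]≔ (symbol (f r) , R)
  advance (pop i)      nothing         r hs = just (just tt) , r , stay hs [ i ]≔ (lookup hs i , L)
  advance (pop i)      (just _)        r hs = nothing , letter (lookup hs i) , stay hs [ i ]≔ rebound (lookup hs i)
  advance (read i)     nothing         r hs = just (just tt) , r , stay hs [ i ]≔ (lookup hs i , R)
  advance (read i)     (just _)        r hs = nothing , letter (lookup hs i) , stay hs [ i ]≔ (lookup hs i , N)
  advance skip         _               r hs = nothing , r , stay hs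
  advance (P ⨾ Q)      (inj₁ p)        r hs = map₁ (just ∘ maybe inj₁ (inj₂ (entry Q))) (advance P p r hs)
  advance (P ⨾ Q)      (inj₂ q)        r hs = map₁ (Maybe.map inj₂) (advance Q q r hs)
  advance (cond c P Q) nothing         r hs = just (just (if c r then inj₁ (entry P) else inj₂ (entry Q))) , r , stay hs
  advance (cond c P Q) (just (inj₁ p)) r hs = map₁ (Maybe.map (just ∘ inj₁)) (advance P p r hs)
  advance (cond c P Q) (just (inj₂ q)) r hs = map₁ (Maybe.map (just ∘ inj₂)) (advance Q q r hs)
  advance (while c P)  nothing         r hs = (if c r then just (just (entry P)) else nothing) , r , stay hs
  advance (while c P)  (just p)        r hs = map₁ just (advance P p r hs)
  advance (exit _)     _               r hs = nothing , r , stay hs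

  verdictAt : ∀ P → Pos P → Maybe Verdict
  verdictAt (P ⨾ Q)      (inj₁ p)        = verdictAt P p
  verdictAt (P ⨾ Q)      (inj₂ q)        = verdictAt Q q
  verdictAt (cond _ P Q) (just (inj₁ p)) = verdictAt P p
  verdictAt (cond _ P Q) (just (inj₂ q)) = verdictAt Q q
  verdictAt (while _ P)  (just p)        = verdictAt P p
  verdictAt (exit v)     _               = just v
  verdictAt _            _               = nothing

  module Compiled (kinds : Vec Bool n) (P₀ : Prog) where

    -- The position nothing is the start: there the heads of the tapes
    -- marked in kinds leave the symbol ▷.
    Control : Set
    Control = Maybe (Pos P₀)

    kickoff : ∀ {m} → Vec Bool m → Vec (Symbol 0) m → Vec (Symbol 0 × Move) m
    kickoff = Vec.zipWith (λ b x → x , (if b then R else N))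

    transition : Control → Reg → Heads → Control × Reg × Actions
    transition nothing  r hs = just (entry P₀) , r , kickoff kinds hs
    transition (just p) r hs = advance P₀ p r hs

    verdict : Control → Maybe Verdict
    verdict nothing  = nothing
    verdict (just p) = verdictAt P₀ p

    abstract
      -- Kept opaque: states are handled through `retract` alone, and the positions of the program
      -- are never actually numbered.
      finite-state : Finite (Control × Reg)
      finite-state = finite-× (finite-Maybe (finite-Pos P₀)) (finite-Maybe finite-Letter)

    M : TM Verdict n
    M = record
      { auxiliary = 0
      ; states    = card finite-state
      ; start     = index finite-state (nothing , nothing)
      ; final     = λ q → verdict (proj₁ (element finite-state q))
      ; δ         = λ q hs →
          let (g , r)         = element finite-state q
              (g′ , r′ , as) = transition g r hs
          in  index finite-state (g′ , r′) , as
      }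

    open Run M using (Config; HaltsFrom; halt; next; headPositions; step)

    config : Control → Reg → Tapes M → Config
    config g r ts = index finite-state (g , r) , ts

    act : Symbol 0 × Move → Tape 0 → Tape 0
    act (x , d) t = move d (write x t)

    step-config : ∀ {g r ts g′ r′ as} → transition g r (Vec.map Tape.head ts) ≡ (g′ , r′ , as) →
                  step (config g r ts) ≡ config g′ r′ (Vec.zipWith act as ts)
    step-config {g} {r} {ts} eq = trans
      (cong (λ (g , r) → enact (transition g r (Vec.map Tape.head ts))) (retract finite-state (g , r)))
      (cong enact eq)
      where
      enact : Control × Reg × Actions → Config
      enact (g , r , as) = config g r (Vec.zipWith act as ts)

    act-stay : ∀ {m} (ts : Vec (Tape 0) m) →
               Vec.zipWith act (Vec.map (_, N) (Vec.map Tape.head ts)) ts ≡ ts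
    act-stay []       = refl
    act-stay (t ∷ ts) = cong (t ∷_) (act-stay ts)

    act-at : ∀ {m} (ts : Vec (Tape 0) m) i a →
             Vec.zipWith act (Vec.map (_, N) (Vec.map Tape.head ts) [ i ]≔ a) ts ≡ ts [ i ]≔ act a (lookup ts i)
    act-at (t ∷ ts) zero    a = cong (_ ∷_) (act-stay ts)
    act-at (t ∷ ts) (suc i) a = cong (t ∷_) (act-at ts i a)

    -- For a `stack` only the cells left of the head matter. An `output` fixes the whole tape, since
    -- `Holds` tolerates nothing but blanks after the word; it can only be pushed to, so no remnants
    -- arise.
    Represents : Store → Tape 0 → Set
    Represents (stream p xs) t = length (Tape.left t) ≡ p × Tape.right t ≡ map symbol xs
    Represents (stack xs)    t = Tape.left t ≡ map symbol xs ++ ▷ ∷ []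
    Represents (output xs)   t = t ≡ tape (map symbol xs ++ ▷ ∷ []) ␣ []

    represents-extent : ∀ s {t} → Represents s t → suc (length (Tape.left t)) ≡ extent s
    represents-extent (stream p xs) (e , _) = cong suc e
    represents-extent (stack xs)    e       rewrite e | length-++ (map symbol xs) {▷ ∷ []} | length-map symbol xs = cong suc (+-comm _ 1)
    represents-extent (output xs)   refl    rewrite length-++ (map symbol xs) {▷ ∷ []} | length-map symbol xs = cong suc (+-comm _ 1)

    Models : St → Tapes M → Set
    Models st ts = ∀ i → Represents (get i st) (lookup ts i)

    models-set : ∀ {st ts s t} i → Models st ts → Represents s t → Models (set i s st) (ts [ i ]≔ t)
    models-set {st} {ts} {s} {t} i m e j with j ≟ᶠ i
    ... | yes refl rewrite get-set i s st | lookup∘updateAt i {λ _ → t} ts = e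
    ... | no  j≢i  rewrite get-set′ j i s st j≢i | lookup∘updateAt′ j i {λ _ → t} j≢i ts = m j

    module _ (lim : Vec ℕ n) where

      Fits : Tapes M → Set
      Fits ts = ∀ i → suc (length (Tape.left (lookup ts i))) ≤ lookup lim i

      FitsSt : St → Set
      FitsSt st = ∀ i → extent (get i st) ≤ lookup lim i

      fits : ∀ {st ts} → Models st ts → FitsSt st → Fits ts
      fits {st} m f i = ≤-trans (≤-reflexive (represents-extent (get i st) (m i))) (f i)

      fits-set : ∀ {st s} i → FitsSt st → extent s ≤ lookup lim i → FitsSt (set i s st)
      fits-set {st} {s} i f le j with j ≟ᶠ i
      ... | yes refl rewrite get-set i s st = le
      ... | no  j≢i  rewrite get-set′ j i s st j≢i = f j

      fits-update : ∀ {ts t} i → Fits ts → suc (length (Tape.left t)) ≤ lookup lim i → Fits (ts [ i ]≔ t)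
      fits-update {ts} {t} i f le j with j ≟ᶠ i
      ... | yes refl rewrite lookup∘updateAt i {λ _ → t} ts = le
      ... | no  j≢i  rewrite lookup∘updateAt′ j i {λ _ → t} j≢i ts = f j

      record Outcome (Φ : Verdict → St → Set) (c : Config) (b : ℕ) : Set where
        constructor outcome
        field
          {time}    : ℕ
          {visited} : Vec ℕ n
          {result}  : Verdict
          {tapes}   : Tapes M
          {end}     : St
          halts     : HaltsFrom c time visited result tapes
          in-time   : time ≤ b
          in-space  : ∀ i → lookup visited i ≤ lookup lim i
          models    : Models end tapes
          satisfied : Φ result end

      fits-head : ∀ {ts} → Fits ts → ∀ i → lookup (headPositions ts) i ≤ lookup lim i
      fits-head {ts} f i = ≤-trans (≤-reflexive (lookup-map i _ ts)) (f i)

      one-step : ∀ {Φ g r ts g′ r′ as b} → Fits ts → verdict g ≡ nothing →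
                 transition g r (Vec.map Tape.head ts) ≡ (g′ , r′ , as) →
                 Outcome Φ (config g′ r′ (Vec.zipWith act as ts)) b → Outcome Φ (config g r ts) (suc b)
      one-step {Φ} {g} {r} {ts} f v eq (outcome {visited = vs} h t s m φ) = outcome
        (next (trans (cong (verdict ∘ proj₁) (retract finite-state (g , r))) v)
              (≡-subst (λ c → HaltsFrom c _ _ _ _) (sym (step-config {g} {r} {ts} eq)) h))
        (s≤s t)
        (λ i → ≤-trans (≤-reflexive (lookup-zipWith _⊔_ i (headPositions ts) vs)) (⊔-lub (fits-head {ts} f i) (s i)))
        m φ

      step-at : ∀ {Φ g r ts g′ r′ i a b} → Fits ts → verdict g ≡ nothing →
                transition g r (Vec.map Tape.head ts) ≡ (g′ , r′ , stay (Vec.map Tape.head ts) [ i ]≔ a) →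
                Outcome Φ (config g′ r′ (ts [ i ]≔ act a (lookup ts i))) b → Outcome Φ (config g r ts) (suc b)
      step-at {ts = ts} {i = i} {a} f v eq o rewrite sym (act-at ts i a) = one-step f v eq o

      -- Popping and reading take two steps because a symbol is visible only once the head has moved
      -- onto it. Both steps act on tape `i`, so their joint effect is a single update.
      two-steps : ∀ {Φ g r ts g₁ g₂ r₂ b} i d a → Fits ts →
                  let t₁ = move d (lookup ts i) in
                  verdict g ≡ nothing → (∀ hs → transition g r hs ≡ (g₁ , r , stay hs [ i ]≔ (lookup hs i , d))) →
                  suc (length (Tape.left t₁)) ≤ lookup lim i →
                  verdict g₁ ≡ nothing → (∀ hs → lookup hs i ≡ Tape.head t₁ → transition g₁ r hs ≡ (g₂ , r₂ , stay hs [ i ]≔ a)) →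
                  Outcome Φ (config g₂ r₂ (ts [ i ]≔ act a t₁)) b → Outcome Φ (config g r ts) (2 + b)
      two-steps {Φ} {g} {r} {ts} {g₁} {g₂} {r₂} {b} i d a f v eq le v₁ eq₁ o =
        step-at {ts = ts} {i = i} f v (eq _)
          (≡-subst (λ x → Outcome Φ (config g₁ r (ts [ i ]≔ act (x , d) (lookup ts i))) (suc b)) (sym (lookup-map i Tape.head ts))
            (step-at {ts = ts [ i ]≔ t₁} {i = i} (fits-update {ts} i f le) v₁
              (eq₁ _ (trans (lookup-map i Tape.head (ts [ i ]≔ t₁)) (cong Tape.head (lookup∘update i ts t₁))))
              (≡-subst (λ ts → Outcome Φ (config g₂ r₂ ts) b) (sym twice) o)))
        where
        t₁ = move d (lookup ts i)
        twice : (ts [ i ]≔ t₁) [ i ]≔ act a (lookup (ts [ i ]≔ t₁) i) ≡ ts [ i ]≔ act a t₁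
        twice = trans ([]≔-idempotent ts i) (cong (λ t → ts [ i ]≔ act a t) (lookup∘update i ts t₁))

      step-stay : ∀ {Φ g r ts g′ r′ b} → Fits ts → verdict g ≡ nothing →
                  transition g r (Vec.map Tape.head ts) ≡ (g′ , r′ , stay (Vec.map Tape.head ts)) →
                  Outcome Φ (config g′ r′ ts) b → Outcome Φ (config g r ts) (suc b)
      step-stay {Φ} {ts = ts} {b = b} f v eq o =
        one-step f v eq (≡-subst (λ ts → Outcome Φ (config _ _ ts) b) (sym (act-stay ts)) o)

    -- `ι` places the positions of `P` inside `P₀`, and `κ` is where control goes when `P` ends.
    -- This makes the simulation local: each instruction is analysed on its own, wherever it occurs.
    record Embedded (P : Prog) (ι : Pos P → Control) (κ : Control) : Set where
      field
        transition-ι : ∀ p r hs → transition (ι p) r hs ≡ map₁ (maybe ι κ) (advance P p r hs)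
        verdict-ι    : ∀ p → verdict (ι p) ≡ verdictAt P p

    open Embedded

    embedded-seqˡ : ∀ {P Q ι κ} → Embedded (P ⨾ Q) ι κ → Embedded P (ι ∘ inj₁) (ι (inj₂ (entry Q)))
    embedded-seqˡ {P} e .transition-ι p r hs with e .transition-ι (inj₁ p) r hs
    ... | eq with advance P p r hs
    ... | just _  , _ = eq
    ... | nothing , _ = eq
    embedded-seqˡ e .verdict-ι p = e .verdict-ι (inj₁ p)

    embedded-seqʳ : ∀ {P Q ι κ} → Embedded (P ⨾ Q) ι κ → Embedded Q (ι ∘ inj₂) κ
    embedded-seqʳ {Q = Q} e .transition-ι p r hs with e .transition-ι (inj₂ p) r hs
    ... | eq with advance Q p r hs
    ... | just _  , _ = eq
    ... | nothing , _ = eq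
    embedded-seqʳ e .verdict-ι p = e .verdict-ι (inj₂ p)

    embedded-condˡ : ∀ {c P Q ι κ} → Embedded (cond c P Q) ι κ → Embedded P (ι ∘ just ∘ inj₁) κ
    embedded-condˡ {P = P} e .transition-ι p r hs with e .transition-ι (just (inj₁ p)) r hs
    ... | eq with advance P p r hs
    ... | just _  , _ = eq
    ... | nothing , _ = eq
    embedded-condˡ e .verdict-ι p = e .verdict-ι (just (inj₁ p))

    embedded-condʳ : ∀ {c P Q ι κ} → Embedded (cond c P Q) ι κ → Embedded Q (ι ∘ just ∘ inj₂) κ
    embedded-condʳ {Q = Q} e .transition-ι p r hs with e .transition-ι (just (inj₂ p)) r hs
    ... | eq with advance Q p r hs
    ... | just _  , _ = eq
    ... | nothing , _ = eq
    embedded-condʳ e .verdict-ι p = e .verdict-ι (just (inj₂ p))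

    embedded-while : ∀ {c P ι κ} → Embedded (while c P) ι κ → Embedded P (ι ∘ just) (ι nothing)
    embedded-while {P = P} e .transition-ι p r hs with e .transition-ι (just p) r hs
    ... | eq with advance P p r hs
    ... | just _  , _ = eq
    ... | nothing , _ = eq
    embedded-while e .verdict-ι p = e .verdict-ι (just p)

    embedded-main : Embedded P₀ just nothing
    embedded-main .transition-ι p r hs with advance P₀ p r hs
    ... | just _  , _ = refl
    ... | nothing , _ = refl
    embedded-main .verdict-ι p = refl

    -- The continuation `K` of the big-step semantics exists only in the proof. For the machine it
    -- is implicit in the control state, the exit of each program being the entry of the next.
    data At : List Prog → Control → Set where
      []  : ∀ {g} → At [] g
      _∷_ : ∀ {P K ι κ} → Embedded P ι κ → At K κ → At (P ∷ K) (ι (entry P))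

    rebound-symbol : ∀ x → rebound (symbol x) ≡ (symbol x , N)
    rebound-symbol (Bit b) = refl
    rebound-symbol Ret     = refl
    rebound-symbol Lam     = refl
    rebound-symbol App     = refl
    rebound-symbol Var     = refl
    rebound-symbol I       = refl

    at-cond : ∀ {c P Q K ι κ} → Embedded (cond c P Q) ι κ → At K κ → ∀ b →
              At ((if b then P else Q) ∷ K) (ι (just (if b then inj₁ (entry P) else inj₂ (entry Q))))
    at-cond e at true  = embedded-condˡ e ∷ at
    at-cond e at false = embedded-condʳ e ∷ at

    at-while : ∀ {c P K ι κ} → Embedded (while c P) ι κ → At K κ → ∀ b →
               At (if b then P ∷ while c P ∷ K else K) (maybe ι κ (if b then just (just (entry P)) else nothing))
    at-while e at true  = embedded-while e ∷ e ∷ at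
    at-while e at false = at

    represents : ∀ {st ts s} i → Models st ts → get i st ≡ s → Represents s (lookup ts i)
    represents i m refl = m i

    module _ {Φ : Verdict → St → Set} (lim : Vec ℕ n) where

      simulate : ∀ {K r st b} → Halt Φ lim K r st b → ∀ {g ts} → At K g → Models st ts → FitsSt lim st →
                 Outcome lim Φ (config g r ts) b
      simulate (push′ {i} {f} {xs} {r = r} {st} eq le h) {ts = ts} (e ∷ at) m fs =
        step-at lim {ts = ts} {i = i} (fits lim {st} {ts} m fs) (e .verdict-ι tt) (e .transition-ι tt r _)
          (simulate h at (models-set {st} {ts} i m pushed) (fits-set lim {st} i fs le))
        where
        pushed : Represents (stack (f r ∷ xs)) (act (symbol (f r) , R) (lookup ts i))
        pushed with lookup ts i | represents {st} {ts} i m eq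
        ... | tape ls x []       | e = cong (symbol (f r) ∷_) e
        ... | tape ls x (_ ∷ rs) | e = cong (symbol (f r) ∷_) e
      simulate (emit′ {i} {f} {xs} {r = r} {st} eq le h) {ts = ts} (e ∷ at) m fs =
        step-at lim {ts = ts} {i = i} (fits lim {st} {ts} m fs) (e .verdict-ι tt) (e .transition-ι tt r _)
          (simulate h at (models-set {st} {ts} i m pushed) (fits-set lim {st} i fs le))
        where
        pushed : Represents (output (f r ∷ xs)) (act (symbol (f r) , R) (lookup ts i))
        pushed rewrite represents {st} {ts} i m eq = refl
      simulate (pop′ {i} {x} {xs} {r = r} {st} {b} eq h) {ts = ts} (_∷_ {κ = κ} e at) m fs =
        popped (lookup ts i) refl (represents {st} {ts} i m eq)
        where
        popped : ∀ t → lookup ts i ≡ t → Represents (stack (x ∷ xs)) t → Outcome lim Φ (config _ r ts) (2 + b)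
        popped (tape _ y rs) eq′ refl = two-steps lim {ts = ts} i L (symbol x , N) (fits lim {st} {ts} m fs)
          (e .verdict-ι nothing) (λ hs → e .transition-ι nothing r hs) le
          (e .verdict-ι (just tt)) (λ hs eq₁ → trans (e .transition-ι (just tt) r hs) (second hs (trans eq₁ (cong (Tape.head ∘ move L) eq′))))
          (simulate h at (models-set {st} {ts} i m (cong (λ t → Tape.left (act (symbol x , N) (move L t))) eq′)) (fits-set lim {st} i fs le′))
          where
          second : ∀ hs → lookup hs i ≡ symbol x →
                   _≡_ {A = Control × Reg × Actions} (κ , letter (lookup hs i) , stay hs [ i ]≔ rebound (lookup hs i)) (κ , just x , stay hs [ i ]≔ (symbol x , N))
          second hs eq₁ rewrite eq₁ | letter-symbol x | rebound-symbol x = refl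
          le′ : extent (stack xs) ≤ lookup lim i
          le′ = ≤-trans (n≤1+n _) (≤-trans (≤-reflexive (cong extent (sym eq))) (fs i))
          le : suc (length (Tape.left (move L (lookup ts i)))) ≤ lookup lim i
          le rewrite eq′ = ≤-trans (≤-reflexive (represents-extent (stack xs) {tape (map symbol xs ++ ▷ ∷ []) ␣ []} refl)) le′
      simulate (empty′ {i} {r = r} {st} {b} eq h) {ts = ts} (_∷_ {κ = κ} e at) m fs =
        popped (lookup ts i) refl (represents {st} {ts} i m eq)
        where
        popped : ∀ t → lookup ts i ≡ t → Represents (stack []) t → Outcome lim Φ (config _ r ts) (2 + b)
        popped t@(tape _ y rs) eq′ refl = two-steps lim {ts = ts} i L (▷ , R) (fits lim {st} {ts} m fs)
          (e .verdict-ι nothing) (λ hs → e .transition-ι nothing r hs) le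
          (e .verdict-ι (just tt)) (λ hs eq₁ → trans (e .transition-ι (just tt) r hs) (second hs (trans eq₁ (cong (Tape.head ∘ move L) eq′))))
          (≡-subst (λ ts → Outcome lim Φ (config κ nothing ts) b) (sym unchanged) (simulate h at m fs))
          where
          second : ∀ hs → lookup hs i ≡ ▷ →
                   _≡_ {A = Control × Reg × Actions} (κ , letter (lookup hs i) , stay hs [ i ]≔ rebound (lookup hs i)) (κ , nothing , stay hs [ i ]≔ (▷ , R))
          second hs eq₁ rewrite eq₁ = refl
          unchanged : ts [ i ]≔ act (▷ , R) (move L (lookup ts i)) ≡ ts
          unchanged = trans (cong (λ t → ts [ i ]≔ act (▷ , R) (move L t)) eq′)
                        (trans (cong (ts [ i ]≔_) (sym eq′)) ([]≔-lookup ts i))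
          le : suc (length (Tape.left (move L (lookup ts i)))) ≤ lookup lim i
          le rewrite eq′ = ≤-trans (s≤s z≤n) (≤-trans (≤-reflexive (cong extent (sym eq))) (fs i))
      simulate (read′ {i} {p} {x} {xs} {r = r} {st} {b} eq le h) {ts = ts} (_∷_ {κ = κ} e at) m fs =
        advanced (lookup ts i) refl (represents {st} {ts} i m eq)
        where
        advanced : ∀ t → lookup ts i ≡ t → Represents (stream p (x ∷ xs)) t → Outcome lim Φ (config _ r ts) (2 + b)
        advanced (tape _ y _) eq′ (refl , refl) = two-steps lim {ts = ts} i R (symbol x , N) (fits lim {st} {ts} m fs)
          (e .verdict-ι nothing) (λ hs → e .transition-ι nothing r hs) (≡-subst (λ t → suc (length (Tape.left (move R t))) ≤ lookup lim i) (sym eq′) le)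
          (e .verdict-ι (just tt)) (λ hs eq₁ → trans (e .transition-ι (just tt) r hs) (second hs (trans eq₁ (cong (Tape.head ∘ move R) eq′))))
          (simulate h at (models-set {st} {ts} i m (≡-subst (λ t → Represents (stream (suc p) xs) (act (symbol x , N) (move R t))) (sym eq′) (refl , refl))) (fits-set lim {st} i fs le))
          where
          second : ∀ hs → lookup hs i ≡ symbol x →
                   _≡_ {A = Control × Reg × Actions} (κ , letter (lookup hs i) , stay hs [ i ]≔ (lookup hs i , N)) (κ , just x , stay hs [ i ]≔ (symbol x , N))
          second hs eq₁ rewrite eq₁ | letter-symbol x = refl
      simulate (end′ {i} {p} {r = r} {st} {b} eq le h) {ts = ts} (_∷_ {κ = κ} e at) m fs =
        advanced (lookup ts i) refl (represents {st} {ts} i m eq)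
        where
        advanced : ∀ t → lookup ts i ≡ t → Represents (stream p []) t → Outcome lim Φ (config _ r ts) (2 + b)
        advanced (tape _ y _) eq′ (refl , refl) = two-steps lim {ts = ts} i R (␣ , N) (fits lim {st} {ts} m fs)
          (e .verdict-ι nothing) (λ hs → e .transition-ι nothing r hs) (≡-subst (λ t → suc (length (Tape.left (move R t))) ≤ lookup lim i) (sym eq′) le)
          (e .verdict-ι (just tt)) (λ hs eq₁ → trans (e .transition-ι (just tt) r hs) (second hs (trans eq₁ (cong (Tape.head ∘ move R) eq′))))
          (simulate h at (models-set {st} {ts} i m (≡-subst (λ t → Represents (stream (suc p) []) (act (␣ , N) (move R t))) (sym eq′) (refl , refl))) (fits-set lim {st} i fs le))
          where
          second : ∀ hs → lookup hs i ≡ ␣ →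
                   _≡_ {A = Control × Reg × Actions} (κ , letter (lookup hs i) , stay hs [ i ]≔ (lookup hs i , N)) (κ , nothing , stay hs [ i ]≔ (␣ , N))
          second hs eq₁ rewrite eq₁ = refl
      simulate (skip′ {r = r} {st} h) {ts = ts} (e ∷ at) m fs =
        step-stay lim {ts = ts} (fits lim {st} {ts} m fs) (e .verdict-ι tt) (e .transition-ι tt r _) (simulate h at m fs)
      -- No machine step is taken here, because the entry of `P ⨾ Q` is the entry of `P`.
      simulate (seq′ h) (e ∷ at) m fs = simulate h (embedded-seqˡ e ∷ embedded-seqʳ e ∷ at) m fs
      simulate (cond′ {c} {r = r} {st} h) {ts = ts} (e ∷ at) m fs =
        step-stay lim {ts = ts} (fits lim {st} {ts} m fs) (e .verdict-ι nothing) (e .transition-ι nothing r _)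
          (simulate h (at-cond e at (c r)) m fs)
      simulate (while′ {c} {r = r} {st} h) {ts = ts} (e ∷ at) m fs =
        step-stay lim {ts = ts} (fits lim {st} {ts} m fs) (e .verdict-ι nothing) (e .transition-ι nothing r _)
          (simulate h (at-while e at (c r)) m fs)
      simulate (exit′ {r = r} {st} φ) {ts = ts} (_∷_ {P} {ι = ι} e at) m fs = outcome
        (halt (trans (cong (verdict ∘ proj₁) (retract finite-state (ι (entry P) , r))) (e .verdict-ι tt)))
        z≤n (fits-head lim {ts} (fits lim {st} {ts} m fs)) m φ

      kickoff-at : ∀ {m} (bs : Vec Bool m) (ts : Vec (Tape 0) m) i →
                   lookup (Vec.zipWith act (kickoff bs (Vec.map Tape.head ts)) ts) i
                   ≡ move (if lookup bs i then R else N) (lookup ts i)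
      kickoff-at (b ∷ bs) (t ∷ ts) zero    = refl
      kickoff-at (b ∷ bs) (t ∷ ts) (suc i) = kickoff-at bs ts i

      run : ∀ {st ts b} → Halt Φ lim (P₀ ∷ []) nothing st b →
            (∀ i → Represents (get i st) (move (if lookup kinds i then R else N) (lookup ts i))) →
            FitsSt lim st → Fits lim ts → Outcome lim Φ (config nothing nothing ts) (suc b)
      run {st} {ts} h m fs f = one-step lim {ts = ts} f refl refl
        (simulate h (embedded-main ∷ []) (λ i → ≡-subst (Represents (get i st)) (sym (kickoff-at kinds ts i)) (m i)) fs)

-- Tapes and elementary loops of the machine

open Language 15

pattern bit₀ = Bit false
pattern bit₁ = Bit true

-- K counts the remaining steps and CNT the size of the current term, both
-- in binary with the least significant digit on top. The term consists of
-- the values on V, the function before its argument, and the code on C that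
-- is still to be read. A contraction substitutes the argument on U into the
-- function on F and writes to G; D holds the depth in unary.
kIn mIn sIn out K CNT T V C U F G D X Y : Fin 15
kIn = tape# 0
mIn = tape# 1
sIn = tape# 2
out = tape# 3
K   = tape# 4
CNT = tape# 5
T   = tape# 6
V   = tape# 7
C   = tape# 8
U   = tape# 9
F   = tape# 10
G   = tape# 11
D   = tape# 12
X   = tape# 13
Y   = tape# 14

infixl 20 _[_≔_]

_[_≔_] : St → Fin 15 → List Letter → St
st [ i ≔ xs ] = set i (stack xs) st

keep : Reg → Letter
keep = fromMaybe I

zero? one? ret? lam? app? var? bar? block? : Reg → Bool
zero? (just bit₀) = true
zero? _           = false
one? (just bit₁) = true
one? _           = false
ret? (just Ret) = true
ret? _          = false
lam? (just Lam) = true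
lam? _          = false
app? (just App) = true
app? _          = false
var? (just Var) = true
var? _          = false
bar? (just I) = true
bar? _        = false
-- On the stack V, bit₁ separates the blocks of abstractions.
block? (just bit₁) = false
block? _           = true

each : Fin 15 → (Reg → Bool) → Prog → Prog
each i c P = pop i ⨾ while c (P ⨾ pop i)

transfer : Fin 15 → Fin 15 → Prog
transfer i j = each i is-just (push j keep)

drain : Fin 15 → Prog
drain i = each i is-just skip

refill : Fin 15 → Letter → Prog
refill i x = each T is-just (push i (const x))

-- The trailing ones are removed and remembered in unary on `T`. If there is no digit above them,
-- the number is about to grow and a digit of m is spent on that.
inc : Prog
inc = each CNT one? (push T (const I))
    ⨾ cond is-just skip (read mIn ⨾ cond is-just skip (exit spaceBoundReached))
    ⨾ push CNT (const bit₁) ⨾ refill CNT bit₀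

dec : Fin 15 → Prog
dec i = each i zero? (push T (const I))
      ⨾ cond is-just skip (exit spaceBoundNotReached)
      ⨾ push i (const bit₀) ⨾ refill i bit₁

-- Binary counters

value : List Bool → ℕ
value []           = 0
value (false ∷ bs) = 2 * value bs
value (true ∷ bs)  = suc (2 * value bs)

value-increment : ∀ bs → value (increment bs) ≡ suc (value bs)
value-increment []           = refl
value-increment (false ∷ bs) = refl
value-increment (true ∷ bs)  rewrite value-increment bs = lemma (value bs)
  where
  lemma : ∀ n → 2 * suc n ≡ suc (suc (2 * n))
  lemma = solve-∀

value-binary : ∀ n → value (binary n) ≡ n
value-binary zero    = refl
value-binary (suc n) = trans (value-increment (binary n)) (cong suc (value-binary n))

value<2^length : ∀ bs → value bs < 2 ^ length bs
value<2^length []           = s≤s z≤n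
value<2^length (false ∷ bs) = *-monoʳ-< 2 (value<2^length bs)
value<2^length (true ∷ bs)  = begin
  2 + 2 * value bs   ≡⟨ lemma (value bs) ⟩
  2 * suc (value bs) ≤⟨ *-monoʳ-≤ 2 (value<2^length bs) ⟩
  2 * 2 ^ length bs  ∎
  where
  open ≤-Reasoning
  lemma : ∀ n → 2 + 2 * n ≡ 2 * suc n
  lemma = solve-∀

decrement : List Bool → List Bool
decrement []           = []
decrement (false ∷ bs) = true ∷ decrement bs
decrement (true ∷ bs)  = false ∷ bs

length-decrement : ∀ bs → length (decrement bs) ≡ length bs
length-decrement []           = refl
length-decrement (false ∷ bs) = cong suc (length-decrement bs)
length-decrement (true ∷ bs)  = refl

value-decrement : ∀ bs {n} → value bs ≡ suc n → value (decrement bs) ≡ n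
value-decrement (true ∷ bs)  e = suc-injective e
value-decrement (false ∷ bs) e with value bs | value-decrement bs
... | suc m | ih rewrite ih refl = suc-injective (trans (cong suc (sym (+-suc m (m + 0)))) e)

-- The amortised analysis of counting down: a digit 0 pays for the step
-- that turns it into 1.
potential : List Bool → ℕ
potential []           = 0
potential (false ∷ bs) = 8 + potential bs
potential (true ∷ bs)  = potential bs

decrement-time : List Bool → ℕ
decrement-time []           = 20
decrement-time (false ∷ bs) = 8 + decrement-time bs
decrement-time (true ∷ bs)  = 20

-- 28 = 20 + 8: the lowest 1 becomes a 0 and has to be endowed with 8 units, while each 0 below it
-- becomes a 1 and releases the 8 units that its own treatment costs.
amortised : ∀ bs → decrement-time bs + potential (decrement bs) ≤ 28 + potential bs
amortised []           = m≤n+m _ 8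
amortised (false ∷ bs) = +-monoʳ-≤ 8 (amortised bs)
amortised (true ∷ bs)  = ≤-refl

decrement-time-bound : ∀ bs → decrement-time bs ≤ length bs * 8 + 20
decrement-time-bound []           = ≤-refl
decrement-time-bound (false ∷ bs) = +-monoʳ-≤ 8 (decrement-time-bound bs)
decrement-time-bound (true ∷ bs)  = m≤n+m 20 (8 + length bs * 8)

potential-bound : ∀ bs → potential bs ≤ length bs * 8
potential-bound []           = z≤n
potential-bound (false ∷ bs) = +-monoʳ-≤ 8 (potential-bound bs)
potential-bound (true ∷ bs)  = ≤-trans (potential-bound bs) (m≤n+m _ 8)

-- The accumulating form is what a pushing loop produces; `bars` has its top letter exposed, as
-- popping requires.
fill : Letter → ℕ → List Letter → List Letter
fill x zero    xs = xs
fill x (suc n) xs = fill x n (x ∷ xs)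

bars : ℕ → List Letter → List Letter
bars zero    xs = xs
bars (suc n) xs = I ∷ bars n xs

fill-∷ : ∀ x n xs → fill x n (x ∷ xs) ≡ x ∷ fill x n xs
fill-∷ x zero    xs = refl
fill-∷ x (suc n) xs = fill-∷ x n (x ∷ xs)

fill-bars : ∀ n xs → fill I n xs ≡ bars n xs
fill-bars zero    xs = refl
fill-bars (suc n) xs = trans (fill-∷ I n xs) (cong (I ∷_) (fill-bars n xs))

length-bars : ∀ n xs → length (bars n xs) ≡ n + length xs
length-bars zero    xs = refl
length-bars (suc n) xs = cong suc (length-bars n xs)

length-fill : ∀ x n xs → length (fill x n xs) ≡ n + length xs
length-fill x zero    xs = refl
length-fill x (suc n) xs = trans (length-fill x n (x ∷ xs)) (+-suc n _)

-- Together the two invariants say that the head on the tape of m is one digit ahead of the counter: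
-- a first digit is read in advance, and the remaining ℓ are available to the counter. `len-cap`
-- makes the time of an operation depend on the sizes seen so far instead of on m.
record Counter (ℓ N : ℕ) : Set where
  constructor counter
  field
    position : ℕ
    digits   : List Bool
    more     : List Bool
    pos-inv  : position + length more ≡ suc ℓ
    len-inv  : length digits + length more ≡ ℓ
    len-cap  : length digits ≤ N

open Counter

count : ∀ {ℓ N} → Counter ℓ N → ℕ
count c = value (digits c)

count<2^ℓ : ∀ {ℓ N} (c : Counter ℓ N) → count c < 2 ^ ℓ
count<2^ℓ (counter _ ds ms _ refl _) = <-≤-trans (value<2^length ds) (^-monoʳ-≤ 2 (m≤m+n (length ds) (length ms)))

infixl 20 _⟨_⟩

_⟨_⟩ : ∀ {ℓ N} → St → Counter ℓ N → St
st ⟨ c ⟩ = set mIn (stream (position c) (map Bit (more c))) (st [ CNT ≔ map Bit (digits c) ])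

-- The lens laws of two stacks in an otherwise arbitrary state. Loops are verified once from these
-- laws; for concrete tapes all four hold by `refl`.
record Two (i j : Fin 15) (at : List Letter → List Letter → St) : Set where
  field
    get₁ : ∀ xs ys → get i (at xs ys) ≡ stack xs
    get₂ : ∀ xs ys → get j (at xs ys) ≡ stack ys
    set₁ : ∀ xs ys zs → at xs ys [ i ≔ zs ] ≡ at zs ys
    set₂ : ∀ xs ys zs → at xs ys [ j ≔ zs ] ≡ at xs zs

-- Time and space of the elementary loops

module Execution (Φ : Verdict → St → Set) (Sk Sm Ss W : ℕ) where

  lim : Vec ℕ 15
  lim = Sk ∷ Sm ∷ Ss ∷ Vec.replicate 12 W

  H : List Prog → Reg → St → ℕ → Set
  H = Halt Φ lim

  enter : ∀ {c P K r st b} → c r ≡ true → H (P ∷ while c P ∷ K) r st b → H (while c P ∷ K) r st (1 + b)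
  enter {c} {P} {K} {r} {st} {b} e h =
    while′ (≡-subst (λ z → H (if z then P ∷ while c P ∷ K else K) r st b) (sym e) h)

  leave : ∀ {c P K r st b} → c r ≡ false → H K r st b → H (while c P ∷ K) r st (1 + b)
  leave {c} {P} {K} {r} {st} {b} e h =
    while′ (≡-subst (λ z → H (if z then P ∷ while c P ∷ K else K) r st b) (sym e) h)

  branch : ∀ {c P Q K r st b z} → c r ≡ z → H ((if z then P else Q) ∷ K) r st b → H (cond c P Q ∷ K) r st (1 + b)
  branch refl = cond′

  at-time : ∀ {K r st b c} → c ≡ b → H K r st b → H K r st c
  at-time refl h = h

  module _ {i j at} (two : Two i j at) where
    open Two two

    push₁ : ∀ {f xs ys K r b} → 2 + length (f r ∷ xs) ≤ lookup lim i →
            H K r (at (f r ∷ xs) ys) b → H (push i f ∷ K) r (at xs ys) (1 + b)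
    push₁ {f} {xs} {ys} {K} {r} {b} le h =
      push′ (get₁ xs ys) le (≡-subst (λ st → H K r st b) (sym (set₁ xs ys (f r ∷ xs))) h)

    push₂ : ∀ {f xs ys K r b} → 2 + length (f r ∷ ys) ≤ lookup lim j →
            H K r (at xs (f r ∷ ys)) b → H (push j f ∷ K) r (at xs ys) (1 + b)
    push₂ {f} {xs} {ys} {K} {r} {b} le h =
      push′ (get₂ xs ys) le (≡-subst (λ st → H K r st b) (sym (set₂ xs ys (f r ∷ ys))) h)

    pop₁ : ∀ {x xs ys K r b} → H K (just x) (at xs ys) b → H (pop i ∷ K) r (at (x ∷ xs) ys) (2 + b)
    pop₁ {x} {xs} {ys} {K} {r} {b} h =
      pop′ (get₁ (x ∷ xs) ys) (≡-subst (λ st → H K (just x) st b) (sym (set₁ (x ∷ xs) ys xs)) h)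

    pop₂ : ∀ {x xs ys K r b} → H K (just x) (at xs ys) b → H (pop j ∷ K) r (at xs (x ∷ ys)) (2 + b)
    pop₂ {x} {xs} {ys} {K} {r} {b} h =
      pop′ (get₂ xs (x ∷ ys)) (≡-subst (λ st → H K (just x) st b) (sym (set₂ xs (x ∷ ys) ys)) h)

    empty₁ : ∀ {ys K r b} → H K nothing (at [] ys) b → H (pop i ∷ K) r (at [] ys) (2 + b)
    empty₁ {ys} = empty′ (get₁ [] ys)

    empty₂ : ∀ {xs K r b} → H K nothing (at xs []) b → H (pop j ∷ K) r (at xs []) (2 + b)
    empty₂ {xs} = empty′ (get₂ xs [])

    transfer-halts : ∀ xs {ys K r b} → 2 + length (xs ʳ++ ys) ≤ lookup lim j →
                     H K nothing (at [] (xs ʳ++ ys)) b → H (transfer i j ∷ K) r (at xs ys) (length xs * 4 + (3 + b))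
    transfer-halts xs le h = seq′ (loop xs le h)
      where
      loop : ∀ xs {ys K r b} → 2 + length (xs ʳ++ ys) ≤ lookup lim j → H K nothing (at [] (xs ʳ++ ys)) b →
             H (pop i ∷ while is-just (push j keep ⨾ pop i) ∷ K) r (at xs ys) (length xs * 4 + (3 + b))
      loop []       le h = empty₁ (while′ h)
      loop (x ∷ xs) {ys} le h = pop₁ (while′ (seq′ (push₂ (≤-trans (s≤s (s≤s long)) le) (loop xs le h))))
        where
        long : length (x ∷ ys) ≤ length (xs ʳ++ (x ∷ ys))
        long = ≤-trans (m≤n+m _ (length xs)) (≤-reflexive (sym (length-ʳ++ xs)))

  module _ {i at} (two : Two i T at) where

    refill-halts : ∀ n x {xs K r b} → 2 + (n + length xs) ≤ lookup lim i →
                   H K nothing (at (fill x n xs) []) b → H (refill i x ∷ K) r (at xs (bars n [])) (n * 4 + (3 + b))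
    refill-halts n x le h = seq′ (loop n le h)
      where
      loop : ∀ n {xs K r b} → 2 + (n + length xs) ≤ lookup lim i → H K nothing (at (fill x n xs) []) b →
             H (pop T ∷ while is-just (push i (const x) ⨾ pop T) ∷ K) r (at xs (bars n [])) (n * 4 + (3 + b))
      loop zero    le h = empty₂ two (while′ h)
      loop (suc n) {xs} le h = pop₂ two (while′ (seq′ (push₁ two
        (≤-trans (s≤s (s≤s (s≤s (m≤n+m _ n)))) le)
        (loop n (≤-trans (≤-reflexive (cong (2 +_) (+-suc n _))) le) h))))

    dec-halts : ∀ bs {m K r b} → value bs ≡ suc m → 2 + length bs ≤ lookup lim i → 2 + length bs ≤ W →
                H K nothing (at (map Bit (decrement bs)) []) b →
                H (dec i ∷ K) r (at (map Bit bs) []) (decrement-time bs + b)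
    dec-halts bs e le le′ h = seq′ (seq′ (loop bs 0 e le le′ h))
      where
      loop : ∀ bs n {m K r b} → value bs ≡ suc m → 2 + (n + length bs) ≤ lookup lim i → 2 + (n + length bs) ≤ W →
             H K nothing (at (fill bit₁ n (map Bit (decrement bs))) []) b →
             H (pop i ∷ while zero? (push T (const I) ⨾ pop i) ∷ (cond is-just skip (exit spaceBoundNotReached)
                ⨾ push i (const bit₀) ⨾ refill i bit₁) ∷ K) r
               (at (map Bit bs) (bars n [])) (n * 4 + (decrement-time bs + b))
      loop (true ∷ bs) n {b = b} e le le′ h = slack (≤-reflexive (lemma n b))
        (pop₁ two (while′ (seq′ (cond′ (skip′ (seq′ (push₁ two
          (≤-trans (s≤s (s≤s (≤-trans (≤-reflexive (cong suc (length-map Bit bs))) (m≤n+m _ n)))) le)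
          (refill-halts n bit₁ (≤-trans (≤-reflexive (cong (λ l → 2 + (n + suc l)) (length-map Bit bs))) le)
            (slack (m≤n+m b 11) h)))))))))
        where
        lemma : ∀ n b → 6 + (n * 4 + (3 + (11 + b))) ≡ n * 4 + (20 + b)
        lemma = solve-∀
      loop (false ∷ bs) n {b = b} e le le′ h = slack (≤-reflexive (lemma n (decrement-time bs + b)))
        (pop₁ two (while′ (seq′ (push₂ two
          (≤-trans (≤-reflexive (cong (3 +_) (trans (length-bars n []) (+-identityʳ n))))
            (≤-trans (s≤s (s≤s (≤-trans (m≤m+n (suc n) _) (≤-reflexive (sym (+-suc n _)))))) le′))
          (slack (≤-reflexive (lemma₂ n (decrement-time bs + b))) (loop bs (suc n) (proj₂ half) (≤-trans (≤-reflexive (cong (2 +_) (sym (+-suc n _)))) le)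
            (≤-trans (≤-reflexive (cong (2 +_) (sym (+-suc n _)))) le′) h))))))
        where
        half : ∃ λ k → value bs ≡ suc k
        half with value bs
        ... | suc k = k , refl
        lemma : ∀ n x → 4 + (4 + (n * 4 + x)) ≡ n * 4 + (8 + x)
        lemma = solve-∀
        lemma₂ : ∀ n x → (4 + n * 4) + x ≡ 4 + (n * 4 + x)
        lemma₂ = solve-∀

    dec-fails : ∀ bs {K r b} → value bs ≡ 0 → 2 + length bs ≤ W → (∀ st → Φ spaceBoundNotReached st) →
                H (dec i ∷ K) r (at (map Bit bs) []) (length bs * 4 + (4 + b))
    dec-fails bs e le φ = seq′ (seq′ (loop bs 0 e le))
      where
      loop : ∀ bs n {K r b} → value bs ≡ 0 → 2 + (n + length bs) ≤ W →
             H (pop i ∷ while zero? (push T (const I) ⨾ pop i) ∷ (cond is-just skip (exit spaceBoundNotReached)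
                ⨾ push i (const bit₀) ⨾ refill i bit₁) ∷ K) r
               (at (map Bit bs) (bars n [])) (length bs * 4 + (4 + b))
      loop []           n e le = empty₁ two (while′ (seq′ (cond′ (exit′ (φ _)))))
      loop (false ∷ bs) n e le = pop₁ two (while′ (seq′ (push₂ two
        (≤-trans (≤-reflexive (cong (3 +_) (trans (length-bars n []) (+-identityʳ n))))
            (≤-trans (s≤s (s≤s (≤-trans (m≤m+n (suc n) _) (≤-reflexive (sym (+-suc n _)))))) le))
        (loop bs (suc n) (zeros (value bs) e) (≤-trans (≤-reflexive (cong (2 +_) (sym (+-suc n _)))) le)))))
        where
        zeros : ∀ n → n + (n + 0) ≡ 0 → n ≡ 0
        zeros zero e = refl

  drain-halts : ∀ i (at : List Letter → St) → (∀ xs → get i (at xs) ≡ stack xs) →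
                (∀ xs ys → at xs [ i ≔ ys ] ≡ at ys) → ∀ xs {K r b} →
                H K nothing (at []) b → H (drain i ∷ K) r (at xs) (length xs * 4 + (3 + b))
  drain-halts i at gt st xs h = seq′ (loop xs h)
    where
    loop : ∀ xs {K r b} → H K nothing (at []) b →
           H (pop i ∷ while is-just (skip ⨾ pop i) ∷ K) r (at xs) (length xs * 4 + (3 + b))
    loop []       h = empty′ (gt []) (while′ h)
    loop (x ∷ xs) {K} {r} {b} h = pop′ (gt (x ∷ xs)) (while′ (seq′ (skip′ (≡-subst (λ s → H _ (just x) s (length xs * 4 + (3 + b)))
      (sym (st (x ∷ xs) xs)) (loop xs h)))))

  module Counting {ℓ N : ℕ} (Sm-large : 3 + ℓ ≤ Sm) (W-large : 4 + N ≤ W) where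

    q : ℕ
    q = N * 8 + 20

    1≤q : ∀ b → 1 + b ≤ q + b
    1≤q b = +-monoˡ-≤ b (≤-trans (s≤s z≤n) (m≤n+m 20 (N * 8)))

    inc-halts : ∀ (st : St) (c : Counter ℓ N) {K r b} →
                (2 ^ ℓ ≤ suc (count c) → ∀ st → Φ spaceBoundReached st) →
                (suc (count c) < 2 ^ ℓ → suc (count c) ≤ N) →
                (∀ c′ → count c′ ≡ suc (count c) → H K nothing (st [ T ≔ [] ] ⟨ c′ ⟩) b) →
                H (inc ∷ K) r (st [ T ≔ [] ] ⟨ c ⟩) (q + b)
    inc-halts st c@(counter p ds ms pi li lc) {K} {r} {b} over fits h = seq′ (seq′ (slack
      (≤-trans (+-monoˡ-≤ (20 + b) (*-monoˡ-≤ 8 lc)) (≤-reflexive (sym (+-assoc (N * 8) 20 b))))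
      (loop ds 0 p ms (≤-trans (+-monoʳ-≤ 3 lc) (≤-trans (n≤1+n _) W-large)) p-bound
        (λ e e′ → over (≤-trans (≤-reflexive (cong (2 ^_) (trans (sym li) (trans (cong (λ ms → length ds + length ms) e′) (+-identityʳ _))))) (≤-reflexive e)))
        λ p′ ms′ e e′ → h (counter p′ (increment ds) ms′ (trans e′ pi) (trans e li) (cap (trans e li))) (value-increment ds))))
      where
      cap : ∀ {k} → length (increment ds) + k ≡ ℓ → length (increment ds) ≤ N
      cap {k} e = ≤-trans (grown ds) (⊔-lub lc (fits bound))
        where
        bound : suc (value ds) < 2 ^ ℓ
        bound = subst₂ (λ v l → v < 2 ^ l) (value-increment ds) e
          (<-≤-trans (value<2^length (increment ds)) (^-monoʳ-≤ 2 (m≤m+n (length (increment ds)) k)))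
        -- The length increases only if all digits are 1, and then the new value is at least the new
        -- length.
        grown : ∀ ds → length (increment ds) ≤ length ds ⊔ suc (value ds)
        grown []           = ≤-refl
        grown (false ∷ ds) = m≤m⊔n (suc (length ds)) (suc (2 * value ds))
        grown (true ∷ ds)  = ≤-trans (s≤s (grown ds)) 
          (⊔-monoʳ-≤ (suc (length ds)) (s≤s (s≤s (m≤m+n (value ds) (value ds + 0)))))
      two : ∀ p ms → Two CNT T (λ xs ys → set mIn (stream p (map Bit ms)) (st [ T ≔ ys ] [ CNT ≔ xs ]))
      two p ms = record { get₁ = λ _ _ → refl ; get₂ = λ _ _ → refl ; set₁ = λ _ _ _ → refl ; set₂ = λ _ _ _ → refl }
      p-bound : 2 + p ≤ Sm
      p-bound = ≤-trans (≤-trans (s≤s (s≤s (m≤m+n p (length ms)))) (≤-reflexive (cong (2 +_) pi))) Sm-large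
      loop : ∀ ds n p ms {r} → 3 + (n + length ds) ≤ W → 2 + p ≤ Sm →
             (2 ^ length ds ≡ suc (value ds) → ms ≡ [] → ∀ st → Φ spaceBoundReached st) →
             (∀ p′ ms′ → length (increment ds) + length ms′ ≡ length ds + length ms → p′ + length ms′ ≡ p + length ms →
               H K nothing (set mIn (stream p′ (map Bit ms′)) (st [ T ≔ [] ] [ CNT ≔ fill bit₀ n (map Bit (increment ds)) ])) b) →
             H (pop CNT ∷ while one? (push T (const I) ⨾ pop CNT)
                ∷ (cond is-just skip (read mIn ⨾ cond is-just skip (exit spaceBoundReached))
                ⨾ push CNT (const bit₁) ⨾ refill CNT bit₀) ∷ K) r
               (set mIn (stream p (map Bit ms)) (st [ T ≔ bars n [] ] [ CNT ≔ map Bit ds ])) (length ds * 8 + (n * 4 + (20 + b)))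
      -- All ℓ digits are 1 and m has none left, so the size about to be counted is exactly 2 ^ ℓ.
      loop []           n p []       le lp h₁ h =
        slack {b = 7} (≤-trans (m≤m+n 7 (13 + b)) (m≤n+m (20 + b) (n * 4))) $
        empty′ refl $ while′ $ seq′ $ cond′ $ seq′ $ end′ refl lp $ cond′ $ exit′ (h₁ refl refl _)
      loop []           n p (m ∷ ms) le lp h₁ h = slack (≤-reflexive (lemma n b)) $
        empty′ refl $ while′ $ seq′ $ cond′ $ seq′ $ read′ refl lp $ cond′ $ skip′ $
        seq′ $ push′ refl (≤-trans (s≤s (s≤s (s≤s z≤n))) le) $
        refill-halts (two (suc p) ms) n bit₀ (≤-trans (≤-reflexive (cong (2 +_) (+-suc n 0))) le) $
        slack (m≤n+m b 8) $ h (suc p) ms refl (sym (+-suc p _))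
        where
        lemma : ∀ n b → 9 + (n * 4 + (3 + (8 + b))) ≡ 0 + (n * 4 + (20 + b))
        lemma = solve-∀
      loop (false ∷ ds) n p ms       le lp h₁ h =
        slack (≤-trans (≤-reflexive (lemma n b)) (+-monoˡ-≤ (n * 4 + (20 + b)) (z≤n {suc (length ds) * 8}))) $
        pop′ refl $ while′ $ seq′ $ cond′ $ skip′ $
        seq′ $ push′ refl (≤-trans (s≤s (s≤s (s≤s (≤-trans (≤-reflexive (length-map Bit ds)) (≤-trans (n≤1+n _) (m≤n+m _ n)))))) le) $
        refill-halts (two p ms) n bit₀ (≤-trans (s≤s (s≤s (≤-reflexive (cong (λ l → n + suc l) (length-map Bit ds))))) (≤-trans (n≤1+n _) le)) $
        slack (m≤n+m b 11) $ h p ms refl refl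
        where
        lemma : ∀ n b → 6 + (n * 4 + (3 + (11 + b))) ≡ 0 + (n * 4 + (20 + b))
        lemma = solve-∀
      loop (true ∷ ds)  n p ms       le lp h₁ h = slack (≤-reflexive (lemma n (length ds * 8) (20 + b))) $
        pop′ refl $ while′ $ seq′ $
        push′ refl (≤-trans (≤-reflexive (cong (3 +_) (length-bars n []))) (≤-trans (+-monoʳ-≤ 3 (+-monoʳ-≤ n z≤n)) le)) $
        loop ds (suc n) p ms (≤-trans (≤-reflexive (cong (3 +_) (sym (+-suc n _)))) le) lp
          (λ e → h₁ (trans (cong (2 *_) e) (lemma₂ (value ds)))) (λ p′ ms′ e → h p′ ms′ (cong suc e))
        where
        lemma : ∀ n x y → 4 + (x + ((4 + n * 4) + y)) ≡ (8 + x) + (n * 4 + y)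
        lemma = solve-∀
        lemma₂ : ∀ v → 2 * suc v ≡ suc (suc (2 * v))
        lemma₂ = solve-∀

    dec-count : ∀ (st : St) (c : Counter ℓ N) {m K r b} → count c ≡ suc m →
                (∀ c′ → count c′ ≡ m → H K nothing (st [ T ≔ [] ] ⟨ c′ ⟩) b) →
                H (dec CNT ∷ K) r (st [ T ≔ [] ] ⟨ c ⟩) (q + b)
    dec-count st c@(counter p ds ms pi li lc) {b = b} e h =
      slack (+-monoˡ-≤ b (≤-trans (decrement-time-bound ds) (+-monoˡ-≤ 20 (*-monoˡ-≤ 8 lc)))) $
      dec-halts {at = λ xs ys → set mIn (stream p (map Bit ms)) (st [ T ≔ ys ] [ CNT ≔ xs ])}
        (record { get₁ = λ _ _ → refl ; get₂ = λ _ _ → refl ; set₁ = λ _ _ _ → refl ; set₂ = λ _ _ _ → refl })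
        ds e le le $
      h (counter p (decrement ds) ms pi (trans (cong (_+ length ms) (length-decrement ds)) li)
          (≤-trans (≤-reflexive (length-decrement ds)) lc)) (value-decrement ds e)
      where
      le : 2 + length ds ≤ W
      le = ≤-trans (+-monoʳ-≤ 2 lc) (≤-trans (m≤n+m (2 + N) 2) W-large)

-- The phases of a reduction step

-- Pushing the code encode t [] onto the stack xs leaves revert t xs.
encode revert : Term → List Letter → List Letter
encode (# n)   xs = Var ∷ bars n xs
encode (s · t) xs = encode s (encode t (App ∷ xs))
encode (ƛ s)   xs = Lam ∷ encode s (Ret ∷ xs)
revert (# n)   xs = fill I n (Var ∷ xs)
revert (s · t) xs = App ∷ revert t (revert s xs)
revert (ƛ s)   xs = Ret ∷ revert s (Lam ∷ xs)

-- The number of letters in the code. An abstraction takes two of them but adds only one to the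
-- size, which is the origin of the factor 2 in the bounds on tapes.
weight : Term → ℕ
weight (# n)   = 1 + n
weight (s · t) = 1 + (weight s + weight t)
weight (ƛ s)   = 2 + weight s

weight≤2*size : ∀ t → weight t ≤ size t + size t
weight≤2*size (# n)   = m≤m+n (1 + n) _
weight≤2*size (s · t) = ≤-trans (s≤s (+-mono-≤ (weight≤2*size s) (weight≤2*size t)))
  (≤-trans (n≤1+n _) (≤-reflexive (lemma (size s) (size t))))
  where
  lemma : ∀ a b → 2 + ((a + a) + (b + b)) ≡ (1 + a + b) + (1 + a + b)
  lemma = solve-∀
weight≤2*size (ƛ s)   = ≤-trans (s≤s (s≤s (weight≤2*size s))) (≤-reflexive (cong suc (sym (+-suc _ _))))

length-revert : ∀ t xs → length (revert t xs) ≡ weight t + length xs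
length-revert (# n)   xs = trans (length-fill I n _) (+-suc n _)
length-revert (s · t) xs = cong suc (trans (length-revert t _) (trans (cong (weight t +_) (length-revert s xs))
  (lemma (weight s) (weight t) (length xs))))
  where
  lemma : ∀ a b c → b + (a + c) ≡ (a + b) + c
  lemma = solve-∀
length-revert (ƛ s)   xs = cong suc (trans (length-revert s _) (+-suc _ _))

length-encode : ∀ t xs → length (encode t xs) ≡ weight t + length xs
length-encode (# n)   xs = cong suc (length-bars n xs)
length-encode (s · t) xs = trans (length-encode s _) (trans (cong (weight s +_) (length-encode t _))
  (lemma (weight s) (weight t) (length xs)))
  where
  lemma : ∀ a b c → a + (b + suc c) ≡ suc ((a + b) + c)
  lemma = solve-∀
length-encode (ƛ s)   xs = cong suc (trans (length-encode s _) (+-suc _ _))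

-- `transfer` acts on stacks as `_ʳ++_`, so this is how a term assembled in reverse becomes code
-- again.
revert-ʳ++ : ∀ t xs ys → revert t xs ʳ++ ys ≡ xs ʳ++ encode t ys
revert-ʳ++ (# n)   xs ys rewrite fill-bars n (Var ∷ xs) = bars-ʳ++ n ys
  where
  bars-ʳ++ : ∀ n ys → bars n (Var ∷ xs) ʳ++ ys ≡ xs ʳ++ (Var ∷ bars n ys)
  bars-ʳ++ zero    ys = refl
  bars-ʳ++ (suc n) ys = trans (bars-ʳ++ n (I ∷ ys)) (cong (λ zs → xs ʳ++ (Var ∷ zs))
    (trans (sym (fill-bars n (I ∷ ys))) (fill-bars (suc n) ys)))
revert-ʳ++ (s · t) xs ys = trans (revert-ʳ++ t (revert s xs) (App ∷ ys)) (revert-ʳ++ s xs _)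
revert-ʳ++ (ƛ s)   xs ys = revert-ʳ++ s (Lam ∷ xs) (Ret ∷ ys)

encode-ʳ++ : ∀ t xs ys → encode t xs ʳ++ ys ≡ xs ʳ++ revert t ys
encode-ʳ++ (# n)   xs ys = bars-ʳ++ n (Var ∷ ys)
  where
  bars-ʳ++ : ∀ n ys → bars n xs ʳ++ ys ≡ xs ʳ++ fill I n ys
  bars-ʳ++ zero    ys = refl
  bars-ʳ++ (suc n) ys = bars-ʳ++ n (I ∷ ys)
encode-ʳ++ (s · t) xs ys = trans (encode-ʳ++ s _ ys) (encode-ʳ++ t (App ∷ xs) _)
encode-ʳ++ (ƛ s)   xs ys = encode-ʳ++ s (Ret ∷ xs) (Lam ∷ ys)

encode-longer : ∀ t {xs} → length xs ≤ length (encode t xs)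
encode-longer t = ≤-trans (m≤n+m _ (weight t)) (≤-reflexive (sym (length-encode t _)))

revert-longer : ∀ t {xs} → length xs ≤ length (revert t xs)
revert-longer t = ≤-trans (m≤n+m _ (weight t)) (≤-reflexive (sym (length-revert t _)))

bump : ∀ {a n} → a ≤ n + n → 2 + a ≤ suc n + suc n
bump {n = n} le = ≤-trans (s≤s (s≤s le)) (≤-reflexive (cong suc (sym (+-suc n n))))

-- The programs of the phases

tally : Prog
tally = cond ret? skip inc

-- Taking the function and the argument out of the count leaves the size of the context alone. While
-- the contractum is written, the counter then climbs to the size of the next term; counting the
-- redex as well would overshoot `Space`.
popBlock : Fin 15 → Prog
popBlock j = each V block? (push j keep ⨾ cond ret? skip (dec CNT))

-- The register serves as loop condition. It stays a letter until `pop D` fails, and that happens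
-- exactly at the `Ret` closing the abstraction.
shiftLoop shift : Prog
shiftLoop = while is-just (pop C ⨾ push V keep ⨾ cond lam? (push D (const I)) (cond ret? (pop D) skip))
shift     = push V (const bit₁) ⨾ push V keep ⨾ shiftLoop

loadLoop load : Prog
loadLoop = while is-just ((push X keep ⨾ tally) ⨾ read sIn)
load     = (read sIn ⨾ loadLoop) ⨾ transfer X C

-- The variable n pops D once for itself and once for each of its n bars,
-- moving what it finds to Y; Var stands there for a failed attempt.
mark : Reg → Letter
mark (just _) = I
mark nothing  = Var

matchStep match restore unchanged replaced decide : Prog
matchStep = pop D ⨾ push Y mark ⨾ pop F ⨾ cond bar? (push X (const I)) skip
match     = matchStep ⨾ while bar? matchStep
restore   = while is-just (cond bar? (push D (const I)) skip ⨾ pop Y)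
unchanged = restore ⨾ push G (const Var) ⨾ inc ⨾ each X is-just (push G keep ⨾ inc)
replaced  = restore ⨾ drain X ⨾ each U is-just (push G keep ⨾ push X keep ⨾ tally) ⨾ transfer X U
decide    = pop Y ⨾ cond var? (pop Y ⨾ cond var? unchanged replaced) unchanged

-- A `Ret` met with `D` empty closes the function itself; it is dropped, and the failed pop ends the
-- loop. `match` recognises the end of an index only by popping the next letter, hence `push F keep`
-- puts that letter back.
substLoop substitute : Prog
substLoop = while is-just
  (cond ret? (pop D ⨾ cond is-just (push G (const Ret) ⨾ pop F) skip)
  (cond lam? (push G keep ⨾ push D (const I) ⨾ inc ⨾ pop F)
  (cond app? (push G keep ⨾ inc ⨾ pop F)
  (match ⨾ push F keep ⨾ decide ⨾ pop F))))
substitute = pop F ⨾ substLoop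

beta : Prog
beta = dec K ⨾ dec K ⨾ dec K ⨾ dec CNT ⨾ popBlock U ⨾ popBlock F
     ⨾ pop F ⨾ substitute ⨾ transfer G C ⨾ drain U

reduceLoop : Prog
reduceLoop = while is-just (cond lam? shift (cond app? beta (exit spaceBoundNotReached)) ⨾ pop C)

finish : Prog
finish = each V block? (push X keep) ⨾ each X is-just (push out keep) ⨾ exit term

main : Prog
main = (read kIn ⨾ while is-just (push X keep ⨾ read kIn)) ⨾ transfer X K ⨾ dec K
     ⨾ read mIn ⨾ cond is-just skip (exit spaceBoundReached)
     ⨾ load ⨾ (pop C ⨾ reduceLoop) ⨾ finish

-- Comparing an index with the depth

marks : ℕ → ℕ → List Letter → List Letter
marks zero    d       ys = ys
marks (suc n) zero    ys = marks n zero (Var ∷ ys)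
marks (suc n) (suc d) ys = marks n d (I ∷ ys)

-- Popping `n + 1` times from `n` bars fails once, at the very end. With more bars no attempt fails,
-- with fewer at least two do; therefore `decide` inspects just the two topmost marks.
marks-equal : ∀ n ys → marks (suc n) n ys ≡ Var ∷ fill I n ys
marks-equal zero    ys = refl
marks-equal (suc n) ys = marks-equal n (I ∷ ys)

marks-less : ∀ n k ys → marks (suc n) (suc (n + k)) ys ≡ I ∷ fill I n ys
marks-less zero    k ys = refl
marks-less (suc n) k ys = marks-less n k (I ∷ ys)

marks-greater : ∀ d k ys → ∃ λ zs → marks (suc (suc (d + k))) d ys ≡ Var ∷ Var ∷ zs
marks-greater zero    k ys = fill Var k ys , trans (exhausted (2 + k) ys) (trans (fill-∷ Var k (Var ∷ ys)) (cong (Var ∷_) (fill-∷ Var k ys)))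
  where
  exhausted : ∀ n ys → marks n zero ys ≡ fill Var n ys
  exhausted zero    ys = refl
  exhausted (suc n) ys = exhausted n (Var ∷ ys)
marks-greater (suc d) k ys = marks-greater d k (I ∷ ys)

marks-differ : ∀ n d → n ≢ d → (∃ λ ys → marks (suc n) d [] ≡ I ∷ ys) ⊎ (∃ λ ys → marks (suc n) d [] ≡ Var ∷ Var ∷ ys)
marks-differ n d n≢d with compare n d
... | less    _ k = inj₁ (_ , marks-less n k [])
... | equal   _   = contradiction refl n≢d
... | greater _ k = inj₂ (marks-greater d k [])

length-marks : ∀ n d ys → length (marks n d ys) ≡ n + length ys
length-marks zero    d       ys = refl
length-marks (suc n) zero    ys = trans (length-marks n zero (Var ∷ ys)) (+-suc n _)
length-marks (suc n) (suc d) ys = trans (length-marks n d (I ∷ ys)) (+-suc n _)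

restored : List Letter → List Letter → List Letter
restored []       ds = ds
restored (x ∷ ys) ds = restored ys (if bar? (just x) then I ∷ ds else ds)

-- Each successful pop left a bar among the marks and each failed one took nothing away, so
-- returning the bars recovers the depth for the variables to come.
restored-marks : ∀ n d ys → restored (marks n d ys) (bars (d ∸ n) []) ≡ restored ys (bars d [])
restored-marks zero    d       ys = refl
restored-marks (suc n) zero    ys = trans (cong (λ k → restored (marks n 0 (Var ∷ ys)) (bars k [])) (sym (0∸n≡0 n))) (restored-marks n zero (Var ∷ ys))
restored-marks (suc n) (suc d) ys = restored-marks n d (I ∷ ys)

tallied : List Letter → ℕ
tallied []       = 0
tallied (x ∷ xs) = (if ret? (just x) then 0 else 1) + tallied xs

-- `Ret` is the only letter without a share in the size: an index in unary has as many letters as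
-- its size, and `Lam` and `App` account for the other constructors.
tallied-encode : ∀ t xs → tallied (encode t xs) ≡ size t + tallied xs
tallied-encode (# n)   xs = cong suc (tallied-bars n)
  where
  tallied-bars : ∀ n → tallied (bars n xs) ≡ n + tallied xs
  tallied-bars zero    = refl
  tallied-bars (suc n) = cong suc (tallied-bars n)
tallied-encode (s · t) xs = trans (tallied-encode s _) (trans (cong (size s +_) (tallied-encode t _))
  (lemma (size s) (size t) (tallied xs)))
  where
  lemma : ∀ a b c → a + (b + suc c) ≡ suc (a + b + c)
  lemma = solve-∀
tallied-encode (ƛ s)   xs = cong suc (tallied-encode s _)

-- The bars of an index are read until another letter appears, so what follows a variable must be
-- nonempty and must not start with a bar.
data Stops : List Letter → Set where
  stops : ∀ {x xs} → bar? (just x) ≡ false → Stops (x ∷ xs)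

stops-encode : ∀ t {xs} → Stops (encode t xs)
stops-encode (# n)   = stops refl
stops-encode (s · t) = stops-encode s
stops-encode (ƛ s)   = stops refl

-- Time and space of the phases

module Phases (Φ : Verdict → St → Set) {Sk Sm Ss W ℓ N : ℕ}
              (Sm-large : 3 + ℓ ≤ Sm) (Ss-large : 4 + (N + N) ≤ Ss) (W-large : 8 + (N + N + (N + N)) ≤ W) where

  open Execution Φ Sk Sm Ss W
  open Counting {ℓ} {N} Sm-large (≤-trans (+-mono-≤ (m≤m+n 4 4) (≤-trans (m≤m+n N N) (m≤m+n (N + N) _))) W-large)

  app-time : ∀ x y c b → suc (x + y) * c + b ≡ c + (y * c + (x * c + b))
  app-time = solve-∀

  app-time′ : ∀ x y c b → suc (x + y) * c + b ≡ x * c + (y * c + (c + b))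
  app-time′ = solve-∀

  lam-time : ∀ x c b → (2 + x) * c + b ≡ c + (x * c + (c + b))
  lam-time = solve-∀

  var-time : ∀ n c b → (1 + n) * c + b ≡ n * c + (c + b)
  var-time = solve-∀

  module PopBlock {j} (f : List Letter → List Letter → St)
           (two : ∀ (c : Counter ℓ N) → Two V j (λ xs ys → f xs ys [ T ≔ [] ] ⟨ c ⟩)) where

    step : Prog
    step = (push j keep ⨾ cond ret? skip (dec CNT)) ⨾ pop V

    Step : (List Prog) → List Letter → List Letter → Counter ℓ N → ℕ → Set
    Step K xs ys c b = ∀ r → H (pop V ∷ while block? step ∷ K) r (f xs ys [ T ≔ [] ] ⟨ c ⟩) b

    pop-counted : ∀ x c xs ys {m K b} → ret? (just x) ≡ false → block? (just x) ≡ true →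
                  count c ≡ suc m → 3 + length ys ≤ lookup lim j →
                  (∀ c′ → count c′ ≡ m → Step K xs (x ∷ ys) c′ b) → Step K (x ∷ xs) ys c ((5 + q) + b)
    pop-counted x c xs ys ¬ret blk e le h r =
      pop₁ (two c) $ enter blk $ seq′ $ seq′ $ push₂ (two c) le $ branch ¬ret $
      dec-count (f xs (x ∷ ys)) c e λ c′ e′ → h c′ e′ _

    pop-Ret : ∀ c xs ys {K b} → 3 + length ys ≤ lookup lim j → Step K xs (Ret ∷ ys) c b → Step K (Ret ∷ xs) ys c ((5 + q) + b)
    pop-Ret c xs ys {b = b} le h r =
      pop₁ (two c) $ while′ $ seq′ $ seq′ $ push₂ (two c) le $ cond′ $ slack (1≤q b) $ skip′ $ h _

    pop-bars : ∀ n c xs ys {m K b} → count c ≡ n + m → 2 + length (bars n ys) ≤ lookup lim j →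
               (∀ c′ → count c′ ≡ m → Step K xs (bars n ys) c′ b) → Step K (bars n xs) ys c (n * (5 + q) + b)
    pop-bars zero    c xs ys e le h = h c e
    pop-bars (suc n) c xs ys {K = K} {b} e le h r = at-time (+-assoc (5 + q) (n * (5 + q)) b) $
      pop-counted I c (bars n xs) ys refl refl e (≤-trans (s≤s (s≤s (s≤s (≤-trans (m≤n+m _ n) (≤-reflexive (sym (length-bars n ys))))))) le)
      (λ c′ e′ → pop-bars n c′ xs (I ∷ ys) e′ (≤-trans (≤-reflexive (cong (λ zs → 2 + length zs) (sym back))) le)
        (λ c″ e″ → ≡-subst (λ zs → Step K xs zs c″ b) back (h c″ e″))) r
      where
      back : bars (suc n) ys ≡ bars n (I ∷ ys)
      back = trans (sym (fill-bars (suc n) ys)) (fill-bars n (I ∷ ys))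

    pop-term : ∀ t c xs ys {m K b} → count c ≡ size t + m → 2 + length (encode t ys) ≤ lookup lim j →
               (∀ c′ → count c′ ≡ m → Step K xs (encode t ys) c′ b) → Step K (revert t xs) ys c (weight t * (5 + q) + b)
    pop-term (# n)   c xs ys {m} {K} {b} e le h r = at-time (var-time n (5 + q) b) $
      ≡-subst (λ zs → Step K zs ys c (n * (5 + q) + ((5 + q) + b))) (sym (fill-bars n (Var ∷ xs)))
      (pop-bars n c (Var ∷ xs) ys (trans e (sym (+-suc n m))) (≤-trans (n≤1+n _) le) λ c′ e′ →
      pop-counted Var c′ xs (bars n ys) refl refl e′ le h) r
    pop-term (s · t) c xs ys {m} {b = b} e le h r = at-time (app-time (weight s) (weight t) (5 + q) b) $
      pop-counted App c (revert t (revert s xs)) ys refl refl e (≤-trans (s≤s (s≤s (≤-trans (encode-longer t) (encode-longer s)))) le) (λ c′ e′ →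
      pop-term t c′ (revert s xs) (App ∷ ys) (trans e′ (lemma (size s) (size t) m)) (≤-trans (s≤s (s≤s (encode-longer s))) le) λ c″ e″ →
      pop-term s c″ xs (encode t (App ∷ ys)) e″ le h) r
      where
      lemma : ∀ a b m → a + b + m ≡ b + (a + m)
      lemma = solve-∀
    pop-term (ƛ s)   c xs ys {m} {b = b} e le h r = at-time (lam-time (weight s) (5 + q) b) $
      pop-Ret c (revert s (Lam ∷ xs)) ys (≤-trans (s≤s (s≤s (≤-trans (encode-longer s) (n≤1+n _)))) le)
      (pop-term s c (Lam ∷ xs) (Ret ∷ ys) (trans e (sym (+-suc (size s) m))) (≤-trans (n≤1+n _) le) λ c′ e′ →
      pop-counted Lam c′ xs (encode s (Ret ∷ ys)) refl refl e′ le h) r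

    popBlock-halts : ∀ t c xs ys {m K r b} → count c ≡ size t + m → 2 + length (encode t ys) ≤ lookup lim j →
                     (∀ c′ → count c′ ≡ m → H K (just bit₁) (f xs (encode t ys) [ T ≔ [] ] ⟨ c′ ⟩) b) →
                     H (popBlock j ∷ K) r (f (revert t (bit₁ ∷ xs)) ys [ T ≔ [] ] ⟨ c ⟩) (weight t * (5 + q) + (3 + b))
    popBlock-halts t c xs ys e le h = seq′ $ pop-term t c (bit₁ ∷ xs) ys e le (λ c′ e′ r → pop₁ (two c′) $ while′ $ h c′ e′) _

  shift-bars : ∀ n st cs vs {K b} → 2 + length (fill I n vs) ≤ W →
               (∀ x → H (shiftLoop ∷ K) (just x) (st [ C ≔ cs ] [ V ≔ fill I n vs ]) b) →
               ∀ x → H (shiftLoop ∷ K) (just x) (st [ C ≔ bars n cs ] [ V ≔ vs ]) (n * 8 + b)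
  shift-bars zero    st cs vs le h = h
  shift-bars (suc n) st cs vs {b = b} le h x = while′ $ seq′ $ pop′ refl $ seq′ $
    push′ refl (≤-trans (s≤s (s≤s (≤-trans (m≤n+m _ n) (≤-reflexive (sym (length-fill I n _)))))) le) $
    cond′ $ cond′ $ slack (m≤n+m _ 1) $ skip′ $ shift-bars n st cs (I ∷ vs) le h I

  -- A complete subterm leaves `D` as it was, since its `Lam` and `Ret` are balanced. Hence no `Ret`
  -- inside it can end the loop.
  shift-term : ∀ t st cs vs ds {K b} → 2 + length (revert t vs) ≤ W → 2 + (length ds + weight t) ≤ W →
               (∀ x → H (shiftLoop ∷ K) (just x) (st [ C ≔ cs ] [ V ≔ revert t vs ] [ D ≔ ds ]) b) →
               ∀ x → H (shiftLoop ∷ K) (just x) (st [ C ≔ encode t cs ] [ V ≔ vs ] [ D ≔ ds ]) (weight t * 8 + b)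
  shift-term (# n)   st cs vs ds le le′ h x = while′ $ seq′ $ pop′ refl $ seq′ $
    push′ refl (≤-trans (s≤s (s≤s (≤-trans (m≤n+m _ n) (≤-reflexive (sym (length-fill I n _)))))) le) $
    cond′ $ cond′ $ slack (m≤n+m _ 1) $ skip′ $ shift-bars n (st [ D ≔ ds ]) cs (Var ∷ vs) le h Var
  shift-term (s · t) st cs vs ds {b = b} le le′ h x = at-time (app-time′ (weight s) (weight t) 8 b) $
    shift-term s st (encode t (App ∷ cs)) vs ds (≤-trans (s≤s (s≤s (revert-longer t))) (≤-trans (n≤1+n _) le))
      (≤-trans (s≤s (s≤s (+-monoʳ-≤ (length ds) (≤-trans (m≤m+n _ (weight t)) (n≤1+n _))))) le′)
    (shift-term t st (App ∷ cs) (revert s vs) ds (≤-trans (n≤1+n _) le)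
      (≤-trans (s≤s (s≤s (+-monoʳ-≤ (length ds) (≤-trans (m≤n+m _ (weight s)) (n≤1+n _))))) le′)
    λ x → while′ $ seq′ $ pop′ refl $ seq′ $ push′ refl le $ cond′ $ cond′ $ slack (m≤n+m _ 1) $ skip′ $ h App) x
  shift-term (ƛ s)   st cs vs ds {b = b} le le′ h x = at-time (lam-time (weight s) 8 b) $
    while′ $ seq′ $ pop′ refl $ seq′ $ push′ refl (≤-trans (s≤s (s≤s (≤-trans (revert-longer s) (n≤1+n _)))) le) $
    cond′ $ slack (m≤n+m _ 2) $ push′ refl (≤-trans (s≤s (s≤s (≤-trans (s≤s (≤-trans (m≤m+n (length ds) _) (n≤1+n _))) (≤-reflexive (lemma (length ds) (weight s)))))) le′) $
    shift-term s st (Ret ∷ cs) (Lam ∷ vs) (I ∷ ds) (≤-trans (n≤1+n _) le) (≤-trans (s≤s (s≤s (≤-trans (n≤1+n _) (≤-reflexive (lemma (length ds) (weight s)))))) le′)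
    (λ x → while′ $ seq′ $ pop′ refl $ seq′ $ push′ refl le $ cond′ $ cond′ $ pop′ refl $ h I) Lam
    where
    lemma : ∀ d w → 2 + (d + w) ≡ d + (2 + w)
    lemma = solve-∀

  shift-halts : ∀ t st cs vs {K b} → 2 + length (revert (ƛ t) (bit₁ ∷ vs)) ≤ W → 2 + weight t ≤ W →
                H K nothing (st [ C ≔ cs ] [ V ≔ revert (ƛ t) (bit₁ ∷ vs) ] [ D ≔ [] ]) b →
                H (shift ∷ K) (just Lam) (st [ C ≔ encode t (Ret ∷ cs) ] [ V ≔ vs ] [ D ≔ [] ]) (weight t * 8 + (11 + b))
  shift-halts t st cs vs {b = b} le le′ h = at-time (lemma (weight t * 8) b) $
    seq′ $ push′ refl (≤-trans (s≤s (s≤s (≤-trans (n≤1+n _) (≤-trans (revert-longer t) (n≤1+n _))))) le) $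
    seq′ $ push′ refl (≤-trans (s≤s (s≤s (≤-trans (revert-longer t) (n≤1+n _)))) le) $
    shift-term t st (Ret ∷ cs) (Lam ∷ bit₁ ∷ vs) [] (≤-trans (n≤1+n _) le) le′
    (λ x → while′ $ seq′ $ pop′ refl $ seq′ $ push′ refl le $ cond′ $ cond′ $ empty′ refl $ leave refl h) Lam
    where
    lemma : ∀ w b → w + (11 + b) ≡ 2 + (w + (9 + b))
    lemma = solve-∀

  -- `total` is the size that the counter would finally reach, possibly far beyond what m permits.
  -- Being a counter value, every intermediate count is below 2 ^ ℓ, and it is at most `total`;
  -- `cap` turns both into the bound N. So the resources are under control even in a phase that is
  -- cut off by an overflow.
  module Bounded (total : ℕ) (over : 2 ^ ℓ ≤ total → ∀ st → Φ spaceBoundReached st)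
                 (cap : ∀ n → n < 2 ^ ℓ → n ≤ total → n ≤ N) where

    count≤N : ∀ (c : Counter ℓ N) {n} → count c ≡ n → n ≤ total → n ≤ N
    count≤N c refl = cap (count c) (count<2^ℓ c)

    inc-count : ∀ st (c : Counter ℓ N) {n K r b} → count c ≡ n → suc n ≤ total →
                (∀ c′ → count c′ ≡ suc n → H K nothing (st [ T ≔ [] ] ⟨ c′ ⟩) b) →
                H (inc ∷ K) r (st [ T ≔ [] ] ⟨ c ⟩) (q + b)
    inc-count st c refl le h = inc-halts st c (λ le′ → over (≤-trans le′ le)) (λ lt → cap _ lt le) h

    -- The loading time is charged to the room left below N, since an
    -- input larger than that is not read to the end.
    credit : ℕ → ℕ → ℕ
    credit n d = ((suc N ∸ n) + (suc N ∸ n) + d) * (6 + q)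

    -- A counted letter releases two units. For `Lam` one is spent at once, and the other is kept in
    -- `d` for the `Ret` that will follow without being counted.
    credit-open : ∀ {n d} → n ≤ N → (6 + q) + credit (suc n) (suc d) ≡ credit n d
    credit-open {n} {d} le rewrite +-∸-assoc 1 le = lemma (N ∸ n) d (6 + q)
      where
      lemma : ∀ k d x → x + (k + k + suc d) * x ≡ (suc k + suc k + d) * x
      lemma = solve-∀

    credit-step : ∀ {n d} → n ≤ N → (6 + q) + credit (suc n) d ≤ credit n d
    credit-step {n} {d} le = ≤-trans (+-monoʳ-≤ (6 + q) (*-monoˡ-≤ (6 + q) (+-monoʳ-≤ ((N ∸ n) + (N ∸ n)) (n≤1+n d))))
      (≤-reflexive (credit-open {n} {d} le))

    credit-close : ∀ n d → (6 + q) + credit n d ≡ credit n (suc d)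
    credit-close n d = lemma (suc N ∸ n) d (6 + q)
      where
      lemma : ∀ k d x → x + (k + k + d) * x ≡ (k + k + suc d) * x
      lemma = solve-∀

    Load : List Prog → St → List Letter → List Letter → Counter ℓ N → ℕ → Set
    Load K st ys xs c b =
      ∀ r → H (read sIn ∷ loadLoop ∷ K) r (set sIn (stream (length xs) ys) (st [ X ≔ xs ]) [ T ≔ [] ] ⟨ c ⟩) b

    room : ∀ {l n} → l ≤ n + n → n ≤ N → 3 + l ≤ W
    room {l} {n} le le′ = ≤-trans (+-mono-≤ {3} {8} (m≤m+n 3 5) (≤-trans le (≤-trans (+-mono-≤ le′ le′) (m≤m+n (N + N) _)))) W-large

    load-counted : ∀ x st c ys xs {n K b} → ret? (just x) ≡ false → count c ≡ n → suc n ≤ total → length xs ≤ n + n →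
                   (∀ c′ → count c′ ≡ suc n → Load K st ys (x ∷ xs) c′ b) → Load K st (x ∷ ys) xs c ((6 + q) + b)
    load-counted x st c ys xs ¬ret e le le′ h r =
      read′ refl (≤-trans (s≤s (s≤s (≤-trans le′ (≤-trans (+-mono-≤ n≤N n≤N) (m≤n+m (N + N) 2))))) Ss-large) $
      while′ $ seq′ $ seq′ $ push′ refl (room le′ n≤N) $ branch ¬ret $ slack (n≤1+n _) $
      inc-count (set sIn (stream (suc (length xs)) ys) (st [ X ≔ x ∷ xs ])) c e le λ c′ e′ → h c′ e′ _
      where n≤N = count≤N c e (≤-trans (n≤1+n _) le)

    load-Ret : ∀ st c ys xs {n K b} → count c ≡ n → n ≤ total → length xs ≤ n + n →
               Load K st ys (Ret ∷ xs) c b → Load K st (Ret ∷ ys) xs c ((6 + q) + b)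
    load-Ret st c ys xs {b = b} e le le′ h r =
      read′ refl (≤-trans (s≤s (s≤s (≤-trans le′ (≤-trans (+-mono-≤ n≤N n≤N) (m≤n+m (N + N) 2))))) Ss-large) $
      while′ $ seq′ $ seq′ $ push′ refl (room le′ n≤N) $ cond′ $ slack (n≤1+n _) $ slack (1≤q b) $ skip′ $ h _
      where n≤N = count≤N c e le

    -- Each counted letter brings at most one `Ret`. The letters read so far together with the `d`
    -- outstanding `Ret` therefore number at most twice the count, which bounds the tapes before the
    -- whole input has been seen.
    Loaded : List Prog → St → List Letter → List Letter → ℕ → ℕ → ℕ → Set
    Loaded K st ys xs n d b = ∀ c → count c ≡ n → length xs + d ≤ n + n → Load K st ys xs c (credit n d + b)

    load-bars : ∀ k st c ys xs {n d K b} → count c ≡ n → k + n ≤ total → length xs + d ≤ n + n →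
                (∀ n′ → n′ ≡ k + n → Loaded K st ys (fill I k xs) n′ d b) →
                Load K st (bars k ys) xs c (credit n d + b)
    load-bars zero    st c ys xs {n} e le le′ h = h n refl c e le′
    load-bars (suc k) st c ys xs {n} {d} {K} {b} e le le′ h r =
      slack (≤-trans (≤-reflexive (sym (+-assoc (6 + q) (credit (suc n) d) b))) (+-monoˡ-≤ b (credit-step {n} {d} (count≤N c e (≤-trans (m≤n+m n (suc k)) le))))) $
      load-counted I st c (bars k ys) xs {K = K} refl e (≤-trans (s≤s (m≤n+m n k)) le) (≤-trans (m≤m+n _ d) le′) (λ c′ e′ →
      load-bars k st c′ ys (I ∷ xs) e′ (≤-trans (≤-reflexive (+-suc k n)) le) (≤-trans (n≤1+n _) (bump le′)) λ n′ e″ →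
      h n′ (trans e″ (+-suc k n))) r

    load-term : ∀ t st c ys xs {n d K b} → count c ≡ n → size t + n ≤ total → length xs + d ≤ n + n →
                (∀ n′ → n′ ≡ size t + n → Loaded K st ys (revert t xs) n′ d b) →
                Load K st (encode t ys) xs c (credit n d + b)
    load-term (# k) st c ys xs {n} {d} {K} {b} e le le′ h r =
      slack (≤-trans (≤-reflexive (sym (+-assoc (6 + q) (credit (suc n) d) b))) (+-monoˡ-≤ b (credit-step {n} {d} (count≤N c e (≤-trans (m≤n+m n (suc k)) le))))) $
      load-counted Var st c (bars k ys) xs {K = K} refl e (≤-trans (s≤s (m≤n+m n k)) le) (≤-trans (m≤m+n _ d) le′) (λ c′ e′ →
      load-bars k st c′ ys (Var ∷ xs) e′ (≤-trans (≤-reflexive (+-suc k n)) le) (≤-trans (n≤1+n _) (bump le′)) λ n′ e″ →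
      h n′ (trans e″ (+-suc k n))) r
    load-term (s · t) st c ys xs {n} {d} {K} {b} e le le′ h =
      load-term s st c (encode t (App ∷ ys)) xs {K = K} e (≤-trans (≤-trans (m≤n+m _ (suc (size t))) (≤-reflexive (lemma (size s) (size t) n))) le) le′ λ n₁ e₁ c₁ f₁ l₁ →
      load-term t st c₁ (App ∷ ys) (revert s xs) {K = K} f₁ (≤-trans (≤-trans (n≤1+n _) (≤-reflexive (trans (cong (λ m → suc (size t + m)) e₁) (lemma (size s) (size t) n)))) le) l₁ λ n₂ e₂ c₂ f₂ l₂ r →
      let eq = trans (cong suc (trans e₂ (cong (size t +_) e₁))) (lemma (size s) (size t) n)
          le₂ = ≤-trans (≤-reflexive eq) le in
      slack (≤-trans (≤-reflexive (sym (+-assoc (6 + q) (credit (suc n₂) d) b))) (+-monoˡ-≤ b (credit-step {n₂} {d} (count≤N c₂ f₂ (≤-trans (n≤1+n _) le₂))))) $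
      load-counted App st c₂ ys (revert t (revert s xs)) {K = K} refl f₂ le₂ (≤-trans (m≤m+n _ d) l₂) (λ c₃ f₃ →
      h (suc n₂) eq c₃ f₃ (≤-trans (n≤1+n _) (bump l₂))) r
      where
      lemma : ∀ a b n → suc (b + (a + n)) ≡ suc (a + b) + n
      lemma = solve-∀
    load-term (ƛ t)   st c ys xs {n} {d} {K} {b} e le le′ h r =
      slack (≤-reflexive (trans (sym (+-assoc (6 + q) (credit (suc n) (suc d)) b)) (cong (_+ b) (credit-open {n} {d} (count≤N c e (≤-trans (m≤n+m n (suc (size t))) le)))))) $
      load-counted Lam st c (encode t (Ret ∷ ys)) xs {K = K} refl e (≤-trans (s≤s (m≤n+m n (size t))) le) (≤-trans (m≤m+n _ d) le′) (λ c₁ f₁ →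
      load-term t st c₁ (Ret ∷ ys) (Lam ∷ xs) {suc n} {suc d} {K} {b} f₁ (≤-trans (≤-reflexive (+-suc (size t) n)) le) (≤-trans (≤-reflexive (cong suc (+-suc (length xs) d))) (bump le′)) λ n₂ e₂ c₂ f₂ l₂ r →
      slack (≤-reflexive (trans (sym (+-assoc (6 + q) (credit n₂ d) b)) (cong (_+ b) (credit-close n₂ d)))) $
      load-Ret st c₂ ys (revert t (Lam ∷ xs)) {K = K} f₂ (≤-trans (≤-reflexive (trans e₂ (+-suc (size t) n))) le) (≤-trans (m≤m+n _ (suc d)) l₂)
      (h n₂ (trans e₂ (+-suc (size t) n)) c₂ f₂ (≤-trans (≤-reflexive (sym (+-suc _ d))) l₂)) r) r

    weight≤2N : ∀ t → size t ≤ N → weight t ≤ N + N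
    weight≤2N t le = ≤-trans (weight≤2*size t) (+-mono-≤ le le)

    load-halts : ∀ t st (c : Counter ℓ N) {K r b} → count c ≡ 0 → size t ≤ total →
                 (∀ (c′ : Counter ℓ N) p → count c′ ≡ size t → H K nothing (set sIn (stream p []) (st [ X ≔ [] ] [ C ≔ encode t [] ]) [ T ≔ [] ] ⟨ c′ ⟩) b) →
                 H (load ∷ K) r (set sIn (stream 0 (encode t [])) (st [ X ≔ [] ] [ C ≔ [] ]) [ T ≔ [] ] ⟨ c ⟩)
                   (credit 0 0 + (6 + ((N + N) * 4 + b)))
    load-halts t st c {K} {r} {b} e le h = seq′ $ seq′ $
      load-term t (st [ C ≔ [] ]) c [] [] {0} {0} {transfer X C ∷ K} e (≤-trans (≤-reflexive (+-identityʳ _)) le) z≤n (λ n e₁ c₁ f₁ l₁ r →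
      let n≤N = count≤N c₁ f₁ (≤-trans (≤-reflexive (trans e₁ (+-identityʳ _))) le)
          t≤N = ≤-trans (≤-reflexive (trans (sym (+-identityʳ _)) (sym e₁))) n≤N in
      slack (≤-trans (+-monoʳ-≤ 6 (+-monoˡ-≤ b (*-monoˡ-≤ 4 (weight≤2N t t≤N)))) (m≤n+m _ (credit n 0))) $
      end′ refl (≤-trans (s≤s (s≤s (≤-trans (≤-trans (m≤m+n _ 0) l₁) (≤-trans (+-mono-≤ n≤N n≤N) (m≤n+m (N + N) 2))))) Ss-large) $
      while′ $ at-time (lemma (weight t * 4) b) $ at-time (cong (λ l → l * 4 + (3 + b)) (sym (trans (length-revert t []) (+-identityʳ _)))) $
      transfer-halts {i = X} {j = C} {at = λ xs ys → set sIn (stream (suc (length (revert t []))) []) (st [ X ≔ xs ] [ C ≔ ys ] [ T ≔ [] ] ⟨ c₁ ⟩)}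
        (record { get₁ = λ _ _ → refl ; get₂ = λ _ _ → refl ; set₁ = λ _ _ _ → refl ; set₂ = λ _ _ _ → refl }) (revert t [])
        (≤-trans (≤-reflexive (cong (λ xs → 2 + length xs) (revert-ʳ++ t [] [])))
          (≤-trans (≤-reflexive (cong (2 +_) (trans (length-encode t []) (+-identityʳ _))))
          (≤-trans (+-mono-≤ {2} {8} (m≤m+n 2 6) (≤-trans (weight≤2N t t≤N) (m≤m+n (N + N) _))) W-large)))
        (≡-subst (λ xs → H K nothing (set sIn (stream (suc (length (revert t []))) []) (st [ X ≔ [] ] [ C ≔ xs ] [ T ≔ [] ] ⟨ c₁ ⟩)) b) (sym (revert-ʳ++ t [] []))
          (h c₁ _ (trans f₁ (trans e₁ (+-identityʳ _)))))) _
      where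
      lemma : ∀ w b → 3 + (w + b) ≡ w + (3 + b)
      lemma = solve-∀

    -- Reading `U` destroys it, yet further occurrences of the variable need it. A second copy is
    -- therefore made on `X`, from which `U` is rebuilt.
    copy-list : ∀ xs st (c : Counter ℓ N) gs zs {n K b} → count c ≡ n → tallied xs + n ≤ total →
                2 + length (xs ʳ++ gs) ≤ W → 2 + length (xs ʳ++ zs) ≤ W →
                (∀ (c′ : Counter ℓ N) → count c′ ≡ tallied xs + n → H K nothing (st [ U ≔ [] ] [ G ≔ xs ʳ++ gs ] [ X ≔ xs ʳ++ zs ] [ T ≔ [] ] ⟨ c′ ⟩) b) →
                ∀ r → H (pop U ∷ while is-just ((push G keep ⨾ push X keep ⨾ tally) ⨾ pop U) ∷ K) r
                  (st [ U ≔ xs ] [ G ≔ gs ] [ X ≔ zs ] [ T ≔ [] ] ⟨ c ⟩) (length xs * (6 + q) + (3 + b))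
    copy-list []       st c gs zs e le l₁ l₂ h r = empty′ refl $ while′ $ h c e
    copy-list (x ∷ xs) st c gs zs {n} {K} {b} e le l₁ l₂ h r = at-time (+-assoc (6 + q) (length xs * (6 + q)) (3 + b)) $
      pop′ refl $ while′ $ seq′ $ seq′ $ push′ refl (≤-trans (s≤s (s≤s (longer gs))) l₁) $
      seq′ $ push′ refl (≤-trans (s≤s (s≤s (longer zs))) l₂) $ counted
      where
      longer : ∀ ys → length (x ∷ ys) ≤ length (xs ʳ++ (x ∷ ys))
      longer ys = ≤-trans (m≤n+m _ (length xs)) (≤-reflexive (sym (length-ʳ++ xs)))
      counted : H (tally ∷ pop U ∷ while is-just ((push G keep ⨾ push X keep ⨾ tally) ⨾ pop U) ∷ K) (just x)
                (st [ U ≔ xs ] [ G ≔ x ∷ gs ] [ X ≔ x ∷ zs ] [ T ≔ [] ] ⟨ c ⟩) (1 + (q + (length xs * (6 + q) + (3 + b))))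
      counted with ret? (just x) in eq
      ... | true  = branch eq $ slack (1≤q _) $ skip′ $ copy-list xs st c (x ∷ gs) (x ∷ zs) e le l₁ l₂ h _
      ... | false = branch eq $ inc-count (st [ U ≔ xs ] [ G ≔ x ∷ gs ] [ X ≔ x ∷ zs ]) c e (≤-trans (s≤s (m≤n+m n _)) le) λ c′ e′ →
        copy-list xs st c′ (x ∷ gs) (x ∷ zs) e′ (≤-trans (≤-reflexive (+-suc _ n)) le) l₁ l₂ (λ c″ e″ → h c″ (trans e″ (+-suc _ n))) _

    match-halts : ∀ n d st x fs xs ys {K b} → bar? (just x) ≡ false → 2 + (suc n + length xs) ≤ W → 2 + (suc n + length ys) ≤ W →
                  H K (just x) (st [ F ≔ fs ] [ X ≔ fill I n xs ] [ D ≔ bars (d ∸ suc n) [] ] [ Y ≔ marks (suc n) d ys ]) b →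
                  ∀ r → H (matchStep ∷ while bar? matchStep ∷ K) r (st [ F ≔ bars n (x ∷ fs) ] [ X ≔ xs ] [ D ≔ bars d [] ] [ Y ≔ ys ]) ((1 + n) * 8 + b)
    match-halts zero    zero    st x fs xs ys e l₁ l₂ h r = seq′ $ empty′ refl $ seq′ $ push′ refl l₂ $ seq′ $ pop′ refl $
      branch e $ skip′ $ leave e h
    match-halts zero    (suc d) st x fs xs ys e l₁ l₂ h r = seq′ $ pop′ refl $ seq′ $ push′ refl l₂ $ seq′ $ pop′ refl $
      branch e $ skip′ $ leave e h
    match-halts (suc n) zero    st x fs xs ys e l₁ l₂ h r = seq′ $ empty′ refl $
      seq′ $ push′ refl (≤-trans (s≤s (s≤s (s≤s (m≤n+m _ (suc n))))) l₂) $ seq′ $ pop′ refl $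
      cond′ $ push′ refl (≤-trans (s≤s (s≤s (s≤s (m≤n+m _ (suc n))))) l₁) $ while′ $
      match-halts n 0 st x fs (I ∷ xs) (Var ∷ ys) e (≤-trans (≤-reflexive (cong (2 +_) (+-suc (suc n) _))) l₁) (≤-trans (≤-reflexive (cong (2 +_) (+-suc (suc n) _))) l₂) h _
    match-halts (suc n) (suc d) st x fs xs ys e l₁ l₂ h r = seq′ $ pop′ refl $
      seq′ $ push′ refl (≤-trans (s≤s (s≤s (s≤s (m≤n+m _ (suc n))))) l₂) $ seq′ $ pop′ refl $
      cond′ $ push′ refl (≤-trans (s≤s (s≤s (s≤s (m≤n+m _ (suc n))))) l₁) $ while′ $
      match-halts n d st x fs (I ∷ xs) (I ∷ ys) e (≤-trans (≤-reflexive (cong (2 +_) (+-suc (suc n) _))) l₁) (≤-trans (≤-reflexive (cong (2 +_) (+-suc (suc n) _))) l₂) h _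

    pop-Y : ∀ st ys {K r b} → H K (head ys) (st [ Y ≔ drop 1 ys ]) b → H (pop Y ∷ K) r (st [ Y ≔ ys ]) (2 + b)
    pop-Y st []       h = empty′ refl h
    pop-Y st (y ∷ ys) h = pop′ refl h

    restore-halts : ∀ st ys ds {K b} → 2 + (length ys + length ds) ≤ W →
                    H K nothing (st [ Y ≔ [] ] [ D ≔ restored ys ds ]) b →
                    H (restore ∷ K) (head ys) (st [ Y ≔ drop 1 ys ] [ D ≔ ds ]) (length ys * 5 + (1 + b))
    restore-halts st []       ds le h = while′ h
    restore-halts st (y ∷ ys) ds {K} {b} le h = while′ $ seq′ $ kept
      where
      kept : H (cond bar? (push D (const I)) skip ∷ pop Y ∷ restore ∷ K) (just y) (st [ Y ≔ ys ] [ D ≔ ds ]) (4 + (length ys * 5 + (1 + b)))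
      kept with bar? (just y) in eq
      ... | true  = branch eq $ push′ refl (≤-trans (s≤s (s≤s (s≤s (m≤n+m _ (length ys))))) le) $
        pop-Y (st [ D ≔ I ∷ ds ]) ys $ restore-halts st ys (I ∷ ds) (≤-trans (s≤s (s≤s (≤-reflexive (+-suc (length ys) _)))) le) h
      ... | false = branch eq $ skip′ $ pop-Y (st [ D ≔ ds ]) ys $ restore-halts st ys ds (≤-trans (n≤1+n _) le) h

    -- Carries the invariant known from loading over a finished subterm, now with the output for the
    -- input and the depth for the outstanding `Ret`. It bounds `G` and `D` by the counter.
    length-revert-bound : ∀ t {gs d n} → length gs + d ≤ n + n → length (revert t gs) + d ≤ (size t + n) + (size t + n)
    length-revert-bound t {gs} {d} {n} le = begin
      length (revert t gs) + d          ≡⟨ cong (_+ d) (length-revert t gs) ⟩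
      weight t + length gs + d          ≡⟨ +-assoc (weight t) _ d ⟩
      weight t + (length gs + d)        ≤⟨ +-mono-≤ (weight≤2*size t) le ⟩
      (size t + size t) + (n + n)       ≡⟨ lemma (size t) n ⟩
      (size t + n) + (size t + n)       ∎
      where
      open ≤-Reasoning
      lemma : ∀ a n → (a + a) + (n + n) ≡ (a + n) + (a + n)
      lemma = solve-∀

    -- The 4N in W consists of 2N letters for the term in hand and 2N for what lies below it on the
    -- same stack; the 8 leaves room for the marker, the cell under the head and letters about to be
    -- pushed.
    within : ∀ {l} → l ≤ N + N + (N + N) → 8 + l ≤ W
    within le = ≤-trans (+-monoʳ-≤ 8 le) W-large

    within₁ : ∀ k {l} → 8 + l ≤ W → k ≤ 8 → k + l ≤ W
    within₁ k le k≤8 = ≤-trans (+-monoˡ-≤ _ k≤8) le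

    give-bars : ∀ k st (c : Counter ℓ N) gs {n K b} → count c ≡ n → k + n ≤ total → 2 + length (fill I k gs) ≤ W →
                (∀ (c′ : Counter ℓ N) → count c′ ≡ k + n → H K nothing (st [ X ≔ [] ] [ G ≔ fill I k gs ] [ T ≔ [] ] ⟨ c′ ⟩) b) →
                ∀ r → H (pop X ∷ while is-just ((push G keep ⨾ inc) ⨾ pop X) ∷ K) r (st [ X ≔ bars k [] ] [ G ≔ gs ] [ T ≔ [] ] ⟨ c ⟩) (k * (4 + q) + (3 + b))
    give-bars zero    st c gs e le l h r = empty′ refl $ while′ $ h c e
    give-bars (suc k) st c gs {n} {K} {b} e le l h r = at-time (+-assoc (4 + q) (k * (4 + q)) (3 + b)) $
      pop′ refl $ while′ $ seq′ $ seq′ $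
      push′ refl (≤-trans (s≤s (s≤s (≤-trans (m≤n+m _ k) (≤-reflexive (sym (length-fill I k _)))))) l) $
      inc-count (st [ X ≔ bars k [] ] [ G ≔ I ∷ gs ]) c e (≤-trans (s≤s (m≤n+m n k)) le) λ c′ e′ →
      give-bars k st c′ (I ∷ gs) e′ (≤-trans (≤-reflexive (+-suc k n)) le) l (λ c″ e″ → h c″ (trans e″ (+-suc k n))) _

    module Substitution (u : Term) (u≤N : size (ƛ u) ≤ N) (st : St) where

      σ : List Letter → List Letter → ℕ → Counter ℓ N → St
      σ fs gs d c = st [ F ≔ fs ] [ G ≔ gs ] [ D ≔ bars d [] ] [ U ≔ encode (ƛ u) [] ] [ X ≔ [] ] [ Y ≔ [] ] [ T ≔ [] ] ⟨ c ⟩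

      unchanged-halts : ∀ k ys ds d c fs gs {n K b} → count c ≡ n → suc k + n ≤ total → length ys ≤ suc k →
                        restored ys ds ≡ bars d [] → 2 + (suc k + length ds) ≤ W → 2 + length (fill I k (Var ∷ gs)) ≤ W →
                        (∀ (c′ : Counter ℓ N) → count c′ ≡ suc k + n → H K nothing (σ fs (revert (# k) gs) d c′) b) →
                        H (unchanged ∷ K) (head ys) (σ fs gs d c [ X ≔ bars k [] ] [ D ≔ ds ] [ Y ≔ drop 1 ys ])
                          (suc k * 5 + (2 + (q + (k * (4 + q) + (3 + b)))))
      unchanged-halts k ys ds d c fs gs {n} {K} {b} e le ys≤ eq l₁ l₂ h = seq′ $
        slack (+-monoˡ-≤ _ (*-monoˡ-≤ 5 ys≤)) $
        restore-halts (σ fs gs d c [ X ≔ bars k [] ]) ys ds (≤-trans (s≤s (s≤s (+-monoˡ-≤ _ ys≤))) l₁) $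
        ≡-subst (λ ds → H _ nothing (σ fs gs d c [ X ≔ bars k [] ] [ D ≔ ds ]) (1 + (q + (k * (4 + q) + (3 + b))))) (sym eq) $
        seq′ $ push′ refl (≤-trans (s≤s (s≤s (≤-trans (m≤n+m _ k) (≤-reflexive (sym (length-fill I k _)))))) l₂) $
        seq′ $ inc-count (σ fs (Var ∷ gs) d c [ X ≔ bars k [] ]) c e (≤-trans (s≤s (m≤n+m n k)) le) λ c′ e′ →
        seq′ $ give-bars k (σ fs gs d c′) c′ (Var ∷ gs) e′ (≤-trans (≤-reflexive (+-suc k n)) le) l₂
          (λ c″ e″ → h c″ (trans e″ (+-suc k n))) _

      replaced-halts : ∀ k ys ds d c fs gs {n K b} → count c ≡ n → size (ƛ u) + n ≤ total → length ys ≤ suc k →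
                       restored ys ds ≡ bars d [] → 2 + (suc k + length ds) ≤ W → 2 + length (revert (ƛ u) gs) ≤ W →
                       (∀ (c′ : Counter ℓ N) → count c′ ≡ size (ƛ u) + n → H K nothing (σ fs (revert (ƛ u) gs) d c′) b) →
                       H (replaced ∷ K) (head ys) (σ fs gs d c [ X ≔ bars k [] ] [ D ≔ ds ] [ Y ≔ drop 1 ys ])
                         (suc k * 5 + (1 + (k * 4 + (3 + (weight (ƛ u) * (6 + q) + (3 + (weight (ƛ u) * 4 + (3 + b))))))))
      replaced-halts k ys ds d c fs gs {n} {K} {b} e le ys≤ eq l₁ l₂ h = seq′ $
        slack (+-monoˡ-≤ _ (*-monoˡ-≤ 5 ys≤)) $
        restore-halts (σ fs gs d c [ X ≔ bars k [] ]) ys ds (≤-trans (s≤s (s≤s (+-monoˡ-≤ _ ys≤))) l₁) $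
        ≡-subst (λ ds → H _ nothing (σ fs gs d c [ X ≔ bars k [] ] [ D ≔ ds ]) b₁) (sym eq) $
        seq′ $ at-time (cong (λ l → l * 4 + (3 + b₂)) (sym (trans (length-bars k []) (+-identityʳ k)))) $
        drain-halts X (λ xs → σ fs gs d c [ X ≔ xs ]) (λ _ → refl) (λ _ _ → refl) (bars k []) $
        seq′ $ seq′ $ at-time (cong (λ l → l * (6 + q) + (3 + b₃)) (sym length-u)) $
        copy-list (encode (ƛ u) []) (σ fs gs d c) c gs [] e
          (≤-trans (≤-reflexive (cong (_+ n) tallied-u)) le) (≤-trans (≤-reflexive (cong (λ xs → 2 + length xs) (encode-ʳ++ (ƛ u) [] gs))) l₂)
          (≤-trans (≤-reflexive (cong (λ xs → 2 + length xs) (encode-ʳ++ (ƛ u) [] []))) (≤-trans (s≤s (s≤s shorter)) l₂))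
          (λ c′ e′ → subst₂ (λ xs zs → H (transfer X U ∷ K) nothing (σ fs xs d c′ [ U ≔ [] ] [ X ≔ zs ]) b₃)
            (sym (encode-ʳ++ (ƛ u) [] gs)) (sym (encode-ʳ++ (ƛ u) [] [])) $
            at-time (cong (λ l → l * 4 + (3 + b)) (sym (trans (length-revert (ƛ u) []) (+-identityʳ _)))) $
            transfer-halts {at = λ xs ys → σ fs (revert (ƛ u) gs) d c′ [ X ≔ xs ] [ U ≔ ys ]}
              (record { get₁ = λ _ _ → refl ; get₂ = λ _ _ → refl ; set₁ = λ _ _ _ → refl ; set₂ = λ _ _ _ → refl })
              (revert (ƛ u) []) (≤-trans (≤-reflexive (cong (λ xs → 2 + length xs) (revert-ʳ++ (ƛ u) [] [])))
                (≤-trans (≤-reflexive (cong (2 +_) (trans length-u (trans (sym (+-identityʳ _)) (sym (length-revert (ƛ u) [])))))) (≤-trans (s≤s (s≤s shorter)) l₂))) $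
            ≡-subst (λ xs → H K nothing (σ fs (revert (ƛ u) gs) d c′ [ U ≔ xs ]) b) (sym (revert-ʳ++ (ƛ u) [] []))
              (h c′ (trans e′ (cong (_+ n) tallied-u)))) _
        where
        b₃ b₂ b₁ : ℕ
        b₃ = weight (ƛ u) * 4 + (3 + b)
        b₂ = weight (ƛ u) * (6 + q) + (3 + b₃)
        b₁ = k * 4 + (3 + b₂)
        length-u : length (encode (ƛ u) []) ≡ weight (ƛ u)
        length-u = trans (length-encode (ƛ u) []) (+-identityʳ _)
        tallied-u : tallied (encode (ƛ u) []) ≡ size (ƛ u)
        tallied-u = trans (tallied-encode (ƛ u) []) (+-identityʳ _)
        shorter : length (revert (ƛ u) []) ≤ length (revert (ƛ u) gs)
        shorter = subst₂ _≤_ (sym (length-revert (ƛ u) [])) (sym (length-revert (ƛ u) gs)) (+-monoʳ-≤ (weight (ƛ u)) z≤n)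

      -- The price of one letter of the function: each is charged as though it were a variable to be
      -- replaced, hence with a full copy of the argument.
      ρ : ℕ
      ρ = 60 + (q + weight (ƛ u) * (10 + q))

      Subst : List Prog → List Letter → List Letter → ℕ → Counter ℓ N → ℕ → Set
      Subst K fs gs d c b = ∀ r → H (pop F ∷ substLoop ∷ K) r (σ fs gs d c) b

      room-revert : ∀ t {gs d n} → size t ≤ N → length gs + d ≤ n + n → n ≤ N → 8 + length (revert t gs) ≤ W
      room-revert t {gs} {d} t≤N l n≤N = within (≤-trans (≤-reflexive (length-revert t gs))
        (+-mono-≤ (weight≤2N t t≤N) (≤-trans (m≤m+n _ d) (≤-trans l (+-mono-≤ n≤N n≤N)))))

      decide-time : ℕ → ℕ → ℕ
      decide-time k b = 6 + (suc k * 5 + (25 + (k * 4 + ((q + k * q) + (weight (ƛ u) * (10 + q) + b)))))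

      decide-halts : ∀ k d c fs gs {n K b} → count c ≡ n → size (subst (# k) d (ƛ u)) + n ≤ total → suc k ≤ N → length gs + d ≤ n + n →
                     (∀ (c′ : Counter ℓ N) → count c′ ≡ size (subst (# k) d (ƛ u)) + n → Subst K fs (revert (subst (# k) d (ƛ u)) gs) d c′ b) →
                     ∀ r → H (decide ∷ pop F ∷ substLoop ∷ K) r (σ fs gs d c [ X ≔ bars k [] ] [ D ≔ bars (d ∸ suc k) [] ] [ Y ≔ marks (suc k) d [] ])
                       (decide-time k b)
      -- This is the decision on which `subst` itself branches, so the term to be produced is known
      -- in both cases.
      decide-halts k d c fs gs {n} {K} {b} e le k<N l h r with k ≟ d
      ... | yes refl =
        ≡-subst (λ ys → H _ r (σ fs gs d c [ X ≔ bars k [] ] [ D ≔ bars (d ∸ suc k) [] ] [ Y ≔ ys ]) (decide-time k b)) (sym shape) $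
        slack (≤-trans (m≤m+n _ (15 + (q + k * q))) (≤-reflexive (lemma k q (weight (ƛ u)) b))) $
        seq′ $ pop′ refl $ cond′ $ seq′ $ pop-Y (σ fs gs d c [ X ≔ bars k [] ] [ D ≔ bars (d ∸ suc k) [] ]) (bars k []) $ branch (not-var k) $
        replaced-halts k (bars k []) (bars (d ∸ suc k) []) d c fs gs e le
          (≤-trans (≤-reflexive (trans (length-bars k []) (+-identityʳ k))) (n≤1+n k))
          (trans (cong (λ ys → restored ys (bars (k ∸ suc k) [])) (sym shape)) (restored-marks (suc k) k []))
          room-D (within₁ 2 (room-revert (ƛ u) {gs} {d} u≤N l n≤N) (m≤m+n 2 6)) (λ c′ e′ → h c′ e′ _)
        where
        shape : marks (suc k) k [] ≡ Var ∷ bars k []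
        shape = trans (marks-equal k []) (cong (Var ∷_) (fill-bars k []))
        not-var : ∀ k → var? (head (bars k [])) ≡ false
        not-var zero    = refl
        not-var (suc k) = refl
        n≤N = count≤N c e (≤-trans (m≤n+m n _) le)
        room-D : 2 + (suc k + length (bars (d ∸ suc k) [])) ≤ W
        room-D = within₁ 2 (within (+-mono-≤ (≤-trans k<N (m≤m+n N N)) (≤-trans (≤-reflexive (trans (length-bars (d ∸ suc k) []) (+-identityʳ _)))
          (≤-trans (m∸n≤m d (suc k)) (≤-trans (≤-trans (m≤n+m d _) l) (+-mono-≤ n≤N n≤N)))))) (m≤m+n 2 6)
        lemma : ∀ k q w b → (6 + ((5 + k * 5) + (1 + (k * 4 + (3 + (w * (6 + q) + (3 + (w * 4 + (3 + b)))))))))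
                            + (15 + (q + k * q)) ≡ 6 + ((5 + k * 5) + (25 + (k * 4 + ((q + k * q) + (w * (10 + q) + b)))))
        lemma = solve-∀
      ... | no k≢d = differ (marks-differ k d k≢d)
        where
        n≤N = count≤N c e (≤-trans (m≤n+m n _) le)
        room-D : 2 + (suc k + length (bars (d ∸ suc k) [])) ≤ W
        room-D = within₁ 2 (within (+-mono-≤ (≤-trans k<N (m≤m+n N N)) (≤-trans (≤-reflexive (trans (length-bars (d ∸ suc k) []) (+-identityʳ _)))
          (≤-trans (m∸n≤m d (suc k)) (≤-trans (≤-trans (m≤n+m d _) l) (+-mono-≤ n≤N n≤N)))))) (m≤m+n 2 6)
        room-G : 2 + length (fill I k (Var ∷ gs)) ≤ W
        room-G = within₁ 2 (room-revert (# k) {gs} {d} k<N l n≤N) (m≤m+n 2 6)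
        lemma : ∀ k q x b → (6 + ((5 + k * 5) + (2 + (q + (k * (4 + q) + (3 + b)))))) + (20 + x)
                            ≡ 6 + ((5 + k * 5) + (25 + (k * 4 + ((q + k * q) + (x + b)))))
        lemma = solve-∀
        long : ∀ {ys} → marks (suc k) d [] ≡ ys → length ys ≤ suc k
        long refl = ≤-reflexive (trans (length-marks (suc k) d []) (+-identityʳ _))
        same : ∀ {ys} → marks (suc k) d [] ≡ ys → restored ys (bars (d ∸ suc k) []) ≡ bars d []
        same refl = restored-marks (suc k) d []
        differ : _ ⊎ _ → _
        differ (inj₁ (ys , shape)) =
          ≡-subst (λ ys → H _ r (σ fs gs d c [ X ≔ bars k [] ] [ D ≔ bars (d ∸ suc k) [] ] [ Y ≔ ys ]) (decide-time k b)) (sym shape) $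
          slack (≤-trans (m≤m+n _ (20 + weight (ƛ u) * (10 + q))) (≤-reflexive (lemma k q (weight (ƛ u) * (10 + q)) b))) $
          slack (m≤n+m _ 3) $
          seq′ $ pop′ refl $ cond′ $
          unchanged-halts k (I ∷ ys) (bars (d ∸ suc k) []) d c fs gs e le (long shape) (same shape) room-D room-G (λ c′ e′ → h c′ e′ _)
        differ (inj₂ (ys , shape)) =
          ≡-subst (λ ys → H _ r (σ fs gs d c [ X ≔ bars k [] ] [ D ≔ bars (d ∸ suc k) [] ] [ Y ≔ ys ]) (decide-time k b)) (sym shape) $
          slack (≤-trans (m≤m+n _ (20 + weight (ƛ u) * (10 + q))) (≤-reflexive (lemma k q (weight (ƛ u) * (10 + q)) b))) $
          seq′ $ pop′ refl $ cond′ $ seq′ $ pop′ refl $ cond′ $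
          unchanged-halts k (Var ∷ ys) (bars (d ∸ suc k) []) d c fs gs e le (≤-trans (n≤1+n _) (long shape)) (same shape) room-D room-G (λ c′ e′ → h c′ e′ _)

      var-halts : ∀ k d c fs gs {n K b} → count c ≡ n → size (subst (# k) d (ƛ u)) + n ≤ total → suc k ≤ N → length gs + d ≤ n + n →
                  Stops fs → 2 + length fs ≤ W →
                  (∀ (c′ : Counter ℓ N) → count c′ ≡ size (subst (# k) d (ƛ u)) + n → Subst K fs (revert (subst (# k) d (ƛ u)) gs) d c′ b) →
                  Subst K (encode (# k) fs) gs d c ((1 + k) * ρ + b)
      var-halts k d c fs@(x ∷ fs′) gs {n} {K} {b} e le k<N l (stops ¬bar) lf h r =
        slack (≤-trans (m≤m+n _ (9 + k * 43 + k * (weight (ƛ u) * (10 + q)))) (≤-reflexive (lemma k q (weight (ƛ u) * (10 + q)) b))) $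
        pop′ refl $ while′ $ cond′ $ cond′ $ cond′ $ seq′ $ seq′ $
        match-halts k d (σ fs gs d c) x fs′ [] [] ¬bar room-X room-X
          (seq′ $ push′ refl lf $ seq′ $
            ≡-subst (λ xs → H _ (just x) (σ fs gs d c [ X ≔ xs ] [ D ≔ bars (d ∸ suc k) [] ] [ Y ≔ marks (suc k) d [] ]) (decide-time k b)) (sym (fill-bars k [])) $
            decide-halts k d c fs gs e le k<N l h _) _
        where
        room-X : 2 + (suc k + 0) ≤ W
        room-X = within₁ 2 (within (≤-trans (≤-reflexive (+-identityʳ _)) (≤-trans k<N (≤-trans (m≤m+n N N) (m≤m+n (N + N) _))))) (m≤m+n 2 6)
        lemma : ∀ k q x b → (6 + ((8 + k * 8) + (1 + (6 + ((5 + k * 5) + (25 + (k * 4 + ((q + k * q) + (x + b))))))))) + (9 + k * 43 + k * x)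
                            ≡ (1 + k) * (60 + (q + x)) + b
        lemma = solve-∀

      ρ-large : ∀ b → 8 + (q + b) ≤ ρ + b
      ρ-large b = ≤-trans (m≤m+n _ (52 + weight (ƛ u) * (10 + q))) (≤-reflexive (lemma q (weight (ƛ u) * (10 + q)) b))
        where
        lemma : ∀ q w b → 8 + (q + b) + (52 + w) ≡ 60 + (q + w) + b
        lemma = solve-∀

      -- The condition on `total` concerns the result of the substitution and not `t`: the counter
      -- grows with `G`, and the function on `F` is no longer part of it.
      subst-term : ∀ t d c fs gs {n K b} → count c ≡ n → size (subst t d (ƛ u)) + n ≤ total → size t ≤ N → length gs + d ≤ n + n →
                   Stops fs → 2 + length (encode t fs) ≤ W →
                   (∀ n′ → n′ ≡ size (subst t d (ƛ u)) + n → ∀ (c′ : Counter ℓ N) → count c′ ≡ n′ → Subst K fs (revert (subst t d (ƛ u)) gs) d c′ b) →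
                   Subst K (encode t fs) gs d c (weight t * ρ + b)
      subst-term (# k)   d c fs gs e le t≤N l sf lf h =
        var-halts k d c fs gs e le t≤N l sf (≤-trans (s≤s (s≤s (encode-longer (# k)))) lf) λ c′ e′ → h _ refl c′ e′
      subst-term (s · t) d c fs gs {n} {K} {b} e le t≤N l sf lf h r = at-time (app-time′ (weight s) (weight t) ρ b) $
        subst-term s d c (encode t (App ∷ fs)) gs e
          (≤-trans (≤-trans (m≤n+m _ (suc (size t′))) (≤-reflexive (lemma (size s′) (size t′) n))) le)
          (≤-trans (≤-trans (m≤m+n _ (size t)) (n≤1+n _)) t≤N) l (stops-encode t) lf (λ n₁ e₁ c₁ f₁ →
        subst-term t d c₁ (App ∷ fs) (revert s′ gs) f₁
          (≤-trans (≤-trans (n≤1+n _) (≤-reflexive (trans (cong (λ m → suc (size t′ + m)) e₁) (lemma (size s′) (size t′) n)))) le)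
          (≤-trans (≤-trans (m≤n+m _ (size s)) (n≤1+n _)) t≤N)
          (≤-trans (length-revert-bound s′ {gs} {d} l) (≤-reflexive (cong₂ _+_ (sym e₁) (sym e₁)))) (stops refl) (≤-trans (s≤s (s≤s (encode-longer s))) lf) λ n₂ e₂ c₂ f₂ r →
        let eq = trans (cong suc (trans e₂ (cong (size t′ +_) e₁))) (lemma (size s′) (size t′) n) in
        slack (ρ-large b) $ slack (n≤1+n _) $ pop′ refl $ while′ $ cond′ $ cond′ $ cond′ $
        seq′ $ push′ refl (room {n = n₂} (≤-trans (m≤m+n _ d) (≤-trans (length-revert-bound t′ {revert s′ gs} {d} {n₁} (≤-trans (length-revert-bound s′ {gs} {d} l) (≤-reflexive (cong₂ _+_ (sym e₁) (sym e₁))))) (≤-reflexive (cong₂ _+_ (sym e₂) (sym e₂))))) (count≤N c₂ f₂ (≤-trans (n≤1+n _) (≤-trans (≤-reflexive eq) le)))) $ seq′ $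
        inc-count (σ fs (App ∷ revert t′ (revert s′ gs)) d c₂) c₂ f₂ (≤-trans (≤-reflexive eq) le) λ c₃ f₃ → h (suc n₂) eq c₃ f₃ _) r
        where
        s′ = subst s d (ƛ u)
        t′ = subst t d (ƛ u)
        lemma : ∀ a b n → suc (b + (a + n)) ≡ suc (a + b) + n
        lemma = solve-∀
      subst-term (ƛ t)   d c fs gs {n} {K} {b} e le t≤N l sf lf h r = at-time (lam-time (weight t) ρ b) $
        slack (ρ-large _) $ slack (n≤1+n _) $ pop′ refl $ while′ $ cond′ $ cond′ $
        seq′ $ push′ refl (room {n = n} (≤-trans (m≤m+n _ d) l) n≤N) $
        seq′ $ push′ refl (≤-trans (≤-reflexive (cong (3 +_) (trans (length-bars d []) (+-identityʳ d)))) (room {n = n} (≤-trans (m≤n+m d _) l) n≤N)) $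
        seq′ $ inc-count (σ (encode t (Ret ∷ fs)) (Lam ∷ gs) (suc d) c) c e (≤-trans (s≤s (m≤n+m n _)) le) λ c₁ f₁ →
        subst-term t (suc d) c₁ (Ret ∷ fs) (Lam ∷ gs) f₁ (≤-trans (≤-reflexive (+-suc (size t′) n)) le) (≤-trans (n≤1+n _) t≤N)
          l₁ (stops refl) (≤-trans (n≤1+n _) lf) (λ n₂ e₂ c₂ f₂ r →
        let l₂ = ≤-trans (length-revert-bound t′ {Lam ∷ gs} {suc d} {suc n} l₁) (≤-reflexive (cong₂ _+_ (sym e₂) (sym e₂)))
            eq = trans e₂ (+-suc (size t′) n) in
        slack (ρ-large b) $ slack (+-monoʳ-≤ 8 (m≤n+m b q)) $ pop′ refl $ while′ $ cond′ $ seq′ $ pop′ refl $ cond′ $ seq′ $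
        push′ refl (room {n = n₂} (≤-trans (m≤m+n _ (suc d)) l₂) (count≤N c₂ f₂ (≤-trans (≤-reflexive eq) le))) $
        h n₂ eq c₂ f₂ _) _
        where
        t′ = subst t (suc d) (ƛ u)
        n≤N = count≤N c e (≤-trans (m≤n+m n _) le)
        l₁ : length (Lam ∷ gs) + suc d ≤ suc n + suc n
        l₁ = ≤-trans (≤-reflexive (cong suc (+-suc (length gs) d))) (bump l)

-- Reduction in contexts

-- A frame is named after what stands beside the hole: `argument t` surrounds a function whose
-- argument still waits, `function a` an argument whose function is already an abstraction.
data Frame : Set where
  argument function : Term → Frame

Context : Set
Context = List Frame

plug : Context → Term → Term
plug []               s = s
plug (argument t ∷ E) s = plug E (s · t)
plug (function a ∷ E) s = plug E ((ƛ a) · s)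

contextSize : Context → ℕ
contextSize []               = 0
contextSize (argument t ∷ E) = suc (size t + contextSize E)
contextSize (function a ∷ E) = suc (size (ƛ a) + contextSize E)

sizeIn : Context → Term → ℕ
sizeIn E s = size s + contextSize E

size-plug : ∀ E s → size (plug E s) ≡ sizeIn E s
size-plug []               s = sym (+-identityʳ _)
size-plug (argument t ∷ E) s = trans (size-plug E (s · t)) (lemma (size s) (size t) (contextSize E))
  where
  lemma : ∀ a b c → suc (a + b) + c ≡ a + suc (b + c)
  lemma = solve-∀
size-plug (function a ∷ E) s = trans (size-plug E ((ƛ a) · s)) (lemma (size s) (size (ƛ a)) (contextSize E))
  where
  lemma : ∀ a b c → suc (b + a) + c ≡ a + suc (b + c)
  lemma = solve-∀

-- A waiting argument is still code and a finished function is a value, so they lie on different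
-- stacks; the `App` of the frame is on `C` in either case.
values codes : Context → List Letter
values []               = []
values (argument t ∷ E) = values E
values (function a ∷ E) = revert (ƛ a) (bit₁ ∷ values E)
codes []               = []
codes (argument t ∷ E) = encode t (App ∷ codes E)
codes (function a ∷ E) = App ∷ codes E

length-values : ∀ E → length (values E) ≤ contextSize E + contextSize E
length-values []               = z≤n
length-values (argument t ∷ E) = ≤-trans (length-values E) (+-mono-≤ le le)
  where le = ≤-trans (m≤n+m (contextSize E) (size t)) (n≤1+n _)
length-values (function a ∷ E) = begin
  length (revert (ƛ a) (bit₁ ∷ values E))                            ≡⟨ length-revert (ƛ a) _ ⟩
  weight (ƛ a) + suc (length (values E))                             ≤⟨ +-mono-≤ (weight≤2*size (ƛ a)) (s≤s (length-values E)) ⟩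
  (size (ƛ a) + size (ƛ a)) + suc (contextSize E + contextSize E)    ≤⟨ n≤1+n _ ⟩
  suc ((size (ƛ a) + size (ƛ a)) + suc (contextSize E + contextSize E)) ≡⟨ lemma (size (ƛ a)) (contextSize E) ⟩
  contextSize (function a ∷ E) + contextSize (function a ∷ E)        ∎
  where
  open ≤-Reasoning
  lemma : ∀ a c → suc ((a + a) + suc (c + c)) ≡ suc (a + c) + suc (a + c)
  lemma = solve-∀

length-codes : ∀ E → length (codes E) ≤ contextSize E + contextSize E
length-codes []               = z≤n
length-codes (argument t ∷ E) = begin
  length (encode t (App ∷ codes E))                               ≡⟨ length-encode t _ ⟩
  weight t + suc (length (codes E))                               ≤⟨ +-mono-≤ (weight≤2*size t) (s≤s (length-codes E)) ⟩
  (size t + size t) + suc (contextSize E + contextSize E)         ≤⟨ n≤1+n _ ⟩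
  suc ((size t + size t) + suc (contextSize E + contextSize E))   ≡⟨ lemma (size t) (contextSize E) ⟩
  contextSize (argument t ∷ E) + contextSize (argument t ∷ E)     ∎
  where
  open ≤-Reasoning
  lemma : ∀ a c → suc ((a + a) + suc (c + c)) ≡ suc (a + c) + suc (a + c)
  lemma = solve-∀
length-codes (function a ∷ E) = ≤-trans (s≤s (length-codes E)) (s≤s (+-mono-≤ le (≤-trans le (n≤1+n _))))
  where
  le : contextSize E ≤ size (ƛ a) + contextSize E
  le = m≤n+m _ _

-- The course of the machine from the term s in the context E, with k
-- decrements left and terms of size B or more being too large.
data Course (B : ℕ) : ℕ → Context → Term → Set where
  stuck    : ∀ {k E n} → Course B k E (# n)
  normal   : ∀ {k a} → Course B k [] (ƛ a)
  descend  : ∀ {k E s t} → Course B k (argument t ∷ E) s → Course B k E (s · t)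
  proceed  : ∀ {k E a t} → Course B k (function a ∷ E) t → Course B k (argument t ∷ E) (ƛ a)
  timeout  : ∀ {k E a u} → k < 3 → Course B k (function a ∷ E) (ƛ u)
  overflow : ∀ {k E a u} → B ≤ sizeIn E (subst a 0 (ƛ u)) → Course B (3 + k) (function a ∷ E) (ƛ u)
  reduce   : ∀ {k E a u} → sizeIn E (subst a 0 (ƛ u)) < B → Course B k E (subst a 0 (ƛ u)) →
             Course B (3 + k) (function a ∷ E) (ƛ u)

peak : ∀ {B k E s} → Course B k E s → ℕ
peak stuck                              = 0
peak normal                             = 0
peak (descend r)                        = peak r
peak (proceed r)                        = peak r
peak (timeout _)                        = 0
peak (overflow {E = E} {a} {u} _)       = sizeIn E (subst a 0 (ƛ u))
peak (reduce {E = E} {a} {u} _ r)       = sizeIn E (subst a 0 (ƛ u)) ⊔ peak r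

moves : ∀ {B k E s} → Course B k E s → ℕ
moves (descend r)  = moves r
moves (proceed r)  = suc (moves r)
moves (reduce _ r) = suc (moves r)
moves _            = 1

-- A failing decrement meets only zeros. Scanning one costs 4, and each holds 8.
potential-zero : ∀ bs → value bs ≡ 0 → length bs * 4 ≤ potential bs
potential-zero []           e = z≤n
potential-zero (false ∷ bs) e = +-mono-≤ (m≤m+n 4 4) (potential-zero bs (m+n≡0⇒m≡0 (value bs) e))

-- The reduction loop

module Reduction (Φ : Verdict → St → Set) {Sk Sm Ss W ℓ N : ℕ}
                 (Sm-large : 3 + ℓ ≤ Sm) (Ss-large : 4 + (N + N) ≤ Ss) (W-large : 8 + (N + N + (N + N)) ≤ W) where

  open Execution Φ Sk Sm Ss W
  open Phases Φ {Sk} {Sm} {Ss} {W} {ℓ} {N} Sm-large Ss-large W-large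
  open Counting {ℓ} {N} Sm-large (≤-trans (+-mono-≤ (m≤m+n 4 4) (≤-trans (m≤m+n N N) (m≤m+n (N + N) _))) W-large)

  Sound : ∀ {B k E s} → Course B k E s → Set
  Sound stuck          = ∀ st → Φ spaceBoundNotReached st
  Sound (normal {a = a}) = ∀ st → get out st ≡ output (revert (ƛ a) []) → Φ term st
  Sound (descend r)    = Sound r
  Sound (proceed r)    = Sound r
  Sound (timeout _)    = ∀ st → Φ spaceBoundNotReached st
  Sound (overflow _)   = ∀ st → Φ spaceBoundReached st
  Sound (reduce _ r)   = Sound r

  state : St → List Bool → List Letter → List Letter → Counter ℓ N → St
  state st ks vs cs c = set out (output []) (st [ K ≔ map Bit ks ] [ V ≔ vs ] [ C ≔ cs ]
    [ U ≔ [] ] [ F ≔ [] ] [ G ≔ [] ] [ D ≔ [] ] [ X ≔ [] ] [ Y ≔ [] ] [ T ≔ [] ]) ⟨ c ⟩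

  -- Uniform bounds for terms of size at most N: `ρN` per letter of the function, `Z` per move. `Z`
  -- is cubic, since each of up to 2N letters may be replaced by up to 2N letters, each of which is
  -- counted in time linear in N.
  ρN Z M : ℕ
  M  = N + N
  ρN = 60 + (q + M * (10 + q))
  Z  = 127 + (q + M * (26 + (q + q + ρN)))

  roomy : ∀ {l} → l ≤ M + M → 8 + l ≤ W
  roomy le = ≤-trans (+-monoʳ-≤ 8 le) W-large

  roomy₂ : ∀ {l} → l ≤ M + M → 2 + l ≤ W
  roomy₂ le = ≤-trans (+-monoˡ-≤ _ (m≤m+n 2 6)) (roomy le)

  weight≤M : ∀ t → size t ≤ N → weight t ≤ M
  weight≤M t le = ≤-trans (weight≤2*size t) (+-mono-≤ le le)

  shift-step : ∀ st ks c a E cs {Ks b} → sizeIn E (ƛ a) ≤ N →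
               (∀ r → H (pop C ∷ reduceLoop ∷ Ks) r (state st ks (revert (ƛ a) (bit₁ ∷ values E)) cs c) b) →
               ∀ r → H (pop C ∷ reduceLoop ∷ Ks) r (state st ks (values E) (encode (ƛ a) cs) c) (15 + (M * 8 + b))
  shift-step st ks c a E cs {b = b} le h r = pop′ refl $ while′ $ seq′ $ cond′ $
    slack (≤-trans (+-monoˡ-≤ (11 + b) (*-monoˡ-≤ 8 a≤M)) (≤-reflexive (lemma₁ (M * 8) b))) $
    shift-halts a (state st ks (values E) cs c) cs (values E) room-V (roomy₂ (≤-trans a≤M (m≤m+n M M))) $ h _
    where
    open ≤-Reasoning
    a≤M : weight a ≤ M
    a≤M = ≤-trans (m≤n+m _ 2) (weight≤M (ƛ a) (≤-trans (m≤m+n _ _) le))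
    lemma₁ : ∀ x b → x + (11 + b) ≡ 11 + (x + b)
    lemma₁ = solve-∀
    lemma₂ : ∀ a c → 2 + ((a + a) + suc (c + c)) ≡ 3 + ((a + c) + (a + c))
    lemma₂ = solve-∀
    room-V : 2 + length (revert (ƛ a) (bit₁ ∷ values E)) ≤ W
    room-V = begin
      2 + length (revert (ƛ a) (bit₁ ∷ values E))                              ≡⟨ cong (2 +_) (length-revert (ƛ a) _) ⟩
      2 + (weight (ƛ a) + suc (length (values E)))                             ≤⟨ +-monoʳ-≤ 2 (+-mono-≤ (weight≤2*size (ƛ a)) (s≤s (length-values E))) ⟩
      2 + ((size (ƛ a) + size (ƛ a)) + suc (contextSize E + contextSize E))    ≡⟨ lemma₂ (size (ƛ a)) (contextSize E) ⟩
      3 + (sizeIn E (ƛ a) + sizeIn E (ƛ a))                                    ≤⟨ +-mono-≤ (m≤m+n 3 5) (≤-trans (+-mono-≤ le le) (m≤m+n M M)) ⟩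
      8 + (M + M)                                                              ≤⟨ W-large ⟩
      W                                                                        ∎

  dec-K : ∀ st ks {k vs cs c Ks r b} → value ks ≡ suc k → 2 + length ks ≤ W →
          H Ks nothing (state st (decrement ks) vs cs c) (potential (decrement ks) + b) →
          H (dec K ∷ Ks) r (state st ks vs cs c) (28 + (potential ks + b))
  dec-K st ks {vs = vs} {cs} {c} {b = b} e le h = slack
    (≤-trans (≤-reflexive (sym (+-assoc (decrement-time ks) (potential (decrement ks)) b))) (+-monoˡ-≤ b (amortised ks))) $
    dec-halts {at = λ xs ys → state st [] vs cs c [ K ≔ xs ] [ T ≔ ys ]}
      (record { get₁ = λ _ _ → refl ; get₂ = λ _ _ → refl ; set₁ = λ _ _ _ → refl ; set₂ = λ _ _ _ → refl }) ks e le le h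

  dec-K-fails : ∀ st ks {vs cs c Ks r b} → value ks ≡ 0 → 2 + length ks ≤ W → (∀ st → Φ spaceBoundNotReached st) →
                H (dec K ∷ Ks) r (state st ks vs cs c) (28 + (potential ks + b))
  dec-K-fails st ks {vs} {cs} {c} {b = b} e le φ = slack
    (≤-trans (+-monoˡ-≤ (4 + b) (potential-zero ks e)) (≤-trans (≤-reflexive (lemma (potential ks) b)) (+-monoˡ-≤ _ (m≤m+n 4 24)))) $
    dec-fails {at = λ xs ys → state st [] vs cs c [ K ≔ xs ] [ T ≔ ys ]}
      (record { get₁ = λ _ _ → refl ; get₂ = λ _ _ → refl ; set₁ = λ _ _ _ → refl ; set₂ = λ _ _ _ → refl }) ks {b = b} e le φ
    where
    lemma : ∀ p b → p + (4 + b) ≡ 4 + (p + b)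
    lemma = solve-∀

  module _ (st : St) (a u : Term) (E : Context) where

    private
      s′ : Term
      s′ = subst a 0 (ƛ u)
      vs cs : List Letter
      vs = values E
      cs = codes E

    contraction-time : ℕ → ℕ
    contraction-time b = q + (weight (ƛ u) * (5 + q) + (3 + (weight (ƛ a) * (5 + q) + (5 +
      (weight a * (60 + (q + weight (ƛ u) * (10 + q))) + (9 + (M * 4 + (3 + (weight (ƛ u) * 4 + (3 + b))))))))))

    contract : ∀ ks (c : Counter ℓ N) {Ks b} → count c ≡ suc (size (ƛ u) + (size (ƛ a) + contextSize E)) → count c ≤ N →
               (2 ^ ℓ ≤ sizeIn E s′ → ∀ st → Φ spaceBoundReached st) →
               (∀ n → n < 2 ^ ℓ → n ≤ sizeIn E s′ → n ≤ N) →
               (∀ (c′ : Counter ℓ N) → count c′ ≡ sizeIn E s′ → H Ks nothing (state st ks vs (encode s′ cs) c′) b) →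
               H (dec CNT ∷ (popBlock U ⨾ popBlock F ⨾ pop F ⨾ substitute ⨾ transfer G C ⨾ drain U) ∷ Ks) nothing
                 (state st ks (revert (ƛ u) (bit₁ ∷ revert (ƛ a) (bit₁ ∷ vs))) cs c) (contraction-time b)
    contract ks c {Ks} {b} e c≤N over cap h =
      dec-count (state st ks _ cs c) c e λ c₁ e₁ → seq′ $
      PopBlock.popBlock-halts {U} (λ xs ys → state st ks xs cs c [ U ≔ ys ])
        (λ _ → record { get₁ = λ _ _ → refl ; get₂ = λ _ _ → refl ; set₁ = λ _ _ _ → refl ; set₂ = λ _ _ _ → refl })
        (ƛ u) c₁ (revert (ƛ a) (bit₁ ∷ vs)) [] e₁ (room-encode (ƛ u) u≤N) λ c₂ e₂ → seq′ $
      PopBlock.popBlock-halts {F} (λ xs ys → state st ks xs cs c [ U ≔ encode (ƛ u) [] ] [ F ≔ ys ])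
        (λ _ → record { get₁ = λ _ _ → refl ; get₂ = λ _ _ → refl ; set₁ = λ _ _ _ → refl ; set₂ = λ _ _ _ → refl })
        (ƛ a) c₂ vs [] e₂ (room-encode (ƛ a) a≤N) λ c₃ e₃ → seq′ $ pop′ refl $ seq′ $ seq′ $
      Bounded.Substitution.subst-term (sizeIn E s′) over cap u u≤N (state st ks vs cs c) a 0 c₃ (Ret ∷ []) [] e₃ ≤-refl
        (≤-trans (n≤1+n _) a≤N) z≤n (stops refl) (≤-trans (n≤1+n _) (room-encode (ƛ a) a≤N))
        (λ n e₄ c₄ e₅ r → pop′ refl $ while′ $ cond′ $ seq′ $ empty′ refl $ cond′ $ skip′ $ while′ $
          let T≤N = Bounded.count≤N (sizeIn E s′) over cap c₄ e₅ (≤-reflexive e₄)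
              s≤N = ≤-trans (≤-trans (m≤m+n (size s′) (contextSize E)) (≤-reflexive (sym e₄))) T≤N in
          seq′ $ slack (+-monoˡ-≤ _ (*-monoˡ-≤ 4 (weight≤M s′ s≤N))) $
          at-time (cong (λ l → l * 4 + (3 + (weight (ƛ u) * 4 + (3 + b)))) (sym (trans (length-revert s′ []) (+-identityʳ _)))) $
          transfer-halts {at = λ xs ys → state st ks vs ys c₄ [ U ≔ encode (ƛ u) [] ] [ G ≔ xs ]}
            (record { get₁ = λ _ _ → refl ; get₂ = λ _ _ → refl ; set₁ = λ _ _ _ → refl ; set₂ = λ _ _ _ → refl })
            (revert s′ []) (≤-trans (≤-reflexive (cong (λ xs → 2 + length xs) (revert-ʳ++ s′ [] cs)))
              (roomy₂ (≤-trans (≤-reflexive (length-encode s′ cs)) (≤-trans (+-mono-≤ (weight≤2*size s′) (length-codes E))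
                (≤-trans (≤-reflexive (lemma (size s′) (contextSize E))) (≤-trans (≤-reflexive (cong₂ _+_ (sym e₄) (sym e₄))) (≤-trans (+-mono-≤ T≤N T≤N) (m≤m+n M M)))))))) $
          ≡-subst (λ xs → H (drain U ∷ Ks) nothing (state st ks vs xs c₄ [ U ≔ encode (ƛ u) [] ]) (weight (ƛ u) * 4 + (3 + b))) (sym (revert-ʳ++ s′ [] cs)) $
          at-time (cong (λ l → l * 4 + (3 + b)) (sym (trans (length-encode (ƛ u) []) (+-identityʳ _)))) $
          drain-halts U (λ xs → state st ks vs (encode s′ cs) c₄ [ U ≔ xs ]) (λ _ → refl) (λ _ _ → refl) (encode (ƛ u) []) $
          h c₄ (trans e₅ e₄)) _
      where
      u≤N : size (ƛ u) ≤ N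
      u≤N = ≤-trans (≤-trans (≤-trans (m≤m+n _ _) (n≤1+n _)) (≤-reflexive (sym e))) c≤N
      a≤N : size (ƛ a) ≤ N
      a≤N = ≤-trans (≤-trans (≤-trans (≤-trans (m≤m+n _ (contextSize E)) (m≤n+m _ (size (ƛ u)))) (n≤1+n _)) (≤-reflexive (sym e))) c≤N
      room-encode : ∀ t → size t ≤ N → 2 + length (encode t []) ≤ W
      room-encode t le = roomy₂ (≤-trans (≤-reflexive (trans (length-encode t []) (+-identityʳ _))) (≤-trans (weight≤M t le) (m≤m+n M M)))
      lemma : ∀ a b → (a + a) + (b + b) ≡ (a + b) + (a + b)
      lemma = solve-∀

  contraction-bound : ∀ st a u E b → size (ƛ u) ≤ N → size (ƛ a) ≤ N →
                      contraction-time st a u E b ≤ 23 + (q + M * (18 + (q + q + ρN))) + b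
  contraction-bound st a u E b u≤N a≤N = ≤-trans
    (+-monoʳ-≤ q (+-mono-≤ (*-monoˡ-≤ (5 + q) wu) (+-monoʳ-≤ 3 (+-mono-≤ (*-monoˡ-≤ (5 + q) wa) (+-monoʳ-≤ 5
      (+-mono-≤ (*-mono-≤ (≤-trans (m≤n+m _ 2) wa) (+-monoʳ-≤ 60 (+-monoʳ-≤ q (*-monoˡ-≤ (10 + q) wu))))
      (+-monoʳ-≤ 9 (+-monoʳ-≤ (M * 4) (+-monoʳ-≤ 3 (+-monoˡ-≤ (3 + b) (*-monoˡ-≤ 4 wu)))))))))))
    (≤-reflexive (lemma M q ρN b))
    where
    wu = weight≤M (ƛ u) u≤N
    wa = weight≤M (ƛ a) a≤N
    lemma : ∀ m q ρ b → q + (m * (5 + q) + (3 + (m * (5 + q) + (5 + (m * ρ + (9 + (m * 4 + (3 + (m * 4 + (3 + b))))))))))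
                        ≡ 23 + (q + m * (18 + (q + q + ρ))) + b
    lemma = solve-∀

  gather-bars : ∀ n st vs xs {Ks b} → 2 + length (bars n xs) ≤ W →
                (∀ r → H (pop V ∷ while block? (push X keep ⨾ pop V) ∷ Ks) r (st [ V ≔ vs ] [ X ≔ bars n xs ]) b) →
                ∀ r → H (pop V ∷ while block? (push X keep ⨾ pop V) ∷ Ks) r (st [ V ≔ fill I n vs ] [ X ≔ xs ]) (n * 4 + b)
  gather-bars n st vs xs {Ks} {b} le h r rewrite fill-bars n vs | sym (fill-bars n xs) = loop n xs le h r
    where
    loop : ∀ n xs → 2 + length (fill I n xs) ≤ W →
           (∀ r → H (pop V ∷ while block? (push X keep ⨾ pop V) ∷ Ks) r (st [ V ≔ vs ] [ X ≔ fill I n xs ]) b) →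
           ∀ r → H (pop V ∷ while block? (push X keep ⨾ pop V) ∷ Ks) r (st [ V ≔ bars n vs ] [ X ≔ xs ]) (n * 4 + b)
    loop zero    xs le h = h
    loop (suc n) xs le h r = pop′ refl $ while′ $ seq′ $
      push′ refl (≤-trans (s≤s (s≤s (≤-trans (m≤n+m _ n) (≤-reflexive (sym (length-fill I n _)))))) le) $ loop n (I ∷ xs) le h _

  gather-term : ∀ t st vs xs {Ks b} → 2 + length (encode t xs) ≤ W →
                (∀ r → H (pop V ∷ while block? (push X keep ⨾ pop V) ∷ Ks) r (st [ V ≔ vs ] [ X ≔ encode t xs ]) b) →
                ∀ r → H (pop V ∷ while block? (push X keep ⨾ pop V) ∷ Ks) r (st [ V ≔ revert t vs ] [ X ≔ xs ]) (weight t * 4 + b)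
  gather-term (# n)   st vs xs {b = b} le h r = at-time (var-time n 4 b) $
    gather-bars n st (Var ∷ vs) xs (≤-trans (n≤1+n _) le) (λ r → pop′ refl $ while′ $ seq′ $ push′ refl le $ h _) r
  gather-term (s · t) st vs xs {b = b} le h r = at-time (app-time (weight s) (weight t) 4 b) $
    pop′ refl $ while′ $ seq′ $ push′ refl (≤-trans (s≤s (s≤s (≤-trans (encode-longer t) (encode-longer s)))) le) $
    gather-term t st (revert s vs) (App ∷ xs) (≤-trans (s≤s (s≤s (encode-longer s))) le)
      (gather-term s st vs (encode t (App ∷ xs)) le h) _
  gather-term (ƛ s)   st vs xs {b = b} le h r = at-time (lam-time (weight s) 4 b) $
    pop′ refl $ while′ $ seq′ $ push′ refl (≤-trans (s≤s (s≤s (≤-trans (encode-longer s) (n≤1+n _)))) le) $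
    gather-term s st (Lam ∷ vs) (Ret ∷ xs) (≤-trans (n≤1+n _) le) (λ r → pop′ refl $ while′ $ seq′ $ push′ refl le $ h _) _

  emit-list : ∀ xs st os {Ks b} → 2 + length (xs ʳ++ os) ≤ W →
              H Ks nothing (set out (output (xs ʳ++ os)) (st [ X ≔ [] ])) b →
              ∀ r → H (pop X ∷ while is-just (push out keep ⨾ pop X) ∷ Ks) r (set out (output os) (st [ X ≔ xs ])) (length xs * 4 + (3 + b))
  emit-list []       st os le h r = empty′ refl $ while′ h
  emit-list (x ∷ xs) st os le h r = pop′ refl $ while′ $ seq′ $
    emit′ refl (≤-trans (s≤s (s≤s (≤-trans (m≤n+m _ (length xs)) (≤-reflexive (sym (length-ʳ++ xs)))))) le) $
    emit-list xs st (x ∷ os) le h _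

  finish-halts : ∀ st ks a (c : Counter ℓ N) {r b} → size (ƛ a) ≤ N → (∀ st → get out st ≡ output (revert (ƛ a) []) → Φ term st) →
                 H (finish ∷ []) r (state st ks (revert (ƛ a) (bit₁ ∷ [])) [] c) (6 + (M * 8 + b))
  finish-halts st ks a c {b = b} a≤N φ = seq′ $ seq′ $
    slack (≤-trans (+-mono-≤ (*-monoˡ-≤ 4 le) (+-monoʳ-≤ 3 (+-monoˡ-≤ (3 + b) (*-monoˡ-≤ 4 le)))) (≤-reflexive (lemma M b))) $
    gather-term (ƛ a) (state st ks [] [] c) (bit₁ ∷ []) [] (roomy₂ (≤-trans (≤-reflexive (trans (length-encode (ƛ a) []) (+-identityʳ _))) (≤-trans le (m≤m+n M M))))
      (λ r → pop′ refl $ while′ $ seq′ $ seq′ $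
        at-time (cong (λ l → l * 4 + (3 + b)) (sym (trans (length-encode (ƛ a) []) (+-identityʳ _)))) $
        emit-list (encode (ƛ a) []) (state st ks [] [] c) [] (≤-trans (≤-reflexive (cong (λ xs → 2 + length xs) (encode-ʳ++ (ƛ a) [] [])))
          (roomy₂ (≤-trans (≤-reflexive (trans (length-revert (ƛ a) []) (+-identityʳ _))) (≤-trans le (m≤m+n M M)))))
          (exit′ (φ _ (cong output (encode-ʳ++ (ƛ a) [] [])))) _) _
    where
    le = weight≤M (ƛ a) a≤N
    lemma : ∀ m b → m * 4 + (3 + (m * 4 + (3 + b))) ≡ 6 + (m * 8 + b)
    lemma = solve-∀

  decrements-halt : ∀ st ks c {k vs cs Ks b} → value ks ≡ 3 + k → 2 + length ks ≤ W →
                    (∀ ks′ → value ks′ ≡ k → length ks′ ≡ length ks →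
                      H ((dec CNT ⨾ popBlock U ⨾ popBlock F ⨾ pop F ⨾ substitute ⨾ transfer G C ⨾ drain U) ∷ Ks) nothing
                        (state st ks′ vs cs c) (potential ks′ + b)) →
                    ∀ x → H (beta ∷ Ks) x (state st ks vs cs c) (84 + (potential ks + b))
  decrements-halt st ks c {vs = vs} {cs} {b = b} e le h x = at-time (lemma (potential ks) b) $
    seq′ $ dec-K st ks {vs = vs} {cs} {c} e le $ at-time (swap (potential ks₁) (28 + b)) $
    seq′ $ dec-K st ks₁ {vs = vs} {cs} {c} (value-decrement ks e) (≤-trans (≤-reflexive (cong (2 +_) (length-decrement ks))) le) $ at-time (swap (potential ks₂) b) $
    seq′ $ dec-K st ks₂ {vs = vs} {cs} {c} (value-decrement ks₁ (value-decrement ks e))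
      (≤-trans (≤-reflexive (cong (2 +_) (trans (length-decrement ks₁) (length-decrement ks)))) le) $
    h (decrement ks₂) (value-decrement ks₂ (value-decrement ks₁ (value-decrement ks e)))
      (trans (length-decrement ks₂) (trans (length-decrement ks₁) (length-decrement ks)))
    where
    ks₁ = decrement ks
    ks₂ = decrement ks₁
    lemma : ∀ p b → 84 + (p + b) ≡ 28 + (p + (28 + (28 + b)))
    lemma = solve-∀
    swap : ∀ p b → p + (28 + b) ≡ 28 + (p + b)
    swap = solve-∀

  decrements-fail : ∀ st ks c {vs cs Ks} → value ks < 3 → 2 + length ks ≤ W → (∀ st → Φ spaceBoundNotReached st) →
                    ∀ x → H (beta ∷ Ks) x (state st ks vs cs c) (84 + (potential ks + 0))
  decrements-fail st ks c {vs} {cs} lt le φ x with value ks in e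
  ... | 0 = slack (m≤n+m _ 56) $ seq′ $ dec-K-fails st ks {vs} {cs} {c} e le φ
  ... | 1 = slack (≤-trans (≤-reflexive (lemma (potential ks))) (m≤n+m _ 28)) $ seq′ $ dec-K st ks {vs = vs} {cs} {c} e le $ at-time (swap (potential ks₁)) $
    seq′ $ dec-K-fails st ks₁ {vs} {cs} {c} (value-decrement ks e) (≤-trans (≤-reflexive (cong (2 +_) (length-decrement ks))) le) φ
    where
    ks₁ = decrement ks
    lemma : ∀ p → 28 + (p + 28) ≡ 56 + (p + 0)
    lemma = solve-∀
    swap : ∀ p → p + 28 ≡ 28 + (p + 0)
    swap = solve-∀
  ... | 2 = at-time (lemma (potential ks)) $
    seq′ $ dec-K st ks {vs = vs} {cs} {c} e le $ at-time (swap (potential ks₁) 28) $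
    seq′ $ dec-K st ks₁ {vs = vs} {cs} {c} (value-decrement ks e) (≤-trans (≤-reflexive (cong (2 +_) (length-decrement ks))) le) $ at-time (swap₀ (potential ks₂)) $
    seq′ $ dec-K-fails st ks₂ {vs} {cs} {c} (value-decrement ks₁ (value-decrement ks e))
      (≤-trans (≤-reflexive (cong (2 +_) (trans (length-decrement ks₁) (length-decrement ks)))) le) φ
    where
    ks₁ = decrement ks
    ks₂ = decrement ks₁
    lemma : ∀ p → 84 + (p + 0) ≡ 28 + (p + (28 + 28))
    lemma = solve-∀
    swap : ∀ p b → p + (28 + b) ≡ 28 + (p + b)
    swap = solve-∀
    swap₀ : ∀ p → p + 28 ≡ 28 + (p + 0)
    swap₀ = solve-∀
  ... | suc (suc (suc _)) = contradiction lt λ { (s≤s (s≤s (s≤s ()))) }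

  redex-step : ∀ st ks c a u E {Ks b} → sizeIn (function a ∷ E) (ƛ u) ≤ N →
               (∀ x → H (beta ∷ pop C ∷ reduceLoop ∷ Ks) x (state st ks (revert (ƛ u) (bit₁ ∷ values (function a ∷ E))) (codes E) c) b) →
               ∀ x → H (pop C ∷ reduceLoop ∷ Ks) x (state st ks (values (function a ∷ E)) (encode (ƛ u) (codes (function a ∷ E))) c)
                 (15 + (M * 8 + (5 + b)))
  redex-step st ks c a u E le h =
    shift-step st ks c u (function a ∷ E) (codes (function a ∷ E)) le λ r → pop′ refl $ while′ $ seq′ $ cond′ $ cond′ $ h _

  -- Carrying the potential of `ks` along the induction makes the decrements of `K` cost a constant
  -- each, so that `Z` is independent of k.
  reduce-halts : ∀ {k E s} (r : Course (2 ^ ℓ) k E s) → Sound r → ∀ st ks (c : Counter ℓ N) →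
                 count c ≡ sizeIn E s → count c ≤ N → (∀ n → n < 2 ^ ℓ → n ≤ peak r → n ≤ N) →
                 value ks ≡ k → 2 + length ks ≤ W →
                 ∀ x → H (pop C ∷ reduceLoop ∷ finish ∷ []) x (state st ks (values E) (encode s (codes E)) c) (moves r * Z + (potential ks + 0))
  reduce-halts stuck φ st ks c e c≤N cap v lk x = pop′ refl $ while′ $ seq′ $ cond′ $ cond′ $ exit′ (φ _)
  reduce-halts (normal {a = a}) φ st ks c e c≤N cap v lk x =
    slack (≤-trans (≤-trans (≤-trans (m≤m+n _ (103 + (q + M * (10 + (q + q + ρN))))) (≤-reflexive (lemma M q ρN))) (m≤m+n Z 0)) (m≤m+n (Z + 0) (potential ks + 0))) $
    shift-step st ks c a [] [] a≤N (λ r → empty′ refl $ while′ $ finish-halts st ks a c {b = 0} (≤-trans (m≤m+n _ 0) a≤N) φ) x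
    where
    a≤N : sizeIn [] (ƛ a) ≤ N
    a≤N = ≤-trans (≤-reflexive (sym e)) c≤N
    lemma : ∀ m q ρ → 15 + (m * 8 + (3 + (6 + (m * 8 + 0)))) + (103 + (q + m * (10 + (q + q + ρ)))) ≡ 127 + (q + m * (26 + (q + q + ρ)))
    lemma = solve-∀
  -- The machine does nothing: the code of `s · t` is by definition that of `s` followed by what the
  -- frame `argument t` leaves on `C`.
  reduce-halts (descend {E = E} {s} {t} r) φ st ks c e c≤N cap v lk x =
    reduce-halts r φ st ks c (trans e (lemma (size s) (size t) (contextSize E))) c≤N cap v lk x
    where
    lemma : ∀ a b c → suc (a + b) + c ≡ a + suc (b + c)
    lemma = solve-∀
  reduce-halts (proceed {E = E} {a} {t} r) φ st ks c e c≤N cap v lk x =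
    slack (≤-trans (m≤m+n _ (112 + (q + M * (18 + (q + q + ρN))))) (≤-reflexive (lemma₂ M q ρN (moves r * Z) (potential ks + 0)))) $
    shift-step st ks c a E (encode t (App ∷ codes E)) (≤-trans (+-monoʳ-≤ (size (ƛ a)) (≤-trans (m≤n+m (contextSize E) (size t)) (n≤1+n _))) (≤-trans (≤-reflexive (sym e)) c≤N))
      (reduce-halts r φ st ks c (trans e (lemma (size (ƛ a)) (size t) (contextSize E))) c≤N cap v lk) x
    where
    lemma : ∀ a b c → a + suc (b + c) ≡ b + suc (a + c)
    lemma = solve-∀
    lemma₂ : ∀ m q ρ y p → 15 + (m * 8 + (y + p)) + (112 + (q + m * (18 + (q + q + ρ)))) ≡ (127 + (q + m * (26 + (q + q + ρ))) + y) + p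
    lemma₂ = solve-∀
  reduce-halts (timeout {k} {E} {a} {u} k<3) φ st ks c e c≤N cap v lk x =
    slack (≤-trans (m≤m+n _ (23 + (q + M * (18 + (q + q + ρN))))) (≤-reflexive (lemma M q ρN (potential ks)))) $
    redex-step st ks c a u E (≤-trans (≤-reflexive (sym e)) c≤N)
      (decrements-fail st ks c (≤-trans (≤-reflexive (cong suc v)) k<3) lk φ) x
    where
    lemma : ∀ m q ρ p → 15 + (m * 8 + (5 + (84 + (p + 0)))) + (23 + (q + m * (18 + (q + q + ρ)))) ≡ (127 + (q + m * (26 + (q + q + ρ))) + 0) + (p + 0)
    lemma = solve-∀
  reduce-halts (overflow {k} {E} {a} {u} over) φ st ks c e c≤N cap v lk x =
    slack (≤-reflexive (lemma M q ρN (potential ks))) $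
    redex-step st ks c a u E (≤-trans (≤-reflexive (sym e)) c≤N)
      (decrements-halt st ks c v lk λ ks′ v′ l′ → seq′ $
        slack (≤-trans (≤-trans (contraction-bound st a u E 0 (≤-trans (m≤m+n _ _) le) (≤-trans (≤-trans (m≤m+n _ (contextSize E)) (n≤1+n _)) (≤-trans (m≤n+m _ (size (ƛ u))) le)))
          (≤-reflexive (+-identityʳ _))) (m≤n+m _ (potential ks′))) $
        contract st a u E ks′ c (trans e (+-suc (size (ƛ u)) _)) c≤N (λ _ → φ) cap
          -- The contractum is never completed, because its size would be a counter value of at
          -- least 2 ^ ℓ.
          (λ c′ e′ → contradiction (≤-trans (s≤s over) (≤-trans (≤-reflexive (cong suc (sym e′))) (count<2^ℓ c′))) (n≮n _))) x
    where
    le = ≤-trans (≤-reflexive (sym e)) c≤N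
    lemma : ∀ m q ρ p → 15 + (m * 8 + (5 + (84 + (p + (23 + (q + m * (18 + (q + q + ρ)))))))) ≡ (127 + (q + m * (26 + (q + q + ρ))) + 0) + (p + 0)
    lemma = solve-∀
  reduce-halts (reduce {k} {E} {a} {u} fits r) φ st ks c e c≤N cap v lk x =
    slack (≤-reflexive (lemma M q ρN (potential ks) (moves r * Z))) $
    redex-step st ks c a u E le
      (decrements-halt st ks c v lk λ ks′ v′ l′ → seq′ $
        slack (≤-trans (contraction-bound st a u E (moves r * Z + (potential ks′ + 0)) (≤-trans (m≤m+n _ _) le) (≤-trans (≤-trans (m≤m+n _ (contextSize E)) (n≤1+n _)) (≤-trans (m≤n+m _ (size (ƛ u))) le)))
          (≤-reflexive (lemma₂ (23 + (q + M * (18 + (q + q + ρN)))) (moves r * Z) (potential ks′)))) $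
        contract st a u E ks′ c (trans e (+-suc (size (ƛ u)) _)) c≤N (λ over → contradiction (≤-trans fits over) (n≮n _))
          (λ n n< n≤ → cap n n< (≤-trans n≤ (m≤m⊔n _ _)))
          (λ c′ e′ → reduce-halts r φ st ks′ c′ e′ (≤-trans (≤-reflexive e′) (cap _ fits (m≤m⊔n _ _)))
            (λ n n< n≤ → cap n n< (≤-trans n≤ (m≤n⊔m _ _))) v′ (≤-trans (≤-reflexive (cong (2 +_) l′)) lk) nothing)) x
    where
    le = ≤-trans (≤-reflexive (sym e)) c≤N
    lemma : ∀ m q ρ p y → 15 + (m * 8 + (5 + (84 + (p + (23 + (q + m * (18 + (q + q + ρ))) + y))))) ≡ (127 + (q + m * (26 + (q + q + ρ))) + y) + (p + 0)
    lemma = solve-∀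
    lemma₂ : ∀ z y p → z + (y + (p + 0)) ≡ p + (z + y)
    lemma₂ = solve-∀

  initial : List Bool → List Bool → Term → St
  initial ks ms s =
    stream 0 (map Bit ks) , stream 0 (map Bit ms) , stream 0 (encode s []) , output [] , copies 11 (stack [])

  module _ (ks : List Bool) (ms : List Bool) (s : Term) (room-K : 2 + length ks ≤ Sk) (room-W : 2 + length ks ≤ W) where

    base : List Letter → List Letter → St
    base xs ys = set kIn (stream (suc (length ks)) []) (initial ks ms s) [ K ≔ xs ] [ T ≔ ys ]

    two-K : Two K T base
    two-K = record { get₁ = λ _ _ → refl ; get₂ = λ _ _ → refl ; set₁ = λ _ _ _ → refl ; set₂ = λ _ _ _ → refl }

    -- Input tapes can only be read forwards, so k is copied to a stack before it can be counted
    -- down. Two reversals bring the least significant digit to the top.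
    acquire : ∀ {P b} → H (P ∷ []) nothing (base (map Bit ks) []) b →
              H ((read kIn ⨾ while is-just (push X keep ⨾ read kIn)) ⨾ transfer X K ⨾ P ∷ []) nothing (initial ks ms s) (length ks * 8 + (6 + b))
    acquire {P} {b} h = at-time (lemma (length ks) b) $ seq′ $ seq′ $ (λ h → loop ks [] 0 refl refl h nothing) $ seq′ $
      at-time (cong (λ l → l * 4 + (3 + b)) (sym length-rev)) $
      transfer-halts {at = λ xs ys → base ys [] [ X ≔ xs ]}
        (record { get₁ = λ _ _ → refl ; get₂ = λ _ _ → refl ; set₁ = λ _ _ _ → refl ; set₂ = λ _ _ _ → refl })
        (map Bit ks ʳ++ []) (≤-trans (≤-reflexive (cong (λ xs → 2 + length xs) twice)) (≤-trans (≤-reflexive (cong (2 +_) (length-map Bit ks))) room-W)) $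
      ≡-subst (λ xs → H (P ∷ []) nothing (base xs []) b) (sym twice) h
      where
      lemma : ∀ l b → l * 8 + (6 + b) ≡ l * 4 + (3 + (l * 4 + (3 + b)))
      lemma = solve-∀
      twice : (map Bit ks ʳ++ []) ʳ++ [] ≡ map Bit ks
      twice = trans (ʳ++-ʳ++ (map Bit ks)) (++-identityʳ _)
      length-rev : length (map Bit ks ʳ++ []) ≡ length ks
      length-rev = trans (length-ʳ++ (map Bit ks)) (trans (+-identityʳ _) (length-map Bit ks))
      loop : ∀ bs xs p → p + length bs ≡ length ks → length xs ≡ p → ∀ {Ks b} →
             H Ks nothing (set kIn (stream (suc (length ks)) []) (initial ks ms s) [ X ≔ map Bit bs ʳ++ xs ]) b →
             ∀ r → H (read kIn ∷ while is-just (push X keep ⨾ read kIn) ∷ Ks) r (set kIn (stream p (map Bit bs)) (initial ks ms s) [ X ≔ xs ]) (length bs * 4 + (3 + b))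
      loop []       xs p e f {Ks} {b} h r rewrite trans (sym (+-identityʳ p)) e = end′ refl room-K $ while′ h
      loop (x ∷ bs) xs p e f h r = read′ refl (≤-trans (s≤s (s≤s (≤-trans (m≤m+n p _) (≤-reflexive e)))) room-K) $ while′ $ seq′ $
        push′ refl (≤-trans (s≤s (s≤s (≤-trans (≤-reflexive (cong suc f)) (≤-trans (m≤m+n (suc p) (length bs)) (≤-reflexive (trans (sym (+-suc p _)) e)))))) room-W) $
        loop bs (Bit x ∷ xs) (suc p) (trans (sym (+-suc p _)) e) (cong suc f) h _

    rejected : ∀ {b} → value ks ≡ 0 → (∀ st → Φ spaceBoundNotReached st) →
               H (main ∷ []) nothing (initial ks ms s) (length ks * 8 + (6 + (length ks * 4 + (4 + b))))
    rejected {b} e φ = acquire $ seq′ $ dec-fails two-K ks {b = b} e room-W φ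

    without-space : ∀ {k b} → value ks ≡ suc k → ms ≡ [] → (∀ st → Φ spaceBoundReached st) →
                    H (main ∷ []) nothing (initial ks ms s) (length ks * 8 + (6 + (decrement-time ks + (3 + b))))
    without-space e refl φ = acquire $ seq′ $ dec-halts two-K ks e room-W room-W $ seq′ $ end′ refl (≤-trans (m≤m+n 2 (1 + ℓ)) Sm-large) $
      seq′ $ cond′ $ exit′ (φ _)

    main-halts : ∀ {k m more b} → value ks ≡ suc k → ms ≡ m ∷ more → length more ≡ ℓ →
                 (r : Course (2 ^ ℓ) k [] s) → (2 ^ ℓ ≤ size s → ∀ st → Φ spaceBoundReached st) → (size s < 2 ^ ℓ → Sound r) →
                 (∀ n → n < 2 ^ ℓ → n ≤ size s ⊔ peak r → n ≤ N) → (size s < 2 ^ ℓ → moves r * Z + (potential (decrement ks) + 0) ≤ b) →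
                 H (main ∷ []) nothing (initial ks ms s)
                   (length ks * 8 + (6 + (decrement-time ks + (4 + ((N + 1 + (N + 1)) * (6 + q) + (6 + (M * 4 + b)))))))
    main-halts {m = m} {more} {b} e refl refl r over sound cap in-time = acquire $ seq′ $ dec-halts two-K ks e room-W room-W $
      seq′ $ read′ refl (≤-trans (m≤m+n 2 (1 + ℓ)) Sm-large) $ seq′ $ cond′ $ skip′ $ seq′ $
      at-time (cong (_+ (6 + (M * 4 + b))) (lemma N (6 + q))) $
      Bounded.load-halts (size s) over (λ n n< n≤ → cap n n< (≤-trans n≤ (m≤m⊔n _ _))) s (base (map Bit (decrement ks)) []) c₀ refl ≤-refl λ c₁ p e₁ →
      -- Once loading has succeeded, the size of `s` is a counter value and hence below 2 ^ ℓ. Only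
      -- now are the hypotheses about the reduction available.
      let s< = ≤-trans (≤-reflexive (cong suc (sym e₁))) (count<2^ℓ c₁) in
      slack (in-time s<) $ seq′ $ seq′ $
      reduce-halts r (sound s<) (set sIn (stream p []) (base [] [])) (decrement ks) c₁ (trans e₁ (sym (+-identityʳ _)))
        (≤-trans (≤-reflexive e₁) (cap _ s< (m≤m⊔n _ _))) (λ n n< n≤ → cap n n< (≤-trans n≤ (m≤n⊔m _ _)))
        (value-decrement ks e) (≤-trans (≤-reflexive (cong (2 +_) (length-decrement ks))) room-W) nothing
      where
      c₀ : Counter ℓ N
      -- Position 1 accounts for the digit of m read in advance.
      c₀ = counter 1 [] more refl refl z≤n
      lemma : ∀ n x → (n + 1 + (n + 1)) * x ≡ (suc n + suc n + 0) * x
      lemma = solve-∀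

-- Reduction sequences, traces and their measures

≻-deterministic : ∀ {s t t′} → s ≻ t → s ≻ t′ → t ≡ t′
≻-deterministic β      β       = refl
≻-deterministic (ξₗ r) (ξₗ r′) = cong (_· _) (≻-deterministic r r′)
≻-deterministic (ξᵣ r) (ξᵣ r′) = cong (_ ·_) (≻-deterministic r r′)

⇓-tail : ∀ {s s′ j n t} → s ≻ s′ → s ⇓⟨ j , n ⟩ t →
         ∃₂ λ j′ n′ → j ≡ suc j′ × n ≡ size s ⊔ n′ × s′ ⇓⟨ j′ , n′ ⟩ t
⇓-tail r (r′ ◅ d) with refl ← ≻-deterministic r r′ = _ , _ , refl , refl , d

-- `Time` and `Space` are given by their graphs, so the final claims concern every derivation;
-- determinism reduces them to the one that the machine has found.
⇓-unique : ∀ {s j n t j′ n′ t′} → s ⇓⟨ j , n ⟩ t → s ⇓⟨ j′ , n′ ⟩ t′ → j ≡ j′ × n ≡ n′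
⇓-unique done    done = refl , refl
⇓-unique (r ◅ d) d′ with ⇓-tail r d′
... | _ , _ , refl , refl , d″ with refl , refl ← ⇓-unique d d″ = refl , refl

size≤space : ∀ {s j n t} → s ⇓⟨ j , n ⟩ t → size s ≤ n
size≤space done    = ≤-refl
size≤space (_ ◅ _) = m≤m⊔n _ _

plug-≻ : ∀ E {s s′} → s ≻ s′ → plug E s ≻ plug E s′
plug-≻ []               r = r
plug-≻ (argument t ∷ E) r = plug-≻ E (ξₗ r)
plug-≻ (function a ∷ E) r = plug-≻ E (ξᵣ r)

-- A variable outside of all abstractions is never removed.
data Exposed : Term → Set where
  here  : ∀ {n} → Exposed (# n)
  left  : ∀ {s t} → Exposed s → Exposed (s · t)
  right : ∀ {s t} → Exposed t → Exposed (s · t)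

exposed-≻ : ∀ {s s′} → Exposed s → s ≻ s′ → Exposed s′
exposed-≻ (left e)  (ξₗ r) = left (exposed-≻ e r)
exposed-≻ (left ()) (ξᵣ r)
exposed-≻ (right e) (ξₗ r) = right e
exposed-≻ (right e) (ξᵣ r) = right (exposed-≻ e r)
exposed-≻ (left ()) β
exposed-≻ (right ()) β

exposed-diverges : ∀ {s j n t} → Exposed s → ¬ s ⇓⟨ j , n ⟩ t
exposed-diverges e (r ◅ d) = exposed-diverges (exposed-≻ e r) d

exposed-plug : ∀ E {s} → Exposed s → Exposed (plug E s)
exposed-plug []               e = e
exposed-plug (argument t ∷ E) e = exposed-plug E (left e)
exposed-plug (function a ∷ E) e = exposed-plug E (right e)

-- A contraction inside a context is a reduction step of the plugged term, so by determinism every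
-- traced term, even one that is too large to be written, lies on the reduction to the normal form.
peak≤space : ∀ {B k E s} (r : Course B k E s) {j n t} → plug E s ⇓⟨ j , n ⟩ t → peak r ≤ n
peak≤space stuck        d = z≤n
peak≤space normal       d = z≤n
peak≤space (descend r)  d = peak≤space r d
peak≤space (proceed r)  d = peak≤space r d
peak≤space (timeout _)  d = z≤n
peak≤space (overflow {E = E} {a} {u} _) d with ⇓-tail (plug-≻ E β) d
... | _ , _ , refl , refl , d′ = ≤-trans (≤-trans (≤-reflexive (sym (size-plug E _))) (size≤space d′)) (m≤n⊔m _ _)
peak≤space (reduce {E = E} _ r) d with ⇓-tail (plug-≻ E β) d
... | _ , _ , refl , refl , d′ = ≤-trans (⊔-lub (≤-trans (≤-reflexive (sym (size-plug E _))) (size≤space d′)) (peak≤space r d′)) (m≤n⊔m _ _)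

-- The part of the context still to be scanned. Functions already moved to `V` do not count, which
-- makes the sum with the current term decrease between contractions.
pending : Context → ℕ
pending []               = 0
pending (argument t ∷ E) = size t + pending E
pending (function a ∷ E) = pending E

pending≤contextSize : ∀ E → pending E ≤ contextSize E
pending≤contextSize []               = z≤n
pending≤contextSize (argument t ∷ E) = ≤-trans (+-monoʳ-≤ (size t) (pending≤contextSize E)) (n≤1+n _)
pending≤contextSize (function a ∷ E) = ≤-trans (pending≤contextSize E) (≤-trans (m≤n+m _ (size (ƛ a))) (n≤1+n _))

-- Lexicographic recursion: a contraction lowers k and obtains fresh fuel for the new term, every
-- other step consumes fuel.
course : ∀ B k f E s → size s + pending E ≤ f → Course B k E s
course B k f       E                (# n)   le = stuck
course B k (suc f) E                (s · t) le =
  descend (course B k f (argument t ∷ E) s (≤-trans (≤-reflexive (sym (+-assoc (size s) (size t) _))) (s≤s⁻¹ le)))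
course B k f       []               (ƛ a)   le = normal
course B k (suc f) (argument t ∷ E) (ƛ a)   le = proceed (course B k f (function a ∷ E) t (≤-trans (m≤n+m _ (size a)) (s≤s⁻¹ le)))
course B (suc (suc (suc k))) f (function a ∷ E) (ƛ u) le with sizeIn E (subst a 0 (ƛ u)) <? B
... | yes fits = reduce fits (course B k _ E (subst a 0 (ƛ u)) ≤-refl)
... | no ¬fits = overflow (≮⇒≥ ¬fits)
course B 0 f (function a ∷ E) (ƛ u) le = timeout (s≤s z≤n)
course B 1 f (function a ∷ E) (ƛ u) le = timeout (s≤s (s≤s z≤n))
course B 2 f (function a ∷ E) (ƛ u) le = timeout (s≤s (s≤s (s≤s z≤n)))

-- Shifts are paid for by the unscanned part of the term. A contraction renews this budget, but by
-- no more than the size of the new term, which is at most `top`.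
moves-bound : ∀ {B top k E s} (r : Course B k E s) → (∀ n → n < B → n ≤ peak r → n ≤ top) →
              moves r ≤ suc (size s + pending E + k * suc top)
moves-bound stuck                        cap = s≤s z≤n
moves-bound normal                       cap = s≤s z≤n
moves-bound {E = E} (descend {s = s} {t} r) cap = ≤-trans (moves-bound r cap)
  (s≤s (+-monoˡ-≤ _ (≤-trans (≤-reflexive (sym (+-assoc (size s) (size t) (pending E)))) (n≤1+n _))))
moves-bound {top = top} {k} {argument t ∷ E} (proceed {a = a} r) cap =
  s≤s (≤-trans (moves-bound r cap) (s≤s (+-monoˡ-≤ (k * suc top) (m≤n+m (size t + pending E) (size a)))))
moves-bound (timeout _)                  cap = s≤s z≤n
moves-bound (overflow _)                 cap = s≤s z≤n
moves-bound {top = top} (reduce {k} {E} {a} {u} fits r) cap = s≤s (begin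
  moves r                                                      ≤⟨ moves-bound r (λ n n< n≤ → cap n n< (≤-trans n≤ (m≤n⊔m _ _))) ⟩
  suc (size s′ + pending E + k * suc top)                        ≤⟨ s≤s (+-monoˡ-≤ _ (≤-trans (+-monoʳ-≤ (size s′) (pending≤contextSize E)) (cap _ fits (m≤m⊔n _ _)))) ⟩
  -- One of the three units taken from k pays for this contraction and the renewed budget; the other
  -- two are given away.
  suc top + k * suc top                                            ≤⟨ m≤n+m _ (suc top + suc top) ⟩
  suc top + suc top + (suc top + k * suc top)                          ≡⟨ +-assoc (suc top) (suc top) _ ⟩
  (3 + k) * suc top                                              ≤⟨ m≤n+m _ (size (ƛ u) + pending E) ⟩
  size (ƛ u) + pending E + (3 + k) * suc top                     ∎)
  where
  open ≤-Reasoning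
  s′ = subst a 0 (ƛ u)

-- Correctness of the verdicts

module _ (Φ : Verdict → Language.St 15 → Set) {Sk Sm Ss W ℓ N : ℕ} (hm : 3 + ℓ ≤ Sm) (hs : 4 + (N + N) ≤ Ss) (hw : 8 + (N + N + (N + N)) ≤ W) where

  open Reduction Φ {Sk} {Sm} {Ss} {W} {ℓ} {N} hm hs hw using (Sound)

  -- The premises of the two failure verdicts quantify over all reductions to a normal form, of
  -- which there may be none. For a diverging term both are vacuous, so termination need not be
  -- decided.
  sound : ∀ {B k E s} (r : Course B k E s) → sizeIn E s < B →
          (∀ {j n t} → plug E s ⇓⟨ j , n ⟩ t → 3 * j ≤ k → n < B → ∀ st → get out st ≡ output (revert t []) → Φ term st) →
          ((∀ {j n t} → plug E s ⇓⟨ j , n ⟩ t → k < 3 * j) → ∀ st → Φ spaceBoundNotReached st) →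
          ((∀ {j n t} → plug E s ⇓⟨ j , n ⟩ t → B ≤ n) → ∀ st → Φ spaceBoundReached st) → Sound r
  -- A variable in evaluation position rules out a normal form, so this verdict is right for every
  -- k.
  sound {E = E} stuck lt φt φn φs = φn λ d → contradiction d (exposed-diverges (exposed-plug E here))
  sound normal lt φt φn φs = φt done z≤n (≤-trans (s≤s (m≤m+n _ 0)) lt)
  sound (descend {E = E} {s} {t} r) lt φt φn φs = sound r (≤-trans (≤-reflexive (cong suc (trans (sym (size-plug (argument t ∷ E) s)) (size-plug E (s · t))))) lt) φt φn φs
  sound (proceed {E = E} {a} {t} r) lt φt φn φs = sound r (≤-trans (≤-reflexive (cong suc (trans (sym (size-plug (function a ∷ E) t)) (size-plug (argument t ∷ E) (ƛ a))))) lt) φt φn φs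
  sound (timeout {k} {E} {a} {u} k<3) lt φt φn φs = φn late
    where
    late : ∀ {j n t} → plug (function a ∷ E) (ƛ u) ⇓⟨ j , n ⟩ t → k < 3 * j
    late d with ⇓-tail (plug-≻ E β) d
    ... | j′ , _ , refl , _ = ≤-trans k<3 (≤-trans (m≤m+n 3 (3 * j′)) (≤-reflexive (sym (*-suc 3 j′))))
  sound (overflow {E = E} {a} {u} over) lt φt φn φs = φs large
    where
    large : ∀ {j n t} → plug (function a ∷ E) (ƛ u) ⇓⟨ j , n ⟩ t → _ ≤ n
    large d with ⇓-tail (plug-≻ E β) d
    ... | _ , _ , refl , refl , d′ = ≤-trans (≤-trans over (≤-trans (≤-reflexive (sym (size-plug E _))) (size≤space d′))) (m≤n⊔m _ _)
  sound {B} (reduce {k} {E} {a} {u} fits r) lt φt φn φs = sound r fits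
    (λ {j} d le n< → φt (r′ ◅ d) (≤-trans (≤-reflexive (*-suc 3 j)) (+-monoʳ-≤ 3 le))
      (⊔-pres-<m (≤-trans (≤-reflexive (cong suc (size-plug (function a ∷ E) (ƛ u)))) lt) n<))
    (λ after → φn (late after)) (λ after → φs (large after))
    where
    r′ = plug-≻ E (β {a} {u})
    late : (∀ {j n t} → plug E (subst a 0 (ƛ u)) ⇓⟨ j , n ⟩ t → k < 3 * j) →
           ∀ {j n t} → plug (function a ∷ E) (ƛ u) ⇓⟨ j , n ⟩ t → 3 + k < 3 * j
    late after d with ⇓-tail r′ d
    ... | j′ , _ , refl , _ , d′ = ≤-trans (+-monoʳ-≤ 3 (after d′)) (≤-reflexive (sym (*-suc 3 j′)))
    large : (∀ {j n t} → plug E (subst a 0 (ƛ u)) ⇓⟨ j , n ⟩ t → B ≤ n) →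
            ∀ {j n t} → plug (function a ∷ E) (ƛ u) ⇓⟨ j , n ⟩ t → B ≤ n
    large after d with ⇓-tail r′ d
    ... | _ , _ , refl , refl , d′ = ≤-trans (after d′) (m≤n⊔m _ _)

-- Binary length and logarithm

data Canonical : List Bool → Set where
  leading : Canonical (true ∷ [])
  _∷_     : ∀ b {bs} → Canonical bs → Canonical (b ∷ bs)

canonical-increment : ∀ {bs} → Canonical bs → Canonical (increment bs)
canonical-increment leading     = false ∷ leading
canonical-increment (false ∷ c) = true ∷ c
canonical-increment (true ∷ c)  = false ∷ canonical-increment c

canonical-binary : ∀ n → Canonical (binary (suc n))
canonical-binary zero    = leading
canonical-binary (suc n) = canonical-increment (canonical-binary n)

canonical-value : ∀ {b bs} → Canonical (b ∷ bs) → 2 ^ length bs ≤ value (b ∷ bs)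
canonical-value leading               = s≤s z≤n
canonical-value (false ∷ c@leading)   = *-monoʳ-≤ 2 (canonical-value c)
canonical-value (false ∷ c@(_ ∷ _))   = *-monoʳ-≤ 2 (canonical-value c)
canonical-value (true ∷ c@leading)    = ≤-trans (*-monoʳ-≤ 2 (canonical-value c)) (n≤1+n _)
canonical-value (true ∷ c@(_ ∷ _))    = ≤-trans (*-monoʳ-≤ 2 (canonical-value c)) (n≤1+n _)

-- The leading digit being 1, the number of digits determines the value up to a factor of 2. This
-- imprecision is the 2 in the claim for `spaceBoundReached`.
binary-suc : ∀ n → ∃₂ λ b bs → binary (suc n) ≡ b ∷ bs × 2 ^ length bs ≤ suc n × suc n < 2 * 2 ^ length bs
binary-suc n with binary (suc n) | canonical-binary n | value-binary (suc n)
... | b ∷ bs | c | e = b , bs , refl , ≤-trans (canonical-value c) (≤-reflexive e) ,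
  ≤-trans (≤-reflexive (cong suc (sym e))) (value<2^length (b ∷ bs))

n<2^n : ∀ n → n < 2 ^ n
n<2^n zero    = s≤s z≤n
n<2^n (suc n) = ≤-trans (s≤s (n<2^n n)) (≤-trans (+-monoˡ-≤ (2 ^ n) (m^n>0 2 n)) (+-monoʳ-≤ (2 ^ n) (m≤m+n (2 ^ n) 0)))

length≤log : ∀ {n m} → 2 ^ n ≤ m → n ≤ ⌊log₂ m ⌋
length≤log {n} le = ≤-trans (≤-reflexive (sym (⌊log₂[2^n]⌋≡n n))) (⌊log₂⌋-mono-≤ le)

-- Codes on tapes

map-symbol-Bit : ∀ bs → map symbol (map Bit bs) ≡ map bit bs
map-symbol-Bit bs = sym (map-∘ bs)

encodeTerm-encode : ∀ t xs → encodeTerm t ++ map symbol xs ≡ map symbol (encode t xs)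
encodeTerm-encode (# n)   xs = cong (VAR ∷_) (trans (cong (_++ map symbol xs) (++-identityʳ (replicate n ∣))) (bars-replicate n))
  where
  bars-replicate : ∀ n → replicate n ∣ ++ map symbol xs ≡ map symbol (bars n xs)
  bars-replicate zero    = refl
  bars-replicate (suc n) = cong (∣ ∷_) (bars-replicate n)
encodeTerm-encode (s · t) xs = begin
  concatMap encodeCom (γ s ++ γ t ++ app ∷ []) ++ map symbol xs                  ≡⟨ cong (_++ map symbol xs) (concatMap-++ encodeCom (γ s) (γ t ++ app ∷ [])) ⟩
  (encodeTerm s ++ concatMap encodeCom (γ t ++ app ∷ [])) ++ map symbol xs       ≡⟨ ++-assoc (encodeTerm s) _ _ ⟩
  encodeTerm s ++ concatMap encodeCom (γ t ++ app ∷ []) ++ map symbol xs         ≡⟨ cong (λ ys → encodeTerm s ++ ys ++ map symbol xs) (concatMap-++ encodeCom (γ t) (app ∷ [])) ⟩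
  encodeTerm s ++ (encodeTerm t ++ APP ∷ []) ++ map symbol xs                    ≡⟨ cong (encodeTerm s ++_) (++-assoc (encodeTerm t) _ _) ⟩
  encodeTerm s ++ encodeTerm t ++ map symbol (App ∷ xs)                          ≡⟨ cong (encodeTerm s ++_) (encodeTerm-encode t (App ∷ xs)) ⟩
  encodeTerm s ++ map symbol (encode t (App ∷ xs))                               ≡⟨ encodeTerm-encode s _ ⟩
  map symbol (encode s (encode t (App ∷ xs)))                                    ∎
  where open ≡-Reasoning
encodeTerm-encode (ƛ s)   xs = cong (LAM ∷_) (begin
  concatMap encodeCom (γ s ++ ret ∷ []) ++ map symbol xs ≡⟨ cong (_++ map symbol xs) (concatMap-++ encodeCom (γ s) (ret ∷ [])) ⟩
  (encodeTerm s ++ RET ∷ []) ++ map symbol xs            ≡⟨ ++-assoc (encodeTerm s) _ _ ⟩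
  encodeTerm s ++ map symbol (Ret ∷ xs)                  ≡⟨ encodeTerm-encode s (Ret ∷ xs) ⟩
  map symbol (encode s (Ret ∷ xs))                       ∎)
  where open ≡-Reasoning

holds-output : ∀ t → Holds (tape (map symbol (revert t []) ++ ▷ ∷ []) ␣ []) (encodeTerm t)
-- The single blank is the cell under the head.
holds-output t = 1 , (begin
  reverse (map symbol (revert t []) ++ ▷ ∷ []) ++ ␣ ∷ []   ≡⟨ cong (_++ ␣ ∷ []) (reverse-++ (map symbol (revert t [])) (▷ ∷ [])) ⟩
  ▷ ∷ reverse (map symbol (revert t [])) ++ ␣ ∷ []         ≡⟨ cong (λ xs → ▷ ∷ xs ++ ␣ ∷ []) (sym (reverse-map symbol (revert t []))) ⟩
  ▷ ∷ map symbol (reverse (revert t [])) ++ ␣ ∷ []         ≡⟨ cong (λ xs → ▷ ∷ map symbol xs ++ ␣ ∷ []) (revert-ʳ++ t [] []) ⟩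
  ▷ ∷ map symbol (encode t []) ++ ␣ ∷ []                   ≡⟨ cong (λ xs → ▷ ∷ xs ++ ␣ ∷ []) (sym (trans (sym (++-identityʳ _)) (encodeTerm-encode t []))) ⟩
  ▷ ∷ encodeTerm t ++ ␣ ∷ []                               ∎)
  where open ≡-Reasoning

⟦_⟧-mono : ∀ p {x y} → x ≤ y → ⟦ p ⟧ x ≤ ⟦ p ⟧ y
⟦ [] ⟧-mono    le = z≤n
⟦ a ∷ p ⟧-mono le = +-monoʳ-≤ a (*-mono-≤ le (⟦ p ⟧-mono le))

sum-mono : ∀ {n} (xs ys : Vec ℕ n) → (∀ i → lookup xs i ≤ lookup ys i) → Vec.sum xs ≤ Vec.sum ys
sum-mono []       []       le = z≤n
sum-mono (x ∷ xs) (y ∷ ys) le = +-mono-≤ (le zero) (sum-mono xs ys (le ∘ suc))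

-- The machine and its specification

kinds : Vec Bool 15
kinds = Vec.replicate 3 false Vec.++ Vec.replicate 12 true

open Compiled kinds main

-- This is (1 + x) ^ 4: there are at most k · (1 + x) moves, each within `Z`, which is cubic in x.
quartic : Polynomial
quartic = 1 ∷ 4 ∷ 6 ∷ 4 ∷ 1 ∷ []

Correct : ℕ → ℕ → Term → Set
Correct k m s =
  ∃ λ (time : ℕ) → ∃ λ (space : ℕ) → ∃ λ (r : Verdict) → ∃ λ (ts : Tapes M) →
    Halts M (inputs M k m s) time space r ts
    × (∀ σ → IsSpace s σ →
         (time ≤[ 300 ] k * ⟦ quartic ⟧ (min∞ m σ))
         × (space ≤[ 300 ] min∞ m σ + ⌊log₂ m ⌋ + ⌊log₂ k ⌋))
    × (r ≡ term →
         ∃ λ (t : Term) → Outputs M ts t × HasNormalForm s t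
           × (∀ σ → IsSpace s σ → σ ≤∞ fin m)
           × (∀ τ → IsTime s τ → 3 *∞ τ +∞ 1 ≤∞ fin k))
    × (r ≡ spaceBoundReached → ∀ σ → IsSpace s σ → fin m ≤∞ 2 *∞ σ)
    × (r ≡ spaceBoundNotReached → ∀ τ → IsTime s τ → fin k <∞ 3 *∞ τ +∞ 1)

module _ (k m : ℕ) (s : Term) where

  Claim : Verdict → St → Set
  Claim term                 st = ∃ λ t → get out st ≡ output (revert t []) × HasNormalForm s t
                                    × (∀ σ → IsSpace s σ → σ ≤∞ fin m) × (∀ τ → IsTime s τ → 3 *∞ τ +∞ 1 ≤∞ fin k)
  Claim spaceBoundReached    st = ∀ σ → IsSpace s σ → fin m ≤∞ 2 *∞ σ
  Claim spaceBoundNotReached st = ∀ τ → IsTime s τ → fin k <∞ 3 *∞ τ +∞ 1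

  blank-models : ∀ n (i : Fin n) → Represents (get i (copies n (stack [])))
                   (move (if lookup (Vec.replicate n true) i then R else N) (lookup (Vec.replicate n (inputTape [])) i))
  blank-models (suc n) zero    = refl
  blank-models (suc n) (suc i) = blank-models n i

  blank-fits : ∀ n {W} (i : Fin n) → 2 ≤ W → extent (get i (copies n (stack []))) ≤ lookup (Vec.replicate n W) i
  blank-fits (suc n) zero    le = le
  blank-fits (suc n) (suc i) le = blank-fits n i le

  blank-positions : ∀ n {W} (i : Fin n) → 1 ≤ W →
                    suc (length (Tape.left (lookup (Vec.replicate n (inputTape {0} [])) i))) ≤ lookup (Vec.replicate n W) i
  blank-positions (suc n) zero    le = le
  blank-positions (suc n) (suc i) le = blank-positions n i le

  conclude : ∀ {Sk Sm Ss W ℓ N b} (hm : 3 + ℓ ≤ Sm) (hs : 4 + (N + N) ≤ Ss) (hw : 8 + (N + N + (N + N)) ≤ W) → 1 ≤ Sk →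
             Halt Claim (Sk ∷ Sm ∷ Ss ∷ Vec.replicate 12 W) (main ∷ []) nothing
               (Reduction.initial Claim {Sk} {Sm} {Ss} {W} {ℓ} {N} hm hs hw (binary k) (binary m) s) b →
             (∀ σ → IsSpace s σ → suc b ≤[ 300 ] k * ⟦ quartic ⟧ (min∞ m σ)) →
             (∀ σ → IsSpace s σ → Sk + (Sm + (Ss + 12 * W)) ≤[ 300 ] min∞ m σ + ⌊log₂ m ⌋ + ⌊log₂ k ⌋) →
             Correct k m s
  conclude {Sk} {Sm} {Ss} {W} {ℓ} {n₀} {b} hm hs hw hk h in-time in-space =
    package (run lim₀ {ts = inputs M k m s} h models₀ fits₀ positions₀)
    where
    lim₀ = Sk ∷ Sm ∷ Ss ∷ Vec.replicate 12 W
    st₀ = Reduction.initial Claim {Sk} {Sm} {Ss} {W} {ℓ} {n₀} hm hs hw (binary k) (binary m) s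
    2≤W : 2 ≤ W
    2≤W = ≤-trans (≤-trans (m≤m+n 2 6) (m≤m+n 8 _)) hw
    models₀ : ∀ i → Represents (get i st₀) (move (if lookup kinds i then R else N) (lookup (inputs M k m s) i))
    models₀ zero                   = refl , sym (map-symbol-Bit (binary k))
    models₀ (suc zero)             = refl , sym (map-symbol-Bit (binary m))
    models₀ (suc (suc zero))       = refl , trans (sym (++-identityʳ _)) (encodeTerm-encode s [])
    models₀ (suc (suc (suc zero))) = refl
    models₀ (suc (suc (suc (suc i)))) = blank-models 11 i
    fits₀ : ∀ i → extent (get i st₀) ≤ lookup lim₀ i
    fits₀ zero                   = hk
    fits₀ (suc zero)             = ≤-trans (s≤s z≤n) hm
    fits₀ (suc (suc zero))       = ≤-trans (s≤s z≤n) hs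
    fits₀ (suc (suc (suc zero))) = 2≤W
    fits₀ (suc (suc (suc (suc i)))) = blank-fits 11 i 2≤W
    positions₀ : ∀ i → suc (length (Tape.left (lookup (inputs M k m s) i))) ≤ lookup lim₀ i
    positions₀ zero                   = hk
    positions₀ (suc zero)             = ≤-trans (s≤s z≤n) hm
    positions₀ (suc (suc zero))       = ≤-trans (s≤s z≤n) hs
    positions₀ (suc (suc (suc zero))) = ≤-trans (n≤1+n 1) 2≤W
    positions₀ (suc (suc (suc (suc i)))) = blank-positions 11 i (≤-trans (n≤1+n 1) 2≤W)
    outputs : ∀ {t st ts} → Models st ts → get out st ≡ output (revert t []) → Outputs M ts t
    outputs {t} {st} {ts@(_ ∷ _ ∷ _ ∷ o ∷ _)} models e =
      ≡-subst (λ tp → Holds tp (encodeTerm t)) (sym (represents {st} {ts} out models e)) (holds-output t)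
    package : Outcome lim₀ Claim (config nothing nothing (inputs M k m s)) (suc b) → Correct k m s
    package (outcome {time} {visited} {r} {ts} {st} halts t≤ v≤ models φ) =
      time , Vec.sum visited , r , ts , (visited , halts , refl) ,
      (λ σ e → ≤-trans t≤ (in-time σ e) , ≤-trans (sum-mono visited lim₀ v≤) (in-space σ e)) ,
      (λ { refl → let (t , e , rest) = φ in t , outputs {t} {st} {ts} models e , rest }) , (λ { refl → φ }) , (λ { refl → φ })

length-binary : ∀ n → length (binary (suc n)) ≤ suc ⌊log₂ suc n ⌋ × length (binary (suc n)) ≤ suc n
length-binary n with binary-suc n
... | b , bs , e , le , _ rewrite e = s≤s (length≤log le) , ≤-trans (n<2^n (length bs)) le

-- The time bound is a constant here, so the run has to end before m or `s` is looked at. The tape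
-- limits add up to 2 + 3 + 4 + 12 · 8 = 105.
zero-steps : ∀ m s → Correct 0 m s
zero-steps m s = conclude 0 m s {2} {3} {4} {8} {0} {0} {10} ≤-refl ≤-refl ≤-refl (s≤s z≤n)
  (Reduction.rejected Φ {2} {3} {4} {8} {0} {0} ≤-refl ≤-refl ≤-refl [] (binary m) s ≤-refl (m≤m+n 2 6) refl early)
  (λ _ _ → m≤m+n 11 289)
  (λ σ _ → ≤-trans (m≤m+n 105 195) (m≤n+m 300 (300 * (min∞ m σ + ⌊log₂ m ⌋ + ⌊log₂ 0 ⌋))))
  where
  Φ = Claim 0 m s
  early : ∀ st τ → IsTime s τ → fin 0 <∞ 3 *∞ τ +∞ 1
  early _ (fin j) _ = Strict.[ m≤n+m 1 (3 * j) ]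
  early _ ∞       _ = Strict.[ 0 ]<⊤⁺

-- Zero has no digits, so the read in advance fails at once, with a verdict that holds trivially.
-- The only real cost is reading k, whose length is at most k.
zero-space : ∀ k s → Correct (suc k) 0 s
zero-space k s = conclude (suc k) 0 s {2 + l} {3} {4} {8 + l} {0} {0} ≤-refl ≤-refl (m≤m+n 8 l) (s≤s z≤n)
  (Reduction.without-space Φ {2 + l} {3} {4} {8 + l} {0} {0} ≤-refl ≤-refl (m≤m+n 8 l) (binary (suc k)) [] s ≤-refl (m≤n+m (2 + l) 6) {b = 0} (value-binary (suc k)) refl small)
  (λ σ _ → in-time σ)
  (λ σ _ → in-space σ)
  where
  Φ = Claim (suc k) 0 s
  l = length (binary (suc k))
  small : ∀ st σ → IsSpace s σ → fin 0 ≤∞ 2 *∞ σ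
  small _ (fin n) _ = NonStrict.[ z≤n ]
  small _ ∞       _ = fin 0 NonStrict.≤⊤⁺
  in-time : ∀ σ → suc (l * 8 + (6 + (decrement-time (binary (suc k)) + (3 + 0)))) ≤[ 300 ] suc k * ⟦ quartic ⟧ (min∞ 0 σ)
  in-time σ = begin
    suc (l * 8 + (6 + (decrement-time (binary (suc k)) + 3)))  ≤⟨ s≤s (+-monoʳ-≤ (l * 8) (+-monoʳ-≤ 6 (+-monoˡ-≤ 3 (decrement-time-bound (binary (suc k)))))) ⟩
    suc (l * 8 + (6 + ((l * 8 + 20) + 3)))                     ≡⟨ lemma₁ l ⟩
    l * 16 + 30                                                ≤⟨ +-mono-≤ (*-monoˡ-≤ 16 (proj₂ (length-binary k))) (m≤m+n 30 270) ⟩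
    suc k * 16 + 300                                           ≤⟨ +-monoˡ-≤ 300 (≤-trans (m≤m+n (suc k * 16) (suc k * 284)) (≤-reflexive (lemma₂ (suc k)))) ⟩
    300 * (suc k * 1) + 300                                    ≤⟨ +-monoˡ-≤ 300 (*-monoʳ-≤ 300 (*-monoʳ-≤ (suc k) (⟦ quartic ⟧-mono (z≤n {min∞ 0 σ})))) ⟩
    300 * (suc k * ⟦ quartic ⟧ (min∞ 0 σ)) + 300               ∎
    where
    open ≤-Reasoning
    lemma₁ : ∀ l → suc (l * 8 + (6 + ((l * 8 + 20) + 3))) ≡ l * 16 + 30
    lemma₁ = solve-∀
    lemma₂ : ∀ k → k * 16 + k * 284 ≡ 300 * (k * 1)
    lemma₂ = solve-∀
  in-space : ∀ σ → 2 + l + (3 + (4 + 12 * (8 + l))) ≤[ 300 ] min∞ 0 σ + ⌊log₂ 0 ⌋ + ⌊log₂ suc k ⌋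
  in-space σ = begin
    2 + l + (3 + (4 + 12 * (8 + l)))                          ≡⟨ lemma₁ l ⟩
    l * 13 + 105                                              ≤⟨ +-monoˡ-≤ 105 (*-monoˡ-≤ 13 (proj₁ (length-binary k))) ⟩
    suc ⌊log₂ suc k ⌋ * 13 + 105                              ≤⟨ m≤m+n _ (⌊log₂ suc k ⌋ * 287 + 182) ⟩
    suc ⌊log₂ suc k ⌋ * 13 + 105 + (⌊log₂ suc k ⌋ * 287 + 182) ≡⟨ lemma₂ ⌊log₂ suc k ⌋ ⟩
    300 * ⌊log₂ suc k ⌋ + 300                                 ≤⟨ +-monoˡ-≤ 300 (*-monoʳ-≤ 300 (m≤n+m _ (min∞ 0 σ + ⌊log₂ 0 ⌋))) ⟩
    300 * (min∞ 0 σ + ⌊log₂ 0 ⌋ + ⌊log₂ suc k ⌋) + 300         ∎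
    where
    open ≤-Reasoning
    lemma₁ : ∀ l → 2 + l + (3 + (4 + 12 * (8 + l))) ≡ l * 13 + 105
    lemma₁ = solve-∀
    lemma₂ : ∀ x → suc x * 13 + 105 + (x * 287 + 182) ≡ 300 * x + 300
    lemma₂ = solve-∀

module _ (k m : ℕ) (s : Term) where

  private
    l ℓ B : ℕ
    l = length (binary (suc k))
    ℓ = length (proj₁ (proj₂ (binary-suc m)))
    B = 2 ^ ℓ
    B≤m : B ≤ suc m
    B≤m = proj₁ (proj₂ (proj₂ (proj₂ (binary-suc m))))
    m<2B : suc m < 2 * B
    m<2B = proj₂ (proj₂ (proj₂ (proj₂ (binary-suc m))))
    r₀ : Course B k [] s
    r₀ = course B k _ [] s ≤-refl
    -- The N of all preceding bounds. Completed terms are smaller than B, and a term that is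
    -- abandoned has been counted no further than that.
    top : ℕ
    top = B ⊓ (size s ⊔ peak r₀)
    Φ = Claim (suc k) (suc m) s
    w : ℕ
    w = 8 + (top + top + (top + top)) + l

    cap : ∀ n → n < B → n ≤ size s ⊔ peak r₀ → n ≤ top
    cap n n< n≤ = ⊓-glb (<⇒≤ n<) n≤

    -- Here the bounds on the run meet `Space`: a finite value dominates all sizes on the trace, and
    -- for a diverging term the comparison with m is all that is claimed.
    top≤ : ∀ σ → IsSpace s σ → top ≤ min∞ (suc m) σ
    top≤ (fin n) (_ , _ , d) = ⊓-mono-≤ B≤m (⊔-lub (size≤space d) (peak≤space r₀ d))
    top≤ ∞       _           = ≤-trans (m⊓n≤m B _) B≤m

    Hm : 3 + ℓ ≤ 3 + ℓ
    Hm = ≤-refl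
    Hs : 4 + (top + top) ≤ 4 + (top + top)
    Hs = ≤-refl
    Hw : 8 + (top + top + (top + top)) ≤ w
    Hw = m≤m+n _ l

    exceeded : (∀ {j n t} → s ⇓⟨ j , n ⟩ t → B ≤ n) → ∀ st → Φ spaceBoundReached st
    exceeded large _ (fin n) (_ , _ , d) = NonStrict.[ ≤-trans (<⇒≤ m<2B) (*-monoʳ-≤ 2 (large d)) ]
    exceeded large _ ∞       _           = fin (suc m) NonStrict.≤⊤⁺

    late : (∀ {j n t} → s ⇓⟨ j , n ⟩ t → k < 3 * j) → ∀ st → Φ spaceBoundNotReached st
    late after _ (fin j) (_ , _ , d) = Strict.[ ≤-trans (s≤s (after d)) (≤-reflexive (+-comm 1 (3 * j))) ]
    late after _ ∞       _           = Strict.[ suc k ]<⊤⁺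

    finished : ∀ {j n t} → s ⇓⟨ j , n ⟩ t → 3 * j ≤ k → n < B → ∀ st → get out st ≡ output (revert t []) → Φ term st
    finished {j} {n} {t} d le n< st e = t , e , (j , n , d) , small , soon
      where
      small : ∀ σ → IsSpace s σ → σ ≤∞ fin (suc m)
      small (fin _) (_ , _ , d′) = NonStrict.[ ≤-trans (≤-reflexive (sym (proj₂ (⇓-unique d d′)))) (≤-trans (<⇒≤ n<) B≤m) ]
      small ∞       none         = contradiction (t , j , n , d) none
      soon : ∀ τ → IsTime s τ → 3 *∞ τ +∞ 1 ≤∞ fin (suc k)
      soon (fin _) (_ , _ , d′) = NonStrict.[ ≤-trans (≤-reflexive (trans (cong (λ j → 3 * j + 1) (sym (proj₁ (⇓-unique d d′)))) (+-comm (3 * j) 1))) (s≤s le) ]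
      soon ∞       none         = contradiction (t , j , n , d) none

    open Reduction Φ {2 + l} {3 + ℓ} {4 + (top + top)} {w} {ℓ} {top} Hm Hs Hw using (Z; main-halts)

    time-left : ℕ
    time-left = (suc k * suc top) * Z + l * 8

    in-time′ : size s < B → moves r₀ * Z + (potential (decrement (binary (suc k))) + 0) ≤ time-left
    in-time′ s<B = +-mono-≤ (*-monoˡ-≤ Z (≤-trans (moves-bound r₀ (λ n n< n≤ → cap n n< (≤-trans n≤ (m≤n⊔m _ _))))
        (s≤s (+-monoˡ-≤ (k * suc top) (≤-trans (≤-reflexive (+-identityʳ _)) (cap _ s<B (m≤m⊔n _ _)))))))
      (≤-trans (≤-reflexive (+-identityʳ _)) (≤-trans (potential-bound (decrement (binary (suc k)))) (≤-reflexive (cong (_* 8) (length-decrement (binary (suc k)))))))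

  positive : Correct (suc k) (suc m) s
  positive = conclude (suc k) (suc m) s {2 + l} {3 + ℓ} {4 + (top + top)} {w} {ℓ} {top} Hm Hs Hw (s≤s z≤n)
    (main-halts (binary (suc k)) (binary (suc m)) s ≤-refl (+-mono-≤ (m≤m+n 2 (6 + (top + top + (top + top)))) (≤-refl {l}))
      {b = time-left} (value-binary (suc k)) (proj₁ (proj₂ (proj₂ (binary-suc m)))) refl r₀
      (λ B≤s → exceeded (λ d → ≤-trans B≤s (size≤space d)))
      (λ s<B → sound Φ {2 + l} {3 + ℓ} {4 + (top + top)} {w} {ℓ} {top} Hm Hs Hw r₀ (≤-trans (≤-reflexive (cong suc (+-identityʳ _))) s<B) finished late exceeded) cap in-time′)
    (λ σ e → in-time σ (top≤ σ e))
    (λ σ e → in-space σ (top≤ σ e))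
    where
    in-time : ∀ σ → top ≤ min∞ (suc m) σ →
              suc (l * 8 + (6 + (decrement-time (binary (suc k)) + (4 + ((top + 1 + (top + 1)) * (6 + (top * 8 + 20)) + (6 + ((top + top) * 4 + time-left)))))))
              ≤[ 300 ] suc k * ⟦ quartic ⟧ (min∞ (suc m) σ)
    in-time σ le = begin
      suc (l * 8 + (6 + (decrement-time (binary (suc k)) + (4 + (x + (6 + ((top + top) * 4 + time-left)))))))
        ≤⟨ s≤s (+-monoʳ-≤ (l * 8) (+-monoʳ-≤ 6 (+-monoˡ-≤ _ (decrement-time-bound (binary (suc k)))))) ⟩
      suc (l * 8 + (6 + ((l * 8 + 20) + (4 + (x + (6 + ((top + top) * 4 + time-left)))))))
        ≡⟨ lemma₁ l x ((top + top) * 4) ((suc k * suc top) * Z) ⟩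
      l * 24 + (37 + (x + ((top + top) * 4 + (suc k * suc top) * Z)))
        ≤⟨ +-monoˡ-≤ _ (*-monoˡ-≤ 24 (proj₂ (length-binary k))) ⟩
      suc k * 24 + (37 + (x + ((top + top) * 4 + (suc k * suc top) * Z)))
        ≤⟨ m≤m+n _ (rest k top) ⟩
      suc k * 24 + (37 + (x + ((top + top) * 4 + (suc k * suc top) * Z))) + rest k top
        ≡⟨ lemma₂ k top ⟩
      300 * (suc k * ⟦ quartic ⟧ top) + 300
        ≤⟨ +-monoˡ-≤ 300 (*-monoʳ-≤ 300 (*-monoʳ-≤ (suc k) (⟦ quartic ⟧-mono le))) ⟩
      300 * (suc k * ⟦ quartic ⟧ (min∞ (suc m) σ)) + 300
        ∎
      where
      open ≤-Reasoning
      x = (top + 1 + (top + 1)) * (6 + (top * 8 + 20))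
      -- The expanded difference of the two sides. That its coefficients are natural numbers is the
      -- whole inequality; for instance 268 = 300 - 32, where 32 is the leading coefficient of `Z`.
      rest : ℕ → ℕ → ℕ
      rest k n = 340 + n * (677 + n * (1316 + n * (1000 + n * 268)))
                 + k * (129 + n * (753 + n * (1332 + n * (1000 + n * 268))))
      lemma₁ : ∀ l x y z → suc (l * 8 + (6 + ((l * 8 + 20) + (4 + (x + (6 + (y + (z + l * 8)))))))) ≡ l * 24 + (37 + (x + (y + z)))
      lemma₁ = solve-∀
      lemma₂ : ∀ k n → suc k * 24 + (37 + ((n + 1 + (n + 1)) * (6 + (n * 8 + 20)) + ((n + n) * 4 + (suc k * suc n)
                 * (127 + ((n * 8 + 20) + (n + n) * (26 + ((n * 8 + 20) + (n * 8 + 20) + (60 + ((n * 8 + 20) + (n + n) * (10 + (n * 8 + 20)))))))))))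
               + (340 + n * (677 + n * (1316 + n * (1000 + n * 268))) + k * (129 + n * (753 + n * (1332 + n * (1000 + n * 268)))))
               ≡ 300 * (suc k * (1 + n * (4 + n * (6 + n * (4 + n * (1 + n * 0)))))) + 300
      lemma₂ = solve-∀
    in-space : ∀ σ → top ≤ min∞ (suc m) σ →
               2 + l + (3 + ℓ + (4 + (top + top) + 12 * w)) ≤[ 300 ] min∞ (suc m) σ + ⌊log₂ suc m ⌋ + ⌊log₂ suc k ⌋
    in-space σ le = begin
      2 + l + (3 + ℓ + (4 + (top + top) + 12 * w))            ≡⟨ lemma₁ l ℓ top ⟩
      l * 13 + (ℓ + (top * 50 + 105))                         ≤⟨ +-mono-≤ (*-monoˡ-≤ 13 (proj₁ (length-binary k))) (+-mono-≤ (length≤log {ℓ} B≤m) (+-monoˡ-≤ 105 (*-monoˡ-≤ 50 le))) ⟩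
      suc a * 13 + (b + (x * 50 + 105))                       ≤⟨ m≤m+n _ (a * 287 + (b * 299 + (x * 250 + 182))) ⟩
      suc a * 13 + (b + (x * 50 + 105)) + (a * 287 + (b * 299 + (x * 250 + 182))) ≡⟨ lemma₂ a b x ⟩
      300 * (x + b + a) + 300                                 ∎
      where
      open ≤-Reasoning
      a = ⌊log₂ suc k ⌋
      b = ⌊log₂ suc m ⌋
      x = min∞ (suc m) σ
      lemma₁ : ∀ l ℓ n → 2 + l + (3 + ℓ + (4 + (n + n) + 12 * (8 + (n + n + (n + n)) + l))) ≡ l * 13 + (ℓ + (n * 50 + 105))
      lemma₁ = solve-∀
      lemma₂ : ∀ a b x → suc a * 13 + (b + (x * 50 + 105)) + (a * 287 + (b * 299 + (x * 250 + 182))) ≡ 300 * (x + b + a) + 300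
      lemma₂ = solve-∀

theorem18 : ∃ λ (w : ℕ) → Σ (TM Verdict (4 + w)) λ M →
    ∃ λ (p : Polynomial) → ∃ λ (c : ℕ) →
    ∀ (k m : ℕ) (s : Term) →
    ∃ λ (time : ℕ) → ∃ λ (space : ℕ) → ∃ λ (r : Verdict) → ∃ λ (ts : Tapes M) →
    Halts M (inputs M k m s) time space r ts
    × (∀ σ → IsSpace s σ →
    (time ≤[ c ] k * ⟦ p ⟧ (min∞ m σ))
    × (space ≤[ c ] min∞ m σ + ⌊log₂ m ⌋ + ⌊log₂ k ⌋))
    × (r ≡ term →
    ∃ λ (t : Term) → Outputs M ts t × HasNormalForm s t
    × (∀ σ → IsSpace s σ → σ ≤∞ fin m)
    × (∀ τ → IsTime s τ → 3 *∞ τ +∞ 1 ≤∞ fin k))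
    × (r ≡ spaceBoundReached → ∀ σ → IsSpace s σ → fin m ≤∞ 2 *∞ σ)
    × (r ≡ spaceBoundNotReached → ∀ τ → IsTime s τ → fin k <∞ 3 *∞ τ +∞ 1)
theorem18 = 11 , M , quartic , 300 , correct
  where
  correct : ∀ k m s → Correct k m s
  correct zero    m       s = zero-steps m s
  correct (suc k) zero    s = zero-space k s
  correct (suc k) (suc m) s = positive k m s
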